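{- Let $q>2$ be a prime power and $u,v$ non-zero elements of $\mathbb{F}_q$. Write $\mathrm{Rad}(q-1)=k\,p_1\cdots p_s$, where $k$ is a (positive) divisor and $p_1,\dots,p_s$ are distinct primes, and set $\delta_4=1-4\sum_{i=1}^s\frac{1}{p_i}$. Suppose $\delta_4>0$. Set $\theta=\theta(k)$, $\tau=\tau(k)$, $W=W(k)$. Then $$N(q,u,v)\ge \delta_4\,\theta^3\cdot(q-1)\left\{\tau\, q-\theta W^3\sqrt{q}\right\}.$$
   Context: A primitive element of $\mathbb{F}_q$ is a generator of $\mathbb{F}_q^*$. For non-zero $u,v\in\mathbb{F}_q$, an ordered pair $(a,b)$ of primitive elements is $(u,v)$-primitive if $ua+vb$ and $va^{ -1}+ub^{ -1}$ are both primitive; $N(q,u,v)$ is the number of such pairs. $\mathrm{Rad}(m)$ is the product of the distinct primes dividing $m$. For a positive integer $m$: $\omega(m)$ is the number of distinct prime divisors of $m$, $W(m)=2^{\omega(m)}$, $\theta(m)=\phi(m)/m$, and $\tau(m)=\prod_{l\mid m}\left(1-\frac{1}{l-1}+\frac{1}{(l-1)^2}\right)$ over distinct primes $l\mid m$. -}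

module Defs where

open import Level using (0ℓ)
open import Data.Nat as ℕ using (ℕ; zero; suc; _∸_; _<_; _≤_)
open import Data.Nat.Primality using (Prime; prime?)
open import Data.Nat.Divisibility using (_∣_; _∣?_)
open import Data.Nat.GCD using (gcd)
open import Data.Fin using (Fin)
open import Data.List using (List; []; _∷_; map; filter; length; upTo; allFin; cartesianProduct; foldr)
open import Data.List.Relation.Unary.All using (All; all?)
open import Data.Integer using (+_)
open import Data.Rational using (ℚ; _/_; 0ℚ; 1ℚ)
import Data.Rational as Q
open import Data.Product using (_×_; _,_; Σ; proj₁; proj₂)
open import Relation.Binary.PropositionalEquality using (_≡_; _≢_)
open import Relation.Binary.Definitions using (DecidableEquality)
open import Relation.Nullary using (Dec; ¬?)
open import Relation.Nullary.Decidable using (_×-dec_)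
open import Algebra.Structures using (IsCommutativeRing)
open import Function.Bundles using (_↔_; Inverse)

IsPrimePower : ℕ → Set
IsPrimePower q = Σ ℕ λ p → Σ ℕ λ e → Prime p × (1 ≤ e) × (q ≡ p ℕ.^ e)

primeDivisors : ℕ → List ℕ
primeDivisors m = filter (λ p → prime? p ×-dec (p ∣? m)) (upTo (suc m))

Rad : ℕ → ℕ
Rad m = foldr ℕ._*_ 1 (primeDivisors m)

ω : ℕ → ℕ
ω m = length (primeDivisors m)

W : ℕ → ℕ
W m = 2 ℕ.^ ω m

φ : ℕ → ℕ
φ m = length (filter (λ i → gcd (suc i) m ℕ.≟ 1) (upTo m))

-- the rational number a / b  (b ≥ 1 in all uses; 0 if b = 0)
frac : ℕ → ℕ → ℚ
frac a zero    = 0ℚ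
frac a (suc b) = (+ a) / suc b

ofℕ : ℕ → ℚ
ofℕ a = frac a 1

prodℚ : List ℚ → ℚ
prodℚ = foldr Q._*_ 1ℚ

sumℚ : List ℚ → ℚ
sumℚ = foldr Q._+_ 0ℚ

θ : ℕ → ℚ
θ m = frac (φ m) m

τ : ℕ → ℚ
τ m = prodℚ (map (λ l → (1ℚ Q.- frac 1 (l ∸ 1)) Q.+ frac 1 ((l ∸ 1) ℕ.* (l ∸ 1))) (primeDivisors m))

record FiniteField (q : ℕ) : Set₁ where
  infixl 7 _*_
  infixl 6 _+_
  field
    Carrier : Set
    _+_ _*_ : Carrier → Carrier → Carrier
    -_      : Carrier → Carrier
    0# 1#   : Carrier
    _⁻¹     : Carrier → Carrier
    isCommutativeRing : IsCommutativeRing _≡_ _+_ _*_ -_ 0# 1#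
    0≢1     : 0# ≢ 1#
    inverseʳ : ∀ x → x ≢ 0# → x * (x ⁻¹) ≡ 1#
    _≟_     : DecidableEquality Carrier
    enum    : Fin q ↔ Carrier

  elements : List Carrier
  elements = map (Inverse.to enum) (allFin q)

  _^_ : Carrier → ℕ → Carrier
  x ^ zero  = 1#
  x ^ suc n = x * (x ^ n)

  -- a is primitive: a generates F_q^*, i.e. a ≠ 0 and a has multiplicative
  -- order exactly q - 1:  a^m ≠ 1 for 1 ≤ m ≤ q - 2
  Primitive : Carrier → Set
  Primitive a = a ≢ 0# × All (λ m → a ^ suc m ≢ 1#) (upTo (q ∸ 2))

  primitive? : (a : Carrier) → Dec (Primitive a)
  primitive? a = ¬? (a ≟ 0#) ×-dec all? (λ m → ¬? ((a ^ suc m) ≟ 1#)) (upTo (q ∸ 2))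

  UVPrimitive : Carrier → Carrier → Carrier × Carrier → Set
  UVPrimitive u v (a , b) =
    Primitive a × Primitive b × Primitive (u * a + v * b)
      × Primitive (v * (a ⁻¹) + u * (b ⁻¹))

  uvPrimitive? : (u v : Carrier) → (ab : Carrier × Carrier) → Dec (UVPrimitive u v ab)
  uvPrimitive? u v (a , b) =
    primitive? a ×-dec primitive? b ×-dec primitive? (u * a + v * b)
      ×-dec primitive? (v * (a ⁻¹) + u * (b ⁻¹))

  N : Carrier → Carrier → ℕ
  N u v = length (filter (uvPrimitive? u v) (cartesianProduct elements elements))

-- Put b = a t and w = u + v t.  Then u a + v b = a w and v / a + u / b = w / (a t), so for fixed t the four
-- conditions are conditions on the classes of a modulo l-th powers, one prime l ∣ q - 1 at a time.
-- Averaging over a makes the classes at different primes independent, hence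
--   N = (q - 1) ∑_t ∏_l m_l (t , w),
-- where m_l (t , w), the proportion of admissible classes of a, depends on the classes of t and w only.
-- At the sieving primes p = pᵢ one has m_p ≥ 1 - 4 / p, which produces the factor δ₄.
-- At the primes l ∣ k one expands ∏ (mean + deviation).  The sum over t of a product of deviations
-- over a nonempty set D of primes is bounded without characters, by the duality form of the large sieve:
-- the deviations are reproduced by the kernel ∏_{l ∈ D} (l² [x = y = 1] - 1), and after Cauchy-Schwarz the
-- remaining double sum over t , t′ is evaluated exactly, because (t , t′) ↦ (t′ / t , w′ / w) is a bijection
-- from the pairs t ≢ t′ onto the pairs x ≢ y with x , y ≢ 1.  This gives √q ∏ spread, where the spread satisfies
-- (l² - 1) variance ≤ spread² and mean + spread = 8 θ(l)⁴, and the expansion resums to θ³ τ q - θ⁴ W³ √q.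
module Submission where

-- The direct route expands each condition in multiplicative characters and bounds Jacobi sums,
-- whose values lie in cyclotomic fields. Here everything stays in ℚ: l² [x = y = 1] - 1 is the sum
-- of all nontrivial characters of the group of pairs of l-th roots of unity, so the kernels carry
-- the characters only through their total, and Cauchy-Schwarz takes the place of |J| = √q. Even √q
-- is not formed: the bound is shown for every rational s ≥ 0 with q ≤ s², and s may tend to √q.
--
-- Two places are tight. The spread at l is dictated by the target θ⁴ W³, and its inequality with
-- the variance is an equality at l = 2; so the count of admissible classes has to be estimated
-- sharply enough to lose nothing there. And only q - 2 values of t have t and w nonzero, which
-- costs 2 θ³ τ in the main term. This is recovered because θ⁴ W³ √q also contains the term θ³ τ √q
-- of the empty set D, where no error arises. The exchange is favourable when √q ≥ 2, which is why q
-- = 3 is treated by hand.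

-- Casts, reciprocals and inequalities in ℚ.

module Rationals where

  open import Defs using (frac; ofℕ)
  open import Data.Nat as ℕ using (ℕ; zero; suc)
  import Data.Nat.Properties as ℕₚ
  open import Data.Integer as ℤ using (+_)
  import Data.Integer.Properties as ℤₚ
  open import Data.Rational
  open import Data.Rational.Properties
  import Data.Rational.Unnormalised as U
  import Data.Rational.Unnormalised.Properties as Uₚ
  open import Data.Rational.Solver
  open import Data.Empty using (⊥-elim)
  open import Data.Sum using (inj₁; inj₂)
  open import Relation.Nullary using (yes; no)
  open import Relation.Binary.PropositionalEquality
  open +-*-Solver

  -- Opaque, so that conversion checking never unfolds the normalisation of fractions.
  opaque

    cast : ℕ → ℚ
    cast = ofℕ

    inv : ℕ → ℚ
    inv = frac 1

    cast≡ofℕ : ∀ a → cast a ≡ ofℕ a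
    cast≡ofℕ a = refl

    inv≡frac : ∀ a → inv a ≡ frac 1 a
    inv≡frac a = refl

    frac-toℚᵘ : ∀ a b → toℚᵘ (frac a (suc b)) U.≃ U.mkℚᵘ (+ a) b
    frac-toℚᵘ a b = toℚᵘ-fromℚᵘ (U.mkℚᵘ (+ a) b)

    cast-+ : ∀ a b → cast (a ℕ.+ b) ≡ cast a + cast b
    cast-+ a b = toℚᵘ-injective (Uₚ.≃-trans (frac-toℚᵘ (a ℕ.+ b) 0) (Uₚ.≃-trans
      (U.*≡* (cong (ℤ._* + 1) (trans (ℤₚ.pos-+ a b) (sym (cong₂ ℤ._+_ (ℤₚ.*-identityʳ (+ a)) (ℤₚ.*-identityʳ (+ b)))))))
      (Uₚ.≃-trans (Uₚ.+-cong (Uₚ.≃-sym (frac-toℚᵘ a 0)) (Uₚ.≃-sym (frac-toℚᵘ b 0)))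
        (Uₚ.≃-sym (toℚᵘ-homo-+ (ofℕ a) (ofℕ b))))))

    cast-* : ∀ a b → cast (a ℕ.* b) ≡ cast a * cast b
    cast-* a b = toℚᵘ-injective (Uₚ.≃-trans (frac-toℚᵘ (a ℕ.* b) 0) (Uₚ.≃-trans
      (U.*≡* (cong (ℤ._* + 1) (ℤₚ.pos-* a b)))
      (Uₚ.≃-trans (Uₚ.*-cong (Uₚ.≃-sym (frac-toℚᵘ a 0)) (Uₚ.≃-sym (frac-toℚᵘ b 0)))
        (Uₚ.≃-sym (toℚᵘ-homo-* (ofℕ a) (ofℕ b))))))

    frac≡cast*inv : ∀ a b → frac a (suc b) ≡ cast a * inv (suc b)
    frac≡cast*inv a b = toℚᵘ-injective (Uₚ.≃-trans (frac-toℚᵘ a b) (Uₚ.≃-trans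
      (U.*≡* (trans (cong (λ x → + a ℤ.* + suc x) (ℕₚ.+-identityʳ b)) (cong (ℤ._* + suc b) (sym (ℤₚ.*-identityʳ (+ a))))))
      (Uₚ.≃-trans (Uₚ.*-cong (Uₚ.≃-sym (frac-toℚᵘ a 0)) (Uₚ.≃-sym (frac-toℚᵘ 1 b)))
        (Uₚ.≃-sym (toℚᵘ-homo-* (ofℕ a) (frac 1 (suc b)))))))

    frac-self : ∀ b → frac (suc b) (suc b) ≡ 1ℚ
    frac-self b = toℚᵘ-injective (Uₚ.≃-trans (frac-toℚᵘ (suc b) b)
      (U.*≡* (trans (ℤₚ.*-identityʳ (+ suc b)) (sym (ℤₚ.*-identityˡ (+ suc b))))))

    cast*inv : ∀ {b} → 1 ℕ.≤ b → cast b * inv b ≡ 1ℚ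
    cast*inv {suc b} _ = trans (sym (frac≡cast*inv (suc b) b)) (frac-self b)

    0≤frac : ∀ a b → 0ℚ ≤ frac a b
    0≤frac a zero    = ≤-refl
    0≤frac a (suc b) = nonNegative⁻¹ (frac a (suc b)) {{normalize-nonNeg a (suc b)}}

    0≤cast : ∀ a → 0ℚ ≤ cast a
    0≤cast a = 0≤frac a 1

    0≤inv : ∀ a → 0ℚ ≤ inv a
    0≤inv a = 0≤frac 1 a

    cast-0 : cast 0 ≡ 0ℚ
    cast-0 = refl

    cast-1 : cast 1 ≡ 1ℚ
    cast-1 = refl

  p≤p+q : ∀ p {q} → 0ℚ ≤ q → p ≤ p + q
  p≤p+q p {q} 0≤q = subst (_≤ p + q) (+-identityʳ p) (+-monoʳ-≤ p 0≤q)

  cast-mono : ∀ {a b} → a ℕ.≤ b → cast a ≤ cast b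
  cast-mono {a} {b} a≤b = subst (cast a ≤_) (trans (sym (cast-+ a (b ℕ.∸ a))) (cong cast (ℕₚ.m+[n∸m]≡n a≤b)))
    (p≤p+q (cast a) (0≤cast (b ℕ.∸ a)))

  cast-suc : ∀ a → cast (suc a) ≡ 1ℚ + cast a
  cast-suc a = trans (cast-+ 1 a) (cong (_+ cast a) cast-1)

  0≤1 : 0ℚ ≤ 1ℚ
  0≤1 = subst (0ℚ ≤_) cast-1 (0≤cast 1)

  *-monoˡ : ∀ {c p q} → 0ℚ ≤ c → p ≤ q → c * p ≤ c * q
  *-monoˡ {c} 0≤c p≤q = *-monoˡ-≤-nonNeg c {{nonNegative 0≤c}} p≤q

  *-monoʳ : ∀ {c p q} → 0ℚ ≤ c → p ≤ q → p * c ≤ q * c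
  *-monoʳ {c} 0≤c p≤q = *-monoʳ-≤-nonNeg c {{nonNegative 0≤c}} p≤q

  0≤* : ∀ {p q} → 0ℚ ≤ p → 0ℚ ≤ q → 0ℚ ≤ p * q
  0≤* {p} {q} 0≤p 0≤q = subst (_≤ p * q) (*-zeroʳ p) (*-monoˡ 0≤p 0≤q)

  *-mono : ∀ {p q r s} → 0ℚ ≤ p → 0ℚ ≤ s → p ≤ q → r ≤ s → p * r ≤ q * s
  *-mono 0≤p 0≤s p≤q r≤s = ≤-trans (*-monoˡ 0≤p r≤s) (*-monoʳ 0≤s p≤q)

  0≤+ : ∀ {p q} → 0ℚ ≤ p → 0ℚ ≤ q → 0ℚ ≤ p + q
  0≤+ {p} {q} 0≤p 0≤q = ≤-trans 0≤p (p≤p+q p 0≤q)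

  ≤⇒0≤- : ∀ {p q} → p ≤ q → 0ℚ ≤ q - p
  ≤⇒0≤- {p} {q} p≤q = subst (_≤ q - p) (+-inverseʳ p) (+-monoˡ-≤ (- p) p≤q)

  0≤-⇒≤ : ∀ {p q} → 0ℚ ≤ q - p → p ≤ q
  0≤-⇒≤ {p} {q} h = subst₂ _≤_ (+-identityˡ p) (solve 2 (λ p q → (q :- p) :+ p := q) refl p q) (+-monoˡ-≤ p h)

  ≤-by-difference : ∀ {p q d} → 0ℚ ≤ d → q - p ≡ d → p ≤ q
  ≤-by-difference 0≤d e = 0≤-⇒≤ (subst (0ℚ ≤_) (sym e) 0≤d)

  0≤p² : ∀ p → 0ℚ ≤ p * p
  0≤p² p with ≤-total 0ℚ p
  ... | inj₁ 0≤p = 0≤* 0≤p 0≤p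
  ... | inj₂ p≤0 = subst (0ℚ ≤_) (solve 1 (λ p → (:- p) :* (:- p) := p :* p) refl p)
                     (0≤* (neg-antimono-≤ p≤0) (neg-antimono-≤ p≤0))

  sq-cancel-≤ : ∀ {p q} → 0ℚ ≤ q → p * p ≤ q * q → p ≤ q
  sq-cancel-≤ {p} {q} 0≤q pp≤qq with p ≤? q
  ... | yes p≤q = p≤q
  ... | no p≰q = ⊥-elim (<-irrefl refl (<-≤-trans
          (≤-<-trans (*-monoˡ 0≤q (<⇒≤ q<p)) (*-monoˡ-<-pos′ q<p)) pp≤qq))
    where
    q<p = ≰⇒> p≰q
    *-monoˡ-<-pos′ : ∀ {r} → r < p → r * p < p * p
    *-monoˡ-<-pos′ r<p = *-monoˡ-<-pos p {{positive (≤-<-trans 0≤q q<p)}} r<p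

  sq-cancel-≥ : ∀ {p q} → 0ℚ ≤ q → p * p ≤ q * q → - q ≤ p
  sq-cancel-≥ {p} {q} 0≤q h = subst (- q ≤_) (neg-involutive p) (neg-antimono-≤ (sq-cancel-≤ 0≤q
      (subst (_≤ q * q) (solve 1 (λ p → p :* p := (:- p) :* (:- p)) refl p) h)))
    where
    neg-involutive : ∀ p → - - p ≡ p
    neg-involutive = solve 1 (λ p → :- (:- p) := p) refl

-- Finite sums and products over lists, reindexing, Cauchy-Schwarz.

module FiniteSums where

  open import Defs using (prodℚ; sumℚ)
  open import Data.Rational
  open import Data.Rational.Properties
  open import Data.Rational.Solver
  open import Data.List using (List; []; _∷_; _++_; map; filter; length; cartesianProduct)
  open import Data.List.Membership.Propositional using (_∈_)
  open import Data.List.Membership.Propositional.Properties using (∈-map⁺; ∈-map⁻)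
  open import Data.List.Membership.Propositional.Properties.WithK using (unique∧set⇒bag)
  open import Data.List.Relation.Binary.BagAndSetEquality using (∼bag⇒↭)
  open import Data.List.Relation.Binary.Permutation.Propositional using (_↭_; prep; swap) renaming (refl to ↭refl; trans to ↭trans)
  open import Data.List.Relation.Unary.All as All using (All; []; _∷_)
  open import Data.List.Relation.Unary.Any using (here; there)
  open import Data.List.Relation.Unary.AllPairs using ([]; _∷_)
  open import Data.List.Relation.Unary.Unique.Propositional using (Unique)
  open import Data.Product using (_×_; _,_)
  open import Data.Empty using (⊥-elim)
  open import Function using (_∘_; mk⇔)
  open import Relation.Nullary using (Dec; yes; no)
  open import Relation.Unary using (Decidable)
  open import Relation.Binary.Definitions using (DecidableEquality)
  open import Relation.Binary.PropositionalEquality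
  open Rationals
  open +-*-Solver

  private variable
    A B : Set

  ∑ : List A → (A → ℚ) → ℚ
  ∑ xs f = sumℚ (map f xs)

  ∏ : List A → (A → ℚ) → ℚ
  ∏ xs f = prodℚ (map f xs)

  𝟙 : {P : Set} → Dec P → ℚ
  𝟙 (yes _) = 1ℚ
  𝟙 (no  _) = 0ℚ

  ∑-cong : ∀ (xs : List A) {f g : A → ℚ} → (∀ {x} → x ∈ xs → f x ≡ g x) → ∑ xs f ≡ ∑ xs g
  ∑-cong []       e = refl
  ∑-cong (x ∷ xs) e = cong₂ _+_ (e (here refl)) (∑-cong xs (e ∘ there))

  ∏-cong : ∀ (xs : List A) {f g : A → ℚ} → (∀ {x} → x ∈ xs → f x ≡ g x) → ∏ xs f ≡ ∏ xs g
  ∏-cong []       e = refl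
  ∏-cong (x ∷ xs) e = cong₂ _*_ (e (here refl)) (∏-cong xs (e ∘ there))

  ∑-+ : ∀ (xs : List A) (f g : A → ℚ) → ∑ xs (λ x → f x + g x) ≡ ∑ xs f + ∑ xs g
  ∑-+ []       f g = refl
  ∑-+ (x ∷ xs) f g = trans (cong (f x + g x +_) (∑-+ xs f g))
    (solve 4 (λ a b c d → (a :+ b) :+ (c :+ d) := (a :+ c) :+ (b :+ d)) refl (f x) (g x) (∑ xs f) (∑ xs g))

  ∏-* : ∀ (xs : List A) (f g : A → ℚ) → ∏ xs (λ x → f x * g x) ≡ ∏ xs f * ∏ xs g
  ∏-* []       f g = refl
  ∏-* (x ∷ xs) f g = trans (cong (f x * g x *_) (∏-* xs f g))
    (solve 4 (λ a b c d → (a :* b) :* (c :* d) := (a :* c) :* (b :* d)) refl (f x) (g x) (∏ xs f) (∏ xs g))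

  ∑-*ˡ : ∀ (xs : List A) c (f : A → ℚ) → ∑ xs (λ x → c * f x) ≡ c * ∑ xs f
  ∑-*ˡ []       c f = sym (*-zeroʳ c)
  ∑-*ˡ (x ∷ xs) c f = trans (cong (c * f x +_) (∑-*ˡ xs c f)) (sym (*-distribˡ-+ c (f x) (∑ xs f)))

  ∑-*ʳ : ∀ (xs : List A) c (f : A → ℚ) → ∑ xs (λ x → f x * c) ≡ ∑ xs f * c
  ∑-*ʳ xs c f = trans (∑-cong xs λ {x} _ → *-comm (f x) c) (trans (∑-*ˡ xs c f) (*-comm c (∑ xs f)))

  ∑-neg : ∀ (xs : List A) (f : A → ℚ) → ∑ xs (λ x → - f x) ≡ - ∑ xs f
  ∑-neg []       f = refl
  ∑-neg (x ∷ xs) f = trans (cong (- f x +_) (∑-neg xs f)) (sym (neg-distrib-+ (f x) (∑ xs f)))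

  ∑-- : ∀ (xs : List A) (f g : A → ℚ) → ∑ xs (λ x → f x - g x) ≡ ∑ xs f - ∑ xs g
  ∑-- xs f g = trans (∑-+ xs f (λ x → - g x)) (cong (∑ xs f +_) (∑-neg xs g))

  ∑-const : ∀ (xs : List A) c → ∑ xs (λ _ → c) ≡ cast (length xs) * c
  ∑-const []       c = sym (trans (cong (_* c) cast-0) (*-zeroˡ c))
  ∑-const (x ∷ xs) c = trans (cong (c +_) (∑-const xs c))
    (trans (solve 2 (λ c n → c :+ n :* c := (con 1ℚ :+ n) :* c) refl c (cast (length xs)))
      (cong (_* c) (sym (cast-suc (length xs)))))

  ∑-zero : ∀ (xs : List A) {f : A → ℚ} → (∀ {x} → x ∈ xs → f x ≡ 0ℚ) → ∑ xs f ≡ 0ℚ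
  ∑-zero xs e = trans (∑-cong xs e) (trans (∑-const xs 0ℚ) (*-zeroʳ (cast (length xs))))

  ∑-mono : ∀ (xs : List A) {f g : A → ℚ} → (∀ {x} → x ∈ xs → f x ≤ g x) → ∑ xs f ≤ ∑ xs g
  ∑-mono []       h = ≤-refl
  ∑-mono (x ∷ xs) h = +-mono-≤ (h (here refl)) (∑-mono xs (h ∘ there))

  0≤∑ : ∀ (xs : List A) {f : A → ℚ} → (∀ {x} → x ∈ xs → 0ℚ ≤ f x) → 0ℚ ≤ ∑ xs f
  0≤∑ []       h = ≤-refl
  0≤∑ (x ∷ xs) h = 0≤+ (h (here refl)) (0≤∑ xs (h ∘ there))

  0≤∏ : ∀ (xs : List A) {f : A → ℚ} → (∀ {x} → x ∈ xs → 0ℚ ≤ f x) → 0ℚ ≤ ∏ xs f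
  0≤∏ []       h = 0≤1
  0≤∏ (x ∷ xs) h = 0≤* (h (here refl)) (0≤∏ xs (h ∘ there))

  ∏-mono : ∀ (xs : List A) {f g : A → ℚ} → (∀ {x} → x ∈ xs → 0ℚ ≤ f x) →
           (∀ {x} → x ∈ xs → f x ≤ g x) → ∏ xs f ≤ ∏ xs g
  ∏-mono []       0≤f f≤g = ≤-refl
  ∏-mono (x ∷ xs) 0≤f f≤g = *-mono (0≤f (here refl))
    (≤-trans (0≤∏ xs (0≤f ∘ there)) (∏-mono xs (0≤f ∘ there) (f≤g ∘ there)))
    (f≤g (here refl)) (∏-mono xs (0≤f ∘ there) (f≤g ∘ there))

  ∑-swap : ∀ (xs : List A) (ys : List B) (f : A → B → ℚ) →
           ∑ xs (λ x → ∑ ys (f x)) ≡ ∑ ys (λ y → ∑ xs (λ x → f x y))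
  ∑-swap []       ys f = sym (∑-zero ys λ _ → refl)
  ∑-swap (x ∷ xs) ys f = trans (cong (∑ ys (f x) +_) (∑-swap xs ys f))
    (sym (∑-+ ys (f x) (λ y → ∑ xs (λ x → f x y))))

  ∑-++ : ∀ (xs ys : List A) (f : A → ℚ) → ∑ (xs ++ ys) f ≡ ∑ xs f + ∑ ys f
  ∑-++ []       ys f = sym (+-identityˡ _)
  ∑-++ (x ∷ xs) ys f = trans (cong (f x +_) (∑-++ xs ys f)) (sym (+-assoc (f x) _ _))

  ∏-++ : ∀ (xs ys : List A) (f : A → ℚ) → ∏ (xs ++ ys) f ≡ ∏ xs f * ∏ ys f
  ∏-++ []       ys f = sym (*-identityˡ _)
  ∏-++ (x ∷ xs) ys f = trans (cong (f x *_) (∏-++ xs ys f)) (sym (*-assoc (f x) _ _))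

  ∑-map : ∀ (g : A → B) (xs : List A) (f : B → ℚ) → ∑ (map g xs) f ≡ ∑ xs (f ∘ g)
  ∑-map g []       f = refl
  ∑-map g (x ∷ xs) f = cong (f (g x) +_) (∑-map g xs f)

  ∑-cartesianProduct : ∀ (xs : List A) (ys : List B) (f : A × B → ℚ) →
                       ∑ (cartesianProduct xs ys) f ≡ ∑ xs (λ x → ∑ ys (λ y → f (x , y)))
  ∑-cartesianProduct []       ys f = refl
  ∑-cartesianProduct (x ∷ xs) ys f = trans (∑-++ (map (x ,_) ys) (cartesianProduct xs ys) f)
    (cong₂ _+_ (∑-map (x ,_) ys f) (∑-cartesianProduct xs ys f))

  ∑-filter : ∀ {P : A → Set} (P? : Decidable P) (xs : List A) (f : A → ℚ) →
             ∑ (filter P? xs) f ≡ ∑ xs (λ x → 𝟙 (P? x) * f x)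
  ∑-filter P? []       f = refl
  ∑-filter P? (x ∷ xs) f with P? x
  ... | yes _ = cong₂ _+_ (sym (*-identityˡ (f x))) (∑-filter P? xs f)
  ... | no  _ = trans (∑-filter P? xs f)
    (sym (trans (cong (_+ ∑ xs (λ x → 𝟙 (P? x) * f x)) (*-zeroˡ (f x))) (+-identityˡ _)))

  length-∑ : ∀ (xs : List A) → cast (length xs) ≡ ∑ xs (λ _ → 1ℚ)
  length-∑ xs = sym (trans (∑-const xs 1ℚ) (*-identityʳ (cast (length xs))))

  ∑-↭ : ∀ {xs ys : List A} (f : A → ℚ) → xs ↭ ys → ∑ xs f ≡ ∑ ys f
  ∑-↭ f ↭refl        = refl
  ∑-↭ f (prep x p)   = cong (f x +_) (∑-↭ f p)
  ∑-↭ f (swap {xs} {ys} x y p) = trans (cong (λ z → f x + (f y + z)) (∑-↭ f p))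
    (solve 3 (λ a b c → a :+ (b :+ c) := b :+ (a :+ c)) refl (f x) (f y) (∑ ys f))
  ∑-↭ f (↭trans p q) = trans (∑-↭ f p) (∑-↭ f q)

  ∏-↭ : ∀ {xs ys : List A} (f : A → ℚ) → xs ↭ ys → ∏ xs f ≡ ∏ ys f
  ∏-↭ f ↭refl        = refl
  ∏-↭ f (prep x p)   = cong (f x *_) (∏-↭ f p)
  ∏-↭ f (swap {xs} {ys} x y p) = trans (cong (λ z → f x * (f y * z)) (∏-↭ f p))
    (solve 3 (λ a b c → a :* (b :* c) := b :* (a :* c)) refl (f x) (f y) (∏ ys f))
  ∏-↭ f (↭trans p q) = trans (∏-↭ f p) (∏-↭ f q)

  unique-↭ : ∀ {xs ys : List A} → Unique xs → Unique ys →
             (∀ {x} → x ∈ xs → x ∈ ys) → (∀ {x} → x ∈ ys → x ∈ xs) → xs ↭ ys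
  unique-↭ uxs uys f g = ∼bag⇒↭ (unique∧set⇒bag uxs uys (mk⇔ f g))

  unique-map : ∀ (σ : A → B) {xs : List A} → (∀ {x y} → x ∈ xs → y ∈ xs → σ x ≡ σ y → x ≡ y) →
               Unique xs → Unique (map σ xs)
  unique-map σ inj [] = []
  unique-map σ {x ∷ xs} inj (x∉ ∷ uxs) = All.tabulate ≢-image ∷ unique-map σ (λ p q → inj (there p) (there q)) uxs
    where
    ≢-image : ∀ {y} → y ∈ map σ xs → σ x ≢ y
    ≢-image y∈ σx≡y with ∈-map⁻ σ y∈
    ... | z , z∈ , y≡σz = All.lookup x∉ z∈ (inj (here refl) (there z∈) (trans σx≡y y≡σz))

  map-↭ : ∀ {xs : List A} {ys : List B} (σ : A → B) (τ : B → A) → Unique xs → Unique ys →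
          (∀ {x} → x ∈ xs → σ x ∈ ys) → (∀ {y} → y ∈ ys → τ y ∈ xs) →
          (∀ {x} → x ∈ xs → τ (σ x) ≡ x) → (∀ {y} → y ∈ ys → σ (τ y) ≡ y) → map σ xs ↭ ys
  map-↭ {xs = xs} {ys} σ τ uxs uys σ∈ τ∈ τσ στ = unique-↭
    (unique-map σ (λ x∈ y∈ e → trans (sym (τσ x∈)) (trans (cong τ e) (τσ y∈))) uxs) uys to from
    where
    to : ∀ {y} → y ∈ map σ xs → y ∈ ys
    to y∈ with ∈-map⁻ σ y∈
    ... | x , x∈ , refl = σ∈ x∈
    from : ∀ {y} → y ∈ ys → y ∈ map σ xs
    from y∈ = subst (_∈ map σ xs) (στ y∈) (∈-map⁺ σ (τ∈ y∈))

  ∑-reindex : ∀ {xs : List A} {ys : List B} (σ : A → B) (τ : B → A) → Unique xs → Unique ys →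
              (∀ {x} → x ∈ xs → σ x ∈ ys) → (∀ {y} → y ∈ ys → τ y ∈ xs) →
              (∀ {x} → x ∈ xs → τ (σ x) ≡ x) → (∀ {y} → y ∈ ys → σ (τ y) ≡ y) →
              (f : B → ℚ) → ∑ xs (f ∘ σ) ≡ ∑ ys f
  ∑-reindex {xs = xs} σ τ uxs uys σ∈ τ∈ τσ στ f =
    trans (sym (∑-map σ xs f)) (∑-↭ f (map-↭ σ τ uxs uys σ∈ τ∈ τσ στ))

  module _ (_≟A_ : DecidableEquality A) where

    𝟙-refl : ∀ x → 𝟙 (x ≟A x) ≡ 1ℚ
    𝟙-refl x with x ≟A x
    ... | yes _   = refl
    ... | no  x≢x = ⊥-elim (x≢x refl)

    𝟙-≢ : ∀ {x y} → x ≢ y → 𝟙 (x ≟A y) ≡ 0ℚ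
    𝟙-≢ {x} {y} x≢y with x ≟A y
    ... | yes x≡y = ⊥-elim (x≢y x≡y)
    ... | no  _   = refl

    ∑-δ : ∀ {xs : List A} {a} (f : A → ℚ) → Unique xs → a ∈ xs → ∑ xs (λ x → 𝟙 (x ≟A a) * f x) ≡ f a
    ∑-δ {x ∷ xs} {a} f (x∉ ∷ u) (here refl) = trans
      (cong₂ _+_ (trans (cong (_* f a) (𝟙-refl a)) (*-identityˡ (f a)))
        (∑-zero xs λ {y} y∈ → trans (cong (_* f y) (𝟙-≢ λ e → All.lookup x∉ y∈ (sym e))) (*-zeroˡ (f y))))
      (+-identityʳ (f a))
    ∑-δ {x ∷ xs} {a} f (x∉ ∷ u) (there a∈) = trans
      (cong₂ _+_ (trans (cong (_* f x) (𝟙-≢ (All.lookup x∉ a∈))) (*-zeroˡ (f x))) (∑-δ f u a∈))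
      (+-identityˡ (f a))

    ∑-δ₁ : ∀ {xs : List A} {a} → Unique xs → a ∈ xs → ∑ xs (λ x → 𝟙 (x ≟A a)) ≡ 1ℚ
    ∑-δ₁ {xs} {a} u a∈ = trans (∑-cong xs λ {x} _ → sym (*-identityʳ (𝟙 (x ≟A a)))) (∑-δ (λ _ → 1ℚ) u a∈)

  𝟙-sym : ∀ {P Q : Set} (p : Dec P) (q : Dec Q) → (P → Q) → (Q → P) → 𝟙 p ≡ 𝟙 q
  𝟙-sym (yes p) (yes q) f g = refl
  𝟙-sym (yes p) (no ¬q) f g = ⊥-elim (¬q (f p))
  𝟙-sym (no ¬p) (yes q) f g = ⊥-elim (¬p (g q))
  𝟙-sym (no ¬p) (no ¬q) f g = refl

  0≤𝟙 : ∀ {P : Set} (p : Dec P) → 0ℚ ≤ 𝟙 p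
  0≤𝟙 (yes _) = 0≤1
  0≤𝟙 (no  _) = ≤-refl

  -- Lagrange's identity by induction: a new entry x increases the difference of the two sides by
  -- the sum over y of the squares (f y g x - g y f x)².
  cauchy-schwarz : ∀ (xs : List A) (f g : A → ℚ) →
    ∑ xs (λ x → f x * g x) * ∑ xs (λ x → f x * g x) ≤ ∑ xs (λ x → f x * f x) * ∑ xs (λ x → g x * g x)
  cauchy-schwarz []       f g = ≤-refl
  cauchy-schwarz (x ∷ xs) f g = ≤-by-difference (0≤+ (≤⇒0≤- (cauchy-schwarz xs f g)) (0≤∑ xs λ {y} _ → 0≤p² (f y * g x - g y * f x)))
    (trans (solve 5 (λ a b S P Q → (a :* a :+ P) :* (b :* b :+ Q) :- (a :* b :+ S) :* (a :* b :+ S) :=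
              (P :* Q :- S :* S) :+ (P :* (b :* b) :+ (Q :* (a :* a) :- S :* ((a :* b) :+ (a :* b))))) refl
              (f x) (g x) S P Q)
      (cong (P * Q - S * S +_) (sym expand)))
    where
    S P Q : ℚ
    S = ∑ xs (λ x → f x * g x)
    P = ∑ xs (λ x → f x * f x)
    Q = ∑ xs (λ x → g x * g x)
    expand : ∑ xs (λ y → (f y * g x - g y * f x) * (f y * g x - g y * f x)) ≡
             P * (g x * g x) + (Q * (f x * f x) - S * (f x * g x + f x * g x))
    expand = trans (∑-cong xs λ {y} _ → solve 4 (λ a b c d → (c :* b :- d :* a) :* (c :* b :- d :* a) :=
                 c :* c :* (b :* b) :+ (d :* d :* (a :* a) :- c :* d :* (a :* b :+ a :* b))) refl (f x) (g x) (f y) (g y))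
      (trans (∑-+ xs _ _) (cong₂ _+_ (∑-*ʳ xs _ _) (trans (∑-- xs _ _) (cong₂ _-_ (∑-*ʳ xs _ _) (∑-*ʳ xs _ _)))))

-- Integer coefficients for solving identities in a commutative ring.

module RingSolving where

  open import Level using (0ℓ)
  open import Algebra.Bundles using (CommutativeRing)
  open import Algebra.Solver.Ring.AlmostCommutativeRing using (_-Raw-AlmostCommutative⟶_; fromCommutativeRing)
  open import Data.Integer as ℤ using (ℤ; +_; -[1+_]; _⊖_)
  import Data.Integer.Properties as ℤₚ
  open import Data.Maybe using (Maybe; just; nothing)
  open import Data.Nat as ℕ using (ℕ; zero; suc)
  import Data.Nat.Properties as ℕₚ
  open import Relation.Nullary using (yes; no)
  import Relation.Binary.PropositionalEquality as ≡
  open ≡ using (_≡_)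

  -- The ring solver with integer coefficients, which decide cancellations that an abstract ring cannot.
  module IntegerCoefficients (R : CommutativeRing 0ℓ 0ℓ) where

    open CommutativeRing R
    open import Algebra.Properties.Ring ring
    open import Algebra.Properties.Semiring.Mult semiring
    open import Relation.Binary.Reasoning.Setoid setoid

    ⟦_⟧ℤ : ℤ → Carrier
    ⟦ + m      ⟧ℤ = m × 1#
    ⟦ -[1+ m ] ⟧ℤ = - (suc m × 1#)

    ⊖-homo : ∀ m k → ⟦ m ⊖ k ⟧ℤ ≈ m × 1# - k × 1#
    ⊖-homo m       zero    = sym (trans (+-congˡ -0#≈0#) (+-identityʳ (m × 1#)))
    ⊖-homo zero    (suc k) = sym (+-identityˡ _)
    ⊖-homo (suc m) (suc k) = begin
      ⟦ suc m ⊖ suc k ⟧ℤ                      ≡⟨ ≡.cong ⟦_⟧ℤ (ℤₚ.[1+m]⊖[1+n]≡m⊖n m k) ⟩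
      ⟦ m ⊖ k ⟧ℤ                              ≈⟨ ⊖-homo m k ⟩
      m × 1# - k × 1#                         ≈⟨ +-congʳ (sym (+-identityˡ _)) ⟩
      0# + m × 1# - k × 1#                    ≈⟨ +-congʳ (+-congʳ (sym (-‿inverseʳ 1#))) ⟩
      1# - 1# + m × 1# - k × 1#               ≈⟨ +-congʳ (+-assoc _ _ _) ⟩
      1# + (- 1# + m × 1#) - k × 1#           ≈⟨ +-congʳ (+-congˡ (+-comm _ _)) ⟩
      1# + (m × 1# - 1#) - k × 1#             ≈⟨ +-congʳ (sym (+-assoc _ _ _)) ⟩
      1# + m × 1# - 1# - k × 1#               ≈⟨ +-assoc _ _ _ ⟩
      1# + m × 1# + (- 1# - k × 1#)           ≈⟨ +-congˡ (-‿+-comm 1# (k × 1#)) ⟩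
      suc m × 1# - suc k × 1#                 ∎

    neg-homo : ∀ i → ⟦ ℤ.- i ⟧ℤ ≈ - ⟦ i ⟧ℤ
    neg-homo (+ zero)  = sym -0#≈0#
    neg-homo (+ suc m) = refl
    neg-homo -[1+ m ]  = sym (-‿involutive _)

    +-homo : ∀ i j → ⟦ i ℤ.+ j ⟧ℤ ≈ ⟦ i ⟧ℤ + ⟦ j ⟧ℤ
    +-homo (+ m)    (+ k)    = ×-homo-+ 1# m k
    +-homo (+ m)    -[1+ k ] = ⊖-homo m (suc k)
    +-homo -[1+ m ] (+ k)    = trans (⊖-homo k (suc m)) (+-comm _ _)
    +-homo -[1+ m ] -[1+ k ] = begin
      - (suc (suc (m ℕ.+ k)) × 1#)            ≡⟨ ≡.cong (λ j → - (suc j × 1#)) (≡.sym (ℕₚ.+-suc m k)) ⟩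
      - ((suc m ℕ.+ suc k) × 1#)              ≈⟨ -‿cong (×-homo-+ 1# (suc m) (suc k)) ⟩
      - (suc m × 1# + suc k × 1#)             ≈⟨ sym (-‿+-comm _ _) ⟩
      - (suc m × 1#) - suc k × 1#             ∎

    *-homo⁺ : ∀ m j → ⟦ + m ℤ.* j ⟧ℤ ≈ ⟦ + m ⟧ℤ * ⟦ j ⟧ℤ
    *-homo⁺ m (+ k)    = trans (reflexive (≡.cong ⟦_⟧ℤ (≡.sym (ℤₚ.pos-* m k)))) (×1-homo-* m k)
    *-homo⁺ m -[1+ k ] = begin
      ⟦ + m ℤ.* -[1+ k ] ⟧ℤ                   ≡⟨ ≡.cong ⟦_⟧ℤ (≡.sym (ℤₚ.neg-distribʳ-* (+ m) (+ suc k))) ⟩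
      ⟦ ℤ.- (+ m ℤ.* + suc k) ⟧ℤ              ≈⟨ neg-homo (+ m ℤ.* + suc k) ⟩
      - ⟦ + m ℤ.* + suc k ⟧ℤ                  ≈⟨ -‿cong (*-homo⁺ m (+ suc k)) ⟩
      - (m × 1# * (suc k × 1#))               ≈⟨ -‿distribʳ-* _ _ ⟩
      m × 1# * - (suc k × 1#)                 ∎

    *-homo : ∀ i j → ⟦ i ℤ.* j ⟧ℤ ≈ ⟦ i ⟧ℤ * ⟦ j ⟧ℤ
    *-homo (+ m)    j = *-homo⁺ m j
    *-homo -[1+ m ] j = begin
      ⟦ -[1+ m ] ℤ.* j ⟧ℤ                     ≡⟨ ≡.cong ⟦_⟧ℤ (≡.sym (ℤₚ.neg-distribˡ-* (+ suc m) j)) ⟩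
      ⟦ ℤ.- (+ suc m ℤ.* j) ⟧ℤ                ≈⟨ neg-homo (+ suc m ℤ.* j) ⟩
      - ⟦ + suc m ℤ.* j ⟧ℤ                    ≈⟨ -‿cong (*-homo⁺ (suc m) j) ⟩
      - (suc m × 1# * ⟦ j ⟧ℤ)                 ≈⟨ -‿distribˡ-* _ _ ⟩
      - (suc m × 1#) * ⟦ j ⟧ℤ                 ∎

    homomorphism : ℤ.+-*-rawRing -Raw-AlmostCommutative⟶ fromCommutativeRing R
    homomorphism = record
      { ⟦_⟧ = ⟦_⟧ℤ ; +-homo = +-homo ; *-homo = *-homo ; -‿homo = neg-homo ; 0-homo = refl ; 1-homo = +-identityʳ 1# }

    coefficients≟ : ∀ i j → Maybe (⟦ i ⟧ℤ ≈ ⟦ j ⟧ℤ)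
    coefficients≟ i j with i ℤₚ.≟ j
    ... | yes i≡j = just (reflexive (≡.cong ⟦_⟧ℤ i≡j))
    ... | no  _   = nothing

    open import Algebra.Solver.Ring ℤ.+-*-rawRing (fromCommutativeRing R) homomorphism coefficients≟ public
      using (solve; _:=_; _:+_; _:*_; :-_; _:-_; con)

-- The multiplicative group of the field: roots of unity, power residues, primitive elements.

module FieldArithmetic where

  open import Defs using (FiniteField)
  open import Data.Nat as ℕ using (ℕ; zero; suc; _∸_; _≤_; _<_; z≤n; s≤s)
  import Data.Nat.Properties as ℕₚ
  open import Data.Nat.Divisibility using (_∣_; divides; ∣⇒≤)
  open import Data.Nat.DivMod using (_/_; m*[n/m]≡n)
  open import Data.Nat.GCD as GCD using (gcd; gcd-GCD; gcd[m,n]∣m; gcd[m,n]∣n; module Bézout)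
  open import Data.Nat.Coprimality using (Coprime; coprime⇒GCD≡1; prime⇒coprime)
  open import Data.Nat.Primality using (Prime; prime⇒nonZero; prime⇒nonTrivial; prime⇒irreducible)
  open import Data.Nat.Primality.Factorisation using (factorise; factorisationHasAllPrimeFactors; module PrimeFactorisation)
  open import Data.Nat.ListAction using (product)
  open import Data.Nat.ListAction.Properties using (∈⇒∣product)
  open import Data.Vec using (Vec; []; _∷_; replicate)
  open import Data.List using (List; []; _∷_; map; filter; length; allFin; upTo; foldr)
  open import Data.List.Properties using (length-map; length-tabulate; length-upTo)
  open import Data.List.Membership.Propositional using (_∈_; find)
  open import Data.List.Membership.Propositional.Properties using (∈-map⁺; ∈-map⁻; ∈-allFin; ∈-filter⁺; ∈-filter⁻; ∈-upTo⁻)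
  open import Data.List.Relation.Binary.Permutation.Propositional using (_↭_; prep; swap) renaming (refl to ↭refl; trans to ↭trans)
  open import Data.List.Relation.Binary.Permutation.Propositional.Properties using (↭-length)
  open import Data.List.Relation.Unary.All as All using (All; []; _∷_)
  open import Data.List.Relation.Unary.All.Properties using (¬All⇒Any¬)
  open import Data.List.Relation.Unary.Any using (here; there)
  open import Data.List.Relation.Unary.AllPairs using ([]; _∷_)
  open import Data.List.Relation.Unary.Unique.Propositional using (Unique)
  open import Data.List.Relation.Unary.Unique.Propositional.Properties using (filter⁺; allFin⁺; map⁺; upTo⁺)
  import Data.List.Membership.DecPropositional as DecMembership
  open import Data.Product using (_×_; _,_; ∃; proj₂)
  open import Data.Sum using (inj₁; inj₂)
  open import Data.Empty using (⊥-elim)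
  open import Function using (Inverse; _∘_)
  open import Relation.Nullary using (¬_; yes; no; ¬?)
  open import Relation.Binary.Definitions using (tri<; tri≈; tri>)
  open import Relation.Binary.PropositionalEquality
  open import Algebra.Bundles using (CommutativeRing)
  open import Algebra.Structures using (IsCommutativeRing)
  open import Data.Integer using (0ℤ)
  open RingSolving
  open FiniteSums using (unique-↭; map-↭; unique-map)

  prime≥1 : ∀ {l} → Prime l → 1 ≤ l
  prime≥1 {l} pl = ℕ.>-nonZero⁻¹ l {{prime⇒nonZero pl}}

  prime≥2 : ∀ {l} → Prime l → 2 ≤ l
  prime≥2 {l} pl = ℕ.nonTrivial⇒n>1 l {{prime⇒nonTrivial pl}}

  prime-∤⇒coprime : ∀ {l r} → Prime l → ¬ l ∣ r → Coprime r l
  prime-∤⇒coprime pl l∤r (d∣r , d∣l) with prime⇒irreducible pl d∣l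
  ... | inj₁ d≡1  = d≡1
  ... | inj₂ refl = ⊥-elim (l∤r d∣r)

  primeDivisor : ∀ {m} → 2 ≤ m → ∃ λ l → Prime l × l ∣ m
  primeDivisor {m@(suc _)} 2≤m with factorise m
  ... | record { factors = [] ; isFactorisation = m≡1 } = ⊥-elim (ℕₚ.<-irrefl (sym m≡1) 2≤m)
  ... | record { factors = l ∷ ls ; isFactorisation = m≡ ; factorsPrime = pl ∷ _ } =
    l , pl , subst (l ∣_) (sym m≡) (∈⇒∣product {ns = l ∷ ls} (here refl))

  module Lemmas {q : ℕ} (2<q : 2 < q) (F : FiniteField q) where

    open FiniteField F public
    open IsCommutativeRing isCommutativeRing public using (*-assoc; *-comm; *-identityˡ; *-identityʳ; zeroˡ; zeroʳ)

    commutativeRing : CommutativeRing _ _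
    commutativeRing = record { isCommutativeRing = isCommutativeRing }

    open IntegerCoefficients commutativeRing public using (solve; _:=_; _:+_; _:*_; :-_; con)
    open ≡-Reasoning

    infixl 6 _−_
    _−_ : Carrier → Carrier → Carrier
    x − y = x + - y

    x−y≡0⇒x≡y : ∀ {x y} → x − y ≡ 0# → x ≡ y
    x−y≡0⇒x≡y {x} {y} e = trans (solve 2 (λ x y → x := (x :+ :- y) :+ y) refl x y)
      (trans (cong (_+ y) e) (solve 1 (λ y → con 0ℤ :+ y := y) refl y))

    x−x≡0 : ∀ x → x − x ≡ 0#
    x−x≡0 = solve 1 (λ x → x :+ :- x := con 0ℤ) refl

    x⁻¹*[x*y]≡y : ∀ {x} y → x ≢ 0# → (x ⁻¹) * (x * y) ≡ y
    x⁻¹*[x*y]≡y {x} y x≢0 = trans (solve 3 (λ x i y → i :* (x :* y) := (x :* i) :* y) refl x (x ⁻¹) y)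
      (trans (cong (_* y) (inverseʳ x x≢0)) (*-identityˡ y))

    x*[x⁻¹*y]≡y : ∀ {x} y → x ≢ 0# → x * ((x ⁻¹) * y) ≡ y
    x*[x⁻¹*y]≡y {x} y x≢0 = trans (solve 3 (λ x i y → x :* (i :* y) := (x :* i) :* y) refl x (x ⁻¹) y)
      (trans (cong (_* y) (inverseʳ x x≢0)) (*-identityˡ y))

    *-cancelˡ : ∀ {x y z} → x ≢ 0# → x * y ≡ x * z → y ≡ z
    *-cancelˡ {x} {y} {z} x≢0 e = trans (sym (x⁻¹*[x*y]≡y y x≢0)) (trans (cong (x ⁻¹ *_) e) (x⁻¹*[x*y]≡y z x≢0))

    *-≢0 : ∀ {x y} → x ≢ 0# → y ≢ 0# → x * y ≢ 0#
    *-≢0 {x} x≢0 y≢0 e = y≢0 (*-cancelˡ x≢0 (trans e (sym (zeroʳ x))))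

    1≢0 : 1# ≢ 0#
    1≢0 = 0≢1 ∘ sym

    ⁻¹-≢0 : ∀ {x} → x ≢ 0# → x ⁻¹ ≢ 0#
    ⁻¹-≢0 {x} x≢0 e = 1≢0 (trans (sym (inverseʳ x x≢0)) (trans (cong (x *_) e) (zeroʳ x)))

    ^-+ : ∀ x m k → x ^ (m ℕ.+ k) ≡ x ^ m * x ^ k
    ^-+ x zero    k = sym (*-identityˡ _)
    ^-+ x (suc m) k = trans (cong (x *_) (^-+ x m k)) (sym (*-assoc x (x ^ m) (x ^ k)))

    ^-* : ∀ x m k → x ^ (m ℕ.* k) ≡ (x ^ k) ^ m
    ^-* x zero    k = refl
    ^-* x (suc m) k = trans (^-+ x k (m ℕ.* k)) (cong (x ^ k *_) (^-* x m k))

    1^ : ∀ m → 1# ^ m ≡ 1#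
    1^ zero    = refl
    1^ (suc m) = trans (*-identityˡ _) (1^ m)

    *-^ : ∀ x y m → (x * y) ^ m ≡ x ^ m * y ^ m
    *-^ x y zero    = sym (*-identityˡ 1#)
    *-^ x y (suc m) = trans (cong (x * y *_) (*-^ x y m))
      (solve 4 (λ a b c d → (a :* b) :* (c :* d) := (a :* c) :* (b :* d)) refl x y (x ^ m) (y ^ m))

    ^-≢0 : ∀ {x} m → x ≢ 0# → x ^ m ≢ 0#
    ^-≢0 zero    x≢0 = 1≢0
    ^-≢0 (suc m) x≢0 = *-≢0 x≢0 (^-≢0 m x≢0)

    ^≡1⇒≢0 : ∀ {x} m → x ^ suc m ≡ 1# → x ≢ 0#
    ^≡1⇒≢0 {x} m e refl = 0≢1 (trans (sym (zeroˡ _)) e)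

    elements-unique : Unique elements
    elements-unique = map⁺ to-injective (allFin⁺ q)
      where
      to-injective : ∀ {i j} → Inverse.to enum i ≡ Inverse.to enum j → i ≡ j
      to-injective {i} {j} e = trans (sym (Inverse.strictlyInverseʳ enum i))
        (trans (cong (Inverse.from enum) e) (Inverse.strictlyInverseʳ enum j))

    ∈-elements : ∀ x → x ∈ elements
    ∈-elements x = subst (_∈ elements) (Inverse.strictlyInverseˡ enum x)
      (∈-map⁺ (Inverse.to enum) (∈-allFin (Inverse.from enum x)))

    length-elements : length elements ≡ q
    length-elements = trans (length-map (Inverse.to enum) (allFin q)) (length-tabulate {n = q} (λ i → i))

    n : ℕ
    n = q ∸ 1

    q≡1+n : q ≡ suc n
    q≡1+n = sym (ℕₚ.m+[n∸m]≡n (ℕₚ.≤-trans (s≤s z≤n) 2<q))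

    1<n : 1 < n
    1<n = ℕ.s≤s⁻¹ (subst (2 <_) q≡1+n 2<q)

    G : List Carrier
    G = filter (λ x → ¬? (x ≟ 0#)) elements

    G-unique : Unique G
    G-unique = filter⁺ (λ x → ¬? (x ≟ 0#)) elements-unique

    ∈G : ∀ {x} → x ≢ 0# → x ∈ G
    ∈G {x} x≢0 = ∈-filter⁺ (λ x → ¬? (x ≟ 0#)) (∈-elements x) x≢0

    ∈G⇒≢0 : ∀ {x} → x ∈ G → x ≢ 0#
    ∈G⇒≢0 x∈ = proj₂ (∈-filter⁻ (λ x → ¬? (x ≟ 0#)) {xs = elements} x∈)

    elements-↭ : elements ↭ 0# ∷ G
    elements-↭ = unique-↭ elements-unique (All.tabulate (λ x∈ 0≡x → ∈G⇒≢0 x∈ (sym 0≡x)) ∷ G-unique) to (λ {x} _ → ∈-elements x)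
      where
      to : ∀ {x} → x ∈ elements → x ∈ 0# ∷ G
      to {x} _ with x ≟ 0#
      ... | yes x≡0 = here x≡0
      ... | no  x≢0 = there (∈G x≢0)

    length-G : length G ≡ n
    length-G = ℕₚ.suc-injective (trans (sym (↭-length elements-↭)) (trans length-elements q≡1+n))

    scale-↭ : ∀ {a} → a ≢ 0# → map (a *_) G ↭ G
    scale-↭ {a} a≢0 = map-↭ (a *_) (a ⁻¹ *_) G-unique G-unique (λ x∈ → ∈G (*-≢0 a≢0 (∈G⇒≢0 x∈)))
      (λ x∈ → ∈G (*-≢0 (⁻¹-≢0 a≢0) (∈G⇒≢0 x∈))) (λ {x} _ → x⁻¹*[x*y]≡y x a≢0) (λ {y} _ → x*[x⁻¹*y]≡y y a≢0)

    prod : List Carrier → Carrier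
    prod = foldr _*_ 1#

    prod-↭ : ∀ {xs ys} → xs ↭ ys → prod xs ≡ prod ys
    prod-↭ ↭refl        = refl
    prod-↭ (prep x p)   = cong (x *_) (prod-↭ p)
    prod-↭ (swap {xs} {ys} x y p) = trans (cong (λ z → x * (y * z)) (prod-↭ p))
      (solve 3 (λ a b c → a :* (b :* c) := b :* (a :* c)) refl x y (prod ys))
    prod-↭ (↭trans p r) = trans (prod-↭ p) (prod-↭ r)

    prod-scale : ∀ a xs → prod (map (a *_) xs) ≡ prod xs * a ^ length xs
    prod-scale a []       = sym (*-identityˡ 1#)
    prod-scale a (x ∷ xs) = trans (cong (a * x *_) (prod-scale a xs))
      (solve 4 (λ a x p r → (a :* x) :* (p :* r) := (x :* p) :* (a :* r)) refl a x (prod xs) (a ^ length xs))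

    prod-≢0 : ∀ {xs} → All (_≢ 0#) xs → prod xs ≢ 0#
    prod-≢0 []       = 1≢0
    prod-≢0 (x ∷ xs) = *-≢0 x (prod-≢0 xs)

    -- Multiplication by a permutes the nonzero elements, so their product P satisfies P a^n = P,
    -- and P can be cancelled.
    fermat : ∀ {a} → a ≢ 0# → a ^ n ≡ 1#
    fermat {a} a≢0 = *-cancelˡ (prod-≢0 {G} (All.tabulate ∈G⇒≢0)) (begin
      prod G * a ^ n          ≡⟨ cong (λ m → prod G * a ^ m) (sym length-G) ⟩
      prod G * a ^ length G   ≡⟨ sym (prod-scale a G) ⟩
      prod (map (a *_) G)     ≡⟨ prod-↭ (scale-↭ a≢0) ⟩
      prod G                  ≡⟨ sym (*-identityʳ _) ⟩
      prod G * 1#             ∎)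

    -- The vector (c₀ , … , cₘ₋₁) stands for the monic polynomial c₀ + c₁ x + … + cₘ₋₁ xᵐ⁻¹ + xᵐ.
    eval : ∀ {m} → Vec Carrier m → Carrier → Carrier
    eval []       x = 1#
    eval (c ∷ cs) x = x * eval cs x + c

    -- Horner's scheme: the values at r of the successive tails of a polynomial are the coefficients
    -- of its quotient by x - r.
    quotient : ∀ {m} → Vec Carrier (suc m) → Carrier → Vec Carrier m
    quotient (c ∷ [])     r = []
    quotient (c ∷ d ∷ cs) r = eval (d ∷ cs) r ∷ quotient (d ∷ cs) r

    eval-quotient : ∀ {m} (p : Vec Carrier (suc m)) r x → eval p x ≡ (x − r) * eval (quotient p r) x + eval p r
    eval-quotient (c ∷ [])     r x = solve 4 (λ x r c o → x :* o :+ c := (x :+ :- r) :* o :+ (r :* o :+ c)) refl x r c 1#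
    eval-quotient (c ∷ d ∷ cs) r x = trans (cong (λ e → x * e + c) (eval-quotient (d ∷ cs) r x))
      (solve 5 (λ x r c Q P → x :* ((x :+ :- r) :* Q :+ P) :+ c := (x :+ :- r) :* (x :* Q :+ P) :+ (r :* P :+ c))
        refl x r c (eval (quotient (d ∷ cs) r) x) (eval (d ∷ cs) r))

    -- Dividing by x - r for a listed root r lowers the degree by one, and the other listed roots
    -- survive in the quotient, as y - r can be cancelled for y ≠ r.
    roots≤degree : ∀ {m} (p : Vec Carrier m) {xs} → Unique xs → All (λ x → eval p x ≡ 0#) xs → length xs ≤ m
    roots≤degree p  {[]}     _ _ = z≤n
    roots≤degree [] {x ∷ xs} _ (1≡0 ∷ _) = ⊥-elim (1≢0 1≡0)
    roots≤degree p@(_ ∷ _) {x ∷ xs} (x∉ ∷ u) (px≡0 ∷ pxs≡0) =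
      s≤s (roots≤degree (quotient p x) u (All.tabulate λ {y} y∈ → root-of-quotient (All.lookup x∉ y∈) (All.lookup pxs≡0 y∈)))
      where
      root-of-quotient : ∀ {y} → x ≢ y → eval p y ≡ 0# → eval (quotient p x) y ≡ 0#
      root-of-quotient {y} x≢y py≡0 = *-cancelˡ (λ e → x≢y (sym (x−y≡0⇒x≡y e))) (begin
        (y − x) * Q               ≡⟨ solve 1 (λ a → a := a :+ con 0ℤ) refl _ ⟩
        (y − x) * Q + 0#          ≡⟨ cong ((y − x) * Q +_) (sym px≡0) ⟩
        (y − x) * Q + eval p x    ≡⟨ sym (eval-quotient p x y) ⟩
        eval p y                  ≡⟨ py≡0 ⟩
        0#                        ≡⟨ sym (zeroʳ _) ⟩
        (y − x) * 0#              ∎)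
        where
        Q : Carrier
        Q = eval (quotient p x) y

    eval-replicate : ∀ m x → eval (replicate m 0#) x ≡ x ^ m
    eval-replicate zero    x = refl
    eval-replicate (suc m) x = trans (cong (λ e → x * e + 0#) (eval-replicate m x))
      (solve 1 (λ a → a :+ con 0ℤ := a) refl (x * x ^ m))

    roots-of-unity≤ : ∀ m {xs} → 1 ≤ m → Unique xs → All (λ x → x ^ m ≡ 1#) xs → length xs ≤ m
    roots-of-unity≤ (suc m) _ u h = roots≤degree (- 1# ∷ replicate m 0#) u
      (All.map (λ {x} e → trans (cong (λ z → x * z − 1#) (eval-replicate m x)) (trans (cong (_− 1#) e) (x−x≡0 1#))) h)

    -- The Bézout identity has the subtraction-free form d + j b = k a, or the same with a and b
    -- exchanged, so natural exponents are enough.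
    ^-Bézout : ∀ {x d a b} → x ^ a ≡ 1# → x ^ b ≡ 1# → Bézout.Identity d a b → x ^ d ≡ 1#
    ^-Bézout {x} {d} {a} {b} xa xb identity = go identity
      where
      power : ∀ k {c} → x ^ c ≡ 1# → x ^ (k ℕ.* c) ≡ 1#
      power k {c} e = trans (^-* x k c) (trans (cong (_^ k) e) (1^ k))
      step : ∀ j k {c c′} → x ^ c ≡ 1# → x ^ c′ ≡ 1# → d ℕ.+ j ℕ.* c ≡ k ℕ.* c′ → x ^ d ≡ 1#
      step j k {c} xc xc′ eq = begin
        x ^ d                      ≡⟨ sym (*-identityʳ _) ⟩
        x ^ d * 1#                 ≡⟨ cong (x ^ d *_) (sym (power j xc)) ⟩
        x ^ d * x ^ (j ℕ.* c)      ≡⟨ sym (^-+ x d (j ℕ.* c)) ⟩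
        x ^ (d ℕ.+ j ℕ.* c)        ≡⟨ cong (x ^_) eq ⟩
        x ^ (k ℕ.* _)              ≡⟨ power k xc′ ⟩
        1#                         ∎
      go : Bézout.Identity d a b → x ^ d ≡ 1#
      go (Bézout.+- j k eq) = step k j xb xa eq
      go (Bézout.-+ j k eq) = step j k xa xb eq

    ^-gcd : ∀ {x} a b → x ^ a ≡ 1# → x ^ b ≡ 1# → x ^ gcd a b ≡ 1#
    ^-gcd a b xa xb = ^-Bézout xa xb (Bézout.identity (gcd-GCD a b))

    ^-coprime : ∀ {x a b} → Coprime a b → x ^ a ≡ 1# → x ^ b ≡ 1# → x ≡ 1#
    ^-coprime {x} c xa xb = trans (sym (*-identityʳ x)) (^-Bézout xa xb (Bézout.identity (coprime⇒GCD≡1 c)))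

    -- The exponent n / l. Its value at 0 is a default, so that `π l` makes sense for any natural
    -- number l without a proof that l is nonzero.
    cofactor : ℕ → ℕ
    cofactor zero    = 0
    cofactor (suc l) = n / suc l

    -- x ↦ π l x is the projection of F_q^* onto the l-th roots of unity, so that π l x ≢ 1# iff x is not an l-th power.
    π : ℕ → Carrier → Carrier
    π l x = x ^ cofactor l

    l*cofactor : ∀ {l} → Prime l → l ∣ n → l ℕ.* cofactor l ≡ n
    l*cofactor {zero}  pl l∣n = ⊥-elim (ℕₚ.<-irrefl refl (prime≥1 pl))
    l*cofactor {suc l} pl l∣n = m*[n/m]≡n l∣n

    cofactor*l : ∀ {l} → Prime l → l ∣ n → cofactor l ℕ.* l ≡ n
    cofactor*l {l} pl l∣n = trans (ℕₚ.*-comm (cofactor l) l) (l*cofactor pl l∣n)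

    1≤cofactor : ∀ {l} → Prime l → l ∣ n → 1 ≤ cofactor l
    1≤cofactor {l} pl l∣n with cofactor l | cofactor*l pl l∣n
    ... | zero  | 0≡n = ⊥-elim (ℕₚ.n≮0 (subst (1 <_) (sym 0≡n) 1<n))
    ... | suc _ | _   = s≤s z≤n

    cofactor<n : ∀ {l} → Prime l → l ∣ n → cofactor l < n
    cofactor<n {l} pl l∣n = subst (cofactor l <_) (cofactor*l pl l∣n)
      (ℕₚ.m<m*n (cofactor l) l {{ℕ.>-nonZero (1≤cofactor pl l∣n)}} (prime≥2 pl))

    π-≢0 : ∀ l {x} → x ≢ 0# → π l x ≢ 0#
    π-≢0 l = ^-≢0 (cofactor l)

    π-* : ∀ l x y → π l (x * y) ≡ π l x * π l y
    π-* l x y = *-^ x y (cofactor l)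

    π-^ : ∀ l x r → π l (x ^ r) ≡ π l x ^ r
    π-^ l x r = trans (sym (^-* x (cofactor l) r)) (trans (cong (x ^_) (ℕₚ.*-comm (cofactor l) r)) (^-* x r (cofactor l)))

    π^l≡1 : ∀ {l x} → Prime l → l ∣ n → x ≢ 0# → π l x ^ l ≡ 1#
    π^l≡1 {l} {x} pl l∣n x≢0 = trans (sym (^-* x l (cofactor l))) (trans (cong (x ^_) (l*cofactor pl l∣n)) (fermat x≢0))

    -- If x^(m+1) = 1 with m + 1 < n, then also x^g = 1 for g = gcd (m+1) n, a proper divisor of n.
    -- A prime l dividing n / g makes n / l a multiple of g, whence `π l x` = 1.
    primitive-criterion : ∀ {x} → x ≢ 0# → (∀ {l} → Prime l → l ∣ n → π l x ≢ 1#) → Primitive x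
    primitive-criterion {x} x≢0 h = x≢0 , All.tabulate λ {m} m∈ → nontrivial m (∈-upTo⁻ m∈)
      where
      nontrivial : ∀ m → m < q ∸ 2 → x ^ suc m ≢ 1#
      nontrivial m m<q∸2 e with gcd[m,n]∣n (suc m) n
      ... | divides t n≡t*g with primeDivisor 2≤t
        where
        g : ℕ
        g = gcd (suc m) n
        m+1<n : suc m < n
        m+1<n = subst (suc m <_) (ℕₚ.m+[n∸m]≡n (ℕₚ.<⇒≤ 1<n)) (s≤s (subst (λ z → m < z ∸ 2) q≡1+n m<q∸2))
        g<n : g < n
        g<n = ℕₚ.≤-<-trans (∣⇒≤ (gcd[m,n]∣m (suc m) n)) m+1<n
        multiple≥2 : ∀ t → n ≡ t ℕ.* g → 2 ≤ t
        multiple≥2 zero          n≡0 = ⊥-elim (ℕₚ.n≮0 (subst (1 <_) n≡0 1<n))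
        multiple≥2 (suc zero)    n≡g = ⊥-elim (ℕₚ.<-irrefl (sym (trans n≡g (ℕₚ.+-identityʳ g))) g<n)
        multiple≥2 (suc (suc _)) _   = s≤s (s≤s z≤n)
        2≤t : 2 ≤ t
        2≤t = multiple≥2 t n≡t*g
      ... | l , pl , divides c t≡c*l = h pl l∣n (begin
          π l x             ≡⟨ cong (x ^_) cofactor≡ ⟩
          x ^ (c ℕ.* g)     ≡⟨ ^-* x c g ⟩
          (x ^ g) ^ c       ≡⟨ cong (_^ c) (^-gcd (suc m) n e (fermat x≢0)) ⟩
          1# ^ c            ≡⟨ 1^ c ⟩
          1#                ∎)
        where
        g : ℕ
        g = gcd (suc m) n
        n≡ : n ≡ l ℕ.* (c ℕ.* g)
        n≡ = trans n≡t*g (trans (cong (ℕ._* g) (trans t≡c*l (ℕₚ.*-comm c l))) (ℕₚ.*-assoc l c g))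
        l∣n : l ∣ n
        l∣n = divides (c ℕ.* g) (trans n≡ (ℕₚ.*-comm l (c ℕ.* g)))
        cofactor≡ : cofactor l ≡ c ℕ.* g
        cofactor≡ = ℕₚ.*-cancelˡ-≡ _ _ l {{prime⇒nonZero pl}} (trans (l*cofactor pl l∣n) n≡)

    μ : ℕ → List Carrier
    μ l = filter (λ z → (z ^ l) ≟ 1#) elements

    μ-unique : ∀ l → Unique (μ l)
    μ-unique l = filter⁺ (λ z → (z ^ l) ≟ 1#) elements-unique

    ∈μ : ∀ l {z} → z ^ l ≡ 1# → z ∈ μ l
    ∈μ l {z} = ∈-filter⁺ (λ z → (z ^ l) ≟ 1#) (∈-elements z)

    ∈μ⇒^≡1 : ∀ l {z} → z ∈ μ l → z ^ l ≡ 1#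
    ∈μ⇒^≡1 l z∈ = proj₂ (∈-filter⁻ (λ z → (z ^ l) ≟ 1#) {xs = elements} z∈)

    1∈μ : ∀ l → 1# ∈ μ l
    1∈μ l = ∈μ l (1^ l)

    *∈μ : ∀ l {y z} → y ∈ μ l → z ∈ μ l → y * z ∈ μ l
    *∈μ l {y} {z} y∈ z∈ = ∈μ l (trans (*-^ y z l) (trans (cong₂ _*_ (∈μ⇒^≡1 l y∈) (∈μ⇒^≡1 l z∈)) (*-identityˡ 1#)))

    ∈μ⇒≢0 : ∀ {l z} → 1 ≤ l → z ∈ μ l → z ≢ 0#
    ∈μ⇒≢0 {suc l} _ z∈ = ^≡1⇒≢0 l (∈μ⇒^≡1 (suc l) z∈)

    ⁻¹∈μ : ∀ {l z} → 1 ≤ l → z ∈ μ l → z ⁻¹ ∈ μ l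
    ⁻¹∈μ {l} {z} 1≤l z∈ = ∈μ l (begin
      (z ⁻¹) ^ l             ≡⟨ sym (*-identityˡ _) ⟩
      1# * (z ⁻¹) ^ l        ≡⟨ cong (_* (z ⁻¹) ^ l) (sym (∈μ⇒^≡1 l z∈)) ⟩
      z ^ l * (z ⁻¹) ^ l     ≡⟨ sym (*-^ z (z ⁻¹) l) ⟩
      (z * z ⁻¹) ^ l       ≡⟨ cong (_^ l) (inverseʳ z (∈μ⇒≢0 1≤l z∈)) ⟩
      1# ^ l               ≡⟨ 1^ l ⟩
      1#                   ∎)

    π∈μ : ∀ {l x} → Prime l → l ∣ n → x ∈ G → π l x ∈ μ l
    π∈μ {l} pl l∣n x∈ = ∈μ l (π^l≡1 pl l∣n (∈G⇒≢0 x∈))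

    -- Otherwise all n nonzero elements would be roots of X^(n/l) - 1, whose degree is less than n.
    non-power : ∀ {l} → Prime l → l ∣ n → ∃ λ x → x ∈ G × π l x ≢ 1#
    non-power {l} pl l∣n with find (¬All⇒Any¬ (λ x → π l x ≟ 1#) G ¬all)
      where
      ¬all : ¬ All (λ x → π l x ≡ 1#) G
      ¬all h = ℕₚ.<⇒≱ (cofactor<n pl l∣n)
        (subst (_≤ cofactor l) length-G (roots-of-unity≤ (cofactor l) (1≤cofactor pl l∣n) G-unique h))
    ... | x , x∈ , πx≢1 = x , x∈ , πx≢1

    powers : ℕ → Carrier → List Carrier
    powers l ζ = map (ζ ^_) (upTo l)

    -- The powers below l are distinct, because a difference of exponents is prime to l. They are
    -- all of `μ l`, because one more element would give X^l - 1 too many roots.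
    powers-↭ : ∀ {l ζ} → Prime l → ζ ^ l ≡ 1# → ζ ≢ 1# → powers l ζ ↭ μ l
    powers-↭ {l} {ζ} pl ζ^l ζ≢1 = unique-↭ powers-unique (μ-unique l) to from
      where
      ζ≢0 : ζ ≢ 0#
      ζ≢0 = ∈μ⇒≢0 (prime≥1 pl) (∈μ l ζ^l)
      <⇒≢ : ∀ {i j} → i < j → j < l → ζ ^ i ≢ ζ ^ j
      <⇒≢ {i} {j} i<j j<l e = ζ≢1 (^-coprime
        (prime⇒coprime pl {{ℕ.>-nonZero (ℕₚ.m<n⇒0<n∸m i<j)}} (ℕₚ.≤-<-trans (ℕₚ.m∸n≤m j i) j<l)) ζ^l
        (*-cancelˡ (^-≢0 i ζ≢0) (begin
          ζ ^ i * ζ ^ (j ∸ i)     ≡⟨ sym (^-+ ζ i (j ∸ i)) ⟩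
          ζ ^ (i ℕ.+ (j ∸ i))     ≡⟨ cong (ζ ^_) (ℕₚ.m+[n∸m]≡n (ℕₚ.<⇒≤ i<j)) ⟩
          ζ ^ j                   ≡⟨ sym e ⟩
          ζ ^ i                   ≡⟨ sym (*-identityʳ _) ⟩
          ζ ^ i * 1#              ∎)))
      injective : ∀ {i j} → i ∈ upTo l → j ∈ upTo l → ζ ^ i ≡ ζ ^ j → i ≡ j
      injective {i} {j} i∈ j∈ e with ℕₚ.<-cmp i j
      ... | tri< i<j _ _ = ⊥-elim (<⇒≢ i<j (∈-upTo⁻ j∈) e)
      ... | tri≈ _ i≡j _ = i≡j
      ... | tri> _ _ j<i = ⊥-elim (<⇒≢ j<i (∈-upTo⁻ i∈) (sym e))
      powers-unique : Unique (powers l ζ)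
      powers-unique = unique-map (ζ ^_) injective (upTo⁺ l)
      powers-root : ∀ {z} → z ∈ powers l ζ → z ^ l ≡ 1#
      powers-root z∈ with ∈-map⁻ (ζ ^_) z∈
      ... | i , _ , refl = trans (sym (^-* ζ l i)) (trans (cong (ζ ^_) (ℕₚ.*-comm l i))
                             (trans (^-* ζ i l) (trans (cong (_^ i) ζ^l) (1^ i))))
      to : ∀ {z} → z ∈ powers l ζ → z ∈ μ l
      to z∈ = ∈μ l (powers-root z∈)
      from : ∀ {z} → z ∈ μ l → z ∈ powers l ζ
      from {z} z∈ with DecMembership._∈?_ _≟_ z (powers l ζ)
      ... | yes p = p
      ... | no ¬p = ⊥-elim (ℕₚ.<-irrefl refl (subst (λ k → suc k ≤ l)
          (trans (length-map (ζ ^_) (upTo l)) (length-upTo l))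
          (roots-of-unity≤ l {z ∷ powers l ζ} (prime≥1 pl)
            (All.tabulate (λ {y} y∈ z≡y → ¬p (subst (_∈ powers l ζ) (sym z≡y) y∈)) ∷ powers-unique)
            (∈μ⇒^≡1 l z∈ ∷ All.tabulate powers-root))))

    -- The exponent ∏ ls makes x ^ product ls invisible to the projections at the primes of ls but not at l.
    separator : ∀ {l} {ls} → Prime l → l ∣ n → All Prime ls → All (_∣ n) ls → ¬ l ∈ ls →
                ∃ λ e → e ∈ G × π l e ≢ 1# × (∀ {l′} → l′ ∈ ls → π l′ e ≡ 1#)
    separator {l} {ls} pl l∣n pls ls∣n l∉ls with non-power pl l∣n
    ... | x , x∈ , πx≢1 = x ^ r , ∈G (^-≢0 r (∈G⇒≢0 x∈)) ,
        (λ e → πx≢1 (^-coprime (prime-∤⇒coprime pl l∤r) (trans (sym (π-^ l x r)) e) (π^l≡1 pl l∣n (∈G⇒≢0 x∈)))) , trivial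
      where
      r : ℕ
      r = product ls
      l∤r : ¬ l ∣ r
      l∤r l∣r = l∉ls (factorisationHasAllPrimeFactors pl l∣r pls)
      trivial : ∀ {l′} → l′ ∈ ls → π l′ (x ^ r) ≡ 1#
      trivial {l′} l′∈ with ∈⇒∣product l′∈
      ... | divides c r≡c*l′ = begin
        π l′ (x ^ r)               ≡⟨ π-^ l′ x r ⟩
        π l′ x ^ r                 ≡⟨ cong (π l′ x ^_) r≡c*l′ ⟩
        π l′ x ^ (c ℕ.* l′)        ≡⟨ ^-* (π l′ x) c l′ ⟩
        (π l′ x ^ l′) ^ c          ≡⟨ cong (_^ c) (π^l≡1 (All.lookup pls l′∈) (All.lookup ls∣n l′∈) (∈G⇒≢0 x∈)) ⟩
        1# ^ c                     ≡⟨ 1^ c ⟩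
        1#                         ∎

    length-μ : ∀ {l} → Prime l → l ∣ n → length (μ l) ≡ l
    length-μ {l} pl l∣n with non-power pl l∣n
    ... | x , x∈ , πx≢1 = trans (sym (↭-length (powers-↭ pl (π^l≡1 pl l∣n (∈G⇒≢0 x∈)) πx≢1)))
          (trans (length-map (π l x ^_) (upTo l)) (length-upTo l))

-- Independence of the power residues at different primes.

module ResidueAverages where

  open import Defs using (FiniteField)
  open import Data.Nat as ℕ using (ℕ; zero; suc)
  open import Data.Nat.Divisibility using (_∣_)
  open import Data.Nat.Primality using (Prime)
  open import Data.Rational
  open import Data.Rational.Properties
  open import Data.Rational.Solver
  open import Data.List using (List; []; _∷_; length; upTo)
  open import Data.List.Properties using (length-upTo)
  open import Data.List.Membership.Propositional using (_∈_)
  open import Data.List.Relation.Unary.All as All using (All; []; _∷_)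
  open import Data.List.Relation.Unary.AllPairs using ([]; _∷_)
  open import Data.List.Relation.Unary.Unique.Propositional using (Unique)
  open import Data.Product using (_,_)
  open import Relation.Nullary using (¬_)
  open import Relation.Binary.PropositionalEquality
  open Rationals
  open FiniteSums
  open FieldArithmetic

  module _ {q : ℕ} (2<q : 2 ℕ.< q) (F : FiniteField q) where

    open Lemmas 2<q F using (Carrier; 1#; _⁻¹; _^_; n; G; μ; π)
      renaming (_*_ to infixl 7 _·_; *-assoc to ·-assoc; *-comm to ·-comm; *-identityˡ to ·-identityˡ)
    private module L = Lemmas 2<q F

    record PrimesOfOrder (ls : List ℕ) : Set where
      constructor primesOfOrder
      field
        distinct : Unique ls
        primes   : All Prime ls
        divide   : All (_∣ n) ls

    open PrimesOfOrder public

    tailPrimes : ∀ {l ls} → PrimesOfOrder (l ∷ ls) → PrimesOfOrder ls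
    tailPrimes (primesOfOrder (_ ∷ u) (_ ∷ p) (_ ∷ d)) = primesOfOrder u p d

    headPrime : ∀ {l ls} → PrimesOfOrder (l ∷ ls) → Prime l
    headPrime P = All.head (primes P)

    headDivides : ∀ {l ls} → PrimesOfOrder (l ∷ ls) → l ∣ n
    headDivides P = All.head (divide P)

    head∉tail : ∀ {l ls} → PrimesOfOrder (l ∷ ls) → ¬ l ∈ ls
    head∉tail (primesOfOrder (l∉ ∷ _) _ _) l∈ = All.lookup l∉ l∈ refl

    ∑G-translate : ∀ {a} → a ∈ G → (f : Carrier → ℚ) → ∑ G (λ x → f (a · x)) ≡ ∑ G f
    ∑G-translate {a} a∈ f = trans (sym (∑-map (a ·_) G f)) (∑-↭ f (L.scale-↭ (L.∈G⇒≢0 a∈)))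

    ∑μ-translate : ∀ {l a} → 1 ℕ.≤ l → a ∈ μ l → (f : Carrier → ℚ) → ∑ (μ l) (λ x → f (a · x)) ≡ ∑ (μ l) f
    ∑μ-translate {l} {a} 1≤l a∈ = ∑-reindex (a ·_) (a ⁻¹ ·_) (L.μ-unique l) (L.μ-unique l)
      (L.*∈μ l a∈) (L.*∈μ l (L.⁻¹∈μ 1≤l a∈)) (λ {x} _ → L.x⁻¹*[x*y]≡y x a≢0) (λ {y} _ → L.x*[x⁻¹*y]≡y y a≢0)
      where a≢0 = L.∈μ⇒≢0 1≤l a∈

    -- Translating by the powers of e runs π l x through all of μ l without changing A.
    average-step : ∀ {l e} → Prime l → l ∣ n → e ∈ G → π l e ≢ 1# → (f A : Carrier → ℚ) →
      (∀ {x} → x ∈ G → A (e · x) ≡ A x) →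
      ∑ G (λ x → f (π l x) * A x) ≡ inv l * ∑ (μ l) f * ∑ G A
    average-step {l} {e} pl l∣n e∈ ζ≢1 f A A-inv = begin
      S                                            ≡⟨ sym (*-identityˡ S) ⟩
      1ℚ * S                                       ≡⟨ cong (_* S) (sym (cast*inv (prime≥1 pl))) ⟩
      cast l * inv l * S                            ≡⟨ solve 3 (λ a b c → a :* b :* c := b :* (a :* c)) refl (cast l) (inv l) S ⟩
      inv l * (cast l * S)                          ≡⟨ cong (inv l *_) l*S ⟩
      inv l * (∑ (μ l) f * ∑ G A)                  ≡⟨ sym (*-assoc (inv l) (∑ (μ l) f) (∑ G A)) ⟩
      inv l * ∑ (μ l) f * ∑ G A                    ∎
      where
      open ≡-Reasoning
      open +-*-Solver
      S : ℚ
      S = ∑ G (λ x → f (π l x) * A x)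
      ζ : Carrier
      ζ = π l e
      A-inv^ : ∀ j {x} → x ∈ G → A (e ^ j · x) ≡ A x
      A-inv^ zero    {x} x∈ = cong A (·-identityˡ x)
      A-inv^ (suc j) {x} x∈ = trans (cong A (·-assoc e (e ^ j) x))
        (trans (A-inv (L.∈G (L.*-≢0 (L.^-≢0 j (L.∈G⇒≢0 e∈)) (L.∈G⇒≢0 x∈)))) (A-inv^ j x∈))
      shifted : ∀ j → S ≡ ∑ G (λ x → f (ζ ^ j · π l x) * A x)
      shifted j = trans (sym (∑G-translate (L.∈G (L.^-≢0 j (L.∈G⇒≢0 e∈))) (λ x → f (π l x) * A x)))
        (∑-cong G λ {x} x∈ → cong₂ _*_ (cong f (trans (L.π-* l (e ^ j) x) (cong (_· π l x) (L.π-^ l e j)))) (A-inv^ j x∈))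
      orbit : ∀ {x} → x ∈ G → ∑ (upTo l) (λ j → f (ζ ^ j · π l x)) ≡ ∑ (μ l) f
      orbit {x} x∈ = begin
        ∑ (upTo l) (λ j → f (ζ ^ j · π l x))       ≡⟨ sym (∑-map (ζ ^_) (upTo l) (λ z → f (z · π l x))) ⟩
        ∑ (L.powers l ζ) (λ z → f (z · π l x))     ≡⟨ ∑-↭ _ (L.powers-↭ pl (L.π^l≡1 pl l∣n (L.∈G⇒≢0 e∈)) ζ≢1) ⟩
        ∑ (μ l) (λ z → f (z · π l x))              ≡⟨ ∑-cong (μ l) (λ {z} _ → cong f (·-comm z (π l x))) ⟩
        ∑ (μ l) (λ z → f (π l x · z))              ≡⟨ ∑μ-translate (prime≥1 pl) (L.π∈μ pl l∣n x∈) f ⟩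
        ∑ (μ l) f                                  ∎
      l*S : cast l * S ≡ ∑ (μ l) f * ∑ G A
      l*S = begin
        cast l * S                                                   ≡⟨ cong (λ k → cast k * S) (sym (length-upTo l)) ⟩
        cast (length (upTo l)) * S                                   ≡⟨ sym (∑-const (upTo l) S) ⟩
        ∑ (upTo l) (λ _ → S)                                        ≡⟨ ∑-cong (upTo l) (λ {j} _ → shifted j) ⟩
        ∑ (upTo l) (λ j → ∑ G (λ x → f (ζ ^ j · π l x) * A x))      ≡⟨ ∑-swap (upTo l) G _ ⟩
        ∑ G (λ x → ∑ (upTo l) (λ j → f (ζ ^ j · π l x) * A x))      ≡⟨ ∑-cong G (λ {x} x∈ → trans
                                                                         (∑-*ʳ (upTo l) (A x) (λ j → f (ζ ^ j · π l x)))
                                                                         (cong (_* A x) (orbit x∈))) ⟩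
        ∑ G (λ x → ∑ (μ l) f * A x)                                 ≡⟨ ∑-*ˡ G (∑ (μ l) f) A ⟩
        ∑ (μ l) f * ∑ G A                                           ∎

    -- This does the work of the Chinese remainder theorem. Multiplication by the `separator`
    -- changes the residue at the head prime and fixes those at the other primes, so the head factor
    -- can be averaged on its own.
    average : ∀ {ls} → PrimesOfOrder ls → (f : ℕ → Carrier → ℚ) →
      ∑ G (λ x → ∏ ls (λ l → f l (π l x))) ≡ cast n * ∏ ls (λ l → inv l * ∑ (μ l) (f l))
    average {[]}     P f = trans (∑-const G 1ℚ) (cong (λ k → cast k * 1ℚ) L.length-G)
    average {l ∷ ls} P f =
      let e , e∈ , πe≢1 , πe≡1 = L.separator (headPrime P) (headDivides P) (primes (tailPrimes P)) (divide (tailPrimes P)) (head∉tail P)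
      in begin
      ∑ G (λ x → f l (π l x) * ∏ ls (λ l → f l (π l x)))
        ≡⟨ average-step (headPrime P) (headDivides P) e∈ πe≢1 (f l) (λ x → ∏ ls (λ l → f l (π l x)))
             (λ {x} _ → ∏-cong ls λ {l′} l′∈ → cong (f l′)
               (trans (L.π-* l′ e x) (trans (cong (_· π l′ x) (πe≡1 l′∈)) (·-identityˡ (π l′ x))))) ⟩
      inv l * ∑ (μ l) (f l) * ∑ G (λ x → ∏ ls (λ l → f l (π l x)))
        ≡⟨ cong (inv l * ∑ (μ l) (f l) *_) (average (tailPrimes P) f) ⟩
      inv l * ∑ (μ l) (f l) * (cast n * ∏ ls (λ l → inv l * ∑ (μ l) (f l)))
        ≡⟨ *-interchange (inv l * ∑ (μ l) (f l)) (cast n) (∏ ls (λ l → inv l * ∑ (μ l) (f l))) ⟩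
      cast n * (inv l * ∑ (μ l) (f l) * ∏ ls (λ l → inv l * ∑ (μ l) (f l)))    ∎
      where
      open ≡-Reasoning
      open +-*-Solver
      *-interchange : ∀ a b c → a * (b * c) ≡ b * (a * c)
      *-interchange = solve 3 (λ a b c → a :* (b :* c) := b :* (a :* c)) refl

    average₂ : ∀ {ls} → PrimesOfOrder ls → (f : ℕ → Carrier → Carrier → ℚ) →
      ∑ G (λ x → ∑ G (λ y → ∏ ls (λ l → f l (π l x) (π l y)))) ≡
      cast n * cast n * ∏ ls (λ l → inv l * inv l * ∑ (μ l) (λ x → ∑ (μ l) (f l x)))
    average₂ {ls} P f = begin
      ∑ G (λ x → ∑ G (λ y → ∏ ls (λ l → f l (π l x) (π l y))))
        ≡⟨ ∑-cong G (λ {x} _ → average P (λ l → f l (π l x))) ⟩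
      ∑ G (λ x → cast n * ∏ ls (λ l → inv l * ∑ (μ l) (f l (π l x))))
        ≡⟨ ∑-*ˡ G (cast n) _ ⟩
      cast n * ∑ G (λ x → ∏ ls (λ l → inv l * ∑ (μ l) (f l (π l x))))
        ≡⟨ cong (cast n *_) (average P (λ l z → inv l * ∑ (μ l) (f l z))) ⟩
      cast n * (cast n * ∏ ls (λ l → inv l * ∑ (μ l) (λ x → inv l * ∑ (μ l) (f l x))))
        ≡⟨ sym (*-assoc (cast n) (cast n) _) ⟩
      cast n * cast n * ∏ ls (λ l → inv l * ∑ (μ l) (λ x → inv l * ∑ (μ l) (f l x)))
        ≡⟨ cong (cast n * cast n *_) (∏-cong ls λ {l} _ → trans (cong (inv l *_) (∑-*ˡ (μ l) (inv l) _)) (sym (*-assoc (inv l) (inv l) _))) ⟩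
      cast n * cast n * ∏ ls (λ l → inv l * inv l * ∑ (μ l) (λ x → ∑ (μ l) (f l x)))    ∎
      where open ≡-Reasoning

-- Mean and variance of the admissible proportion at one prime, and the kernel.

module LocalMoments where

  open import Defs using (FiniteField; ofℕ)
  open import Data.Nat as ℕ using (ℕ; zero; suc)
  import Data.Nat.Properties as ℕₚ
  open import Data.Nat.Divisibility using (_∣_)
  open import Data.Nat.Primality using (Prime)
  open import Data.Rational hiding (_≟_)
  open import Data.Rational.Properties hiding (_≟_)
  open import Data.Rational.Solver
  open import Data.List using (List)
  open import Data.List.Membership.Propositional using (_∈_)
  open import Relation.Nullary using (Dec; yes; no)
  open import Relation.Binary.PropositionalEquality
  open Rationals
  open FiniteSums
  open FieldArithmetic
  open ResidueAverages

  open +-*-Solver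

  0≤1-𝟙 : ∀ {P : Set} (d : Dec P) → 0ℚ ≤ 1ℚ - 𝟙 d
  0≤1-𝟙 (yes _) = ≤-refl
  0≤1-𝟙 (no  _) = 0≤1

  1-p-q≤[1-p]*r : ∀ {p q r} → 0ℚ ≤ p → 0ℚ ≤ 1ℚ - p → 0ℚ ≤ q → 1ℚ - q ≤ r → 1ℚ - (p + q) ≤ (1ℚ - p) * r
  1-p-q≤[1-p]*r {p} {q} {r} 0≤p 0≤1-p 0≤q 1-q≤r = ≤-trans
    (≤-by-difference (0≤* 0≤p 0≤q) (solve 2 (λ p q → (con 1ℚ :- p) :* (con 1ℚ :- q) :- (con 1ℚ :- (p :+ q)) := p :* q) refl p q))
    (*-monoˡ 0≤1-p 1-q≤r)

  1-p≤1 : ∀ {p} → 0ℚ ≤ p → 1ℚ - p ≤ 1ℚ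
  1-p≤1 {p} 0≤p = ≤-by-difference 0≤p (solve 1 (λ p → con 1ℚ :- (con 1ℚ :- p) := p) refl p)

  p*q≤p : ∀ {p q} → 0ℚ ≤ p → q ≤ 1ℚ → p * q ≤ p
  p*q≤p {p} 0≤p q≤1 = ≤-trans (*-monoˡ 0≤p q≤1) (≤-reflexive (*-identityʳ p))

  -- Here u will be the excess of the count over k - 2. On [0, 2] the left side is at most 0. The
  -- range up to 3 is open only if both conditions hold, and there 3 - u (u - 2) = (3 - u) (u + 1).
  quadratic-bound : ∀ {P Q : Set} (d : Dec P) (e : Dec Q) {u} → 0ℚ ≤ u → u ≤ ofℕ 2 + 𝟙 d → u ≤ ofℕ 2 + 𝟙 e →
                    u * (u - ofℕ 2) ≤ ofℕ 3 * (𝟙 d * 𝟙 e)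
  quadratic-bound (yes _) (yes _) {u} 0≤u u≤3 _ = ≤-by-difference (0≤* (≤⇒0≤- u≤3) (0≤+ 0≤u 0≤1))
    (solve 1 (λ u → con (ofℕ 3) :* (con 1ℚ :* con 1ℚ) :- u :* (u :- con (ofℕ 2)) :=
      ((con (ofℕ 2) :+ con 1ℚ) :- u) :* (u :+ con 1ℚ)) refl u)
  quadratic-bound (no  _) e {u} 0≤u u≤2 _ = ≤-by-difference (0≤* 0≤u (≤⇒0≤- u≤2))
    (solve 2 (λ u e → con (ofℕ 3) :* (con 0ℚ :* e) :- u :* (u :- con (ofℕ 2)) := u :* ((con (ofℕ 2) :+ con 0ℚ) :- u)) refl u (𝟙 e))
  quadratic-bound d (no  _) {u} 0≤u _ u≤2 = ≤-by-difference (0≤* 0≤u (≤⇒0≤- u≤2))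
    (solve 2 (λ u e → con (ofℕ 3) :* (e :* con 0ℚ) :- u :* (u :- con (ofℕ 2)) := u :* ((con (ofℕ 2) :+ con 0ℚ) :- u)) refl u (𝟙 d))

  -- With k = l - 2 this is (l² - 1) variance ≤ spread² after cancelling (k + 1)² / l⁸; it is an equality for l = 2.
  moment-polynomial : ∀ j → let k = cast j in
    ofℕ 3 * (k + ofℕ 3) * ((k + ofℕ 2) * (k + ofℕ 2)) * (1ℚ + k * (ofℕ 7 + k * ofℕ 4)) ≤
    (ofℕ 6 + k * (ofℕ 21 + k * (ofℕ 21 + k * ofℕ 7))) * (ofℕ 6 + k * (ofℕ 21 + k * (ofℕ 21 + k * ofℕ 7)))
  moment-polynomial zero    = subst P (sym cast-0) ≤-refl
    where
    P : ℚ → Set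
    P k = ofℕ 3 * (k + ofℕ 3) * ((k + ofℕ 2) * (k + ofℕ 2)) * (1ℚ + k * (ofℕ 7 + k * ofℕ 4)) ≤
      (ofℕ 6 + k * (ofℕ 21 + k * (ofℕ 21 + k * ofℕ 7))) * (ofℕ 6 + k * (ofℕ 21 + k * (ofℕ 21 + k * ofℕ 7)))
  moment-polynomial (suc j) = subst P (sym (cast-suc j)) (≤-by-difference
    -- In powers of k the difference has constant term 0 and linear term -48 k, so it is negative
    -- for small positive real k. The substitution k = 1 + i makes all seven coefficients positive.
    (0≤horner 1729 (0≤horner 6432 (0≤horner 9399 (0≤horner 6944 (0≤horner 2775 (0≤horner 576 (0≤frac 49 1)))))))
    (solve 1 (λ i → let k = con 1ℚ :+ i; p = con (ofℕ 6) :+ k :* (con (ofℕ 21) :+ k :* (con (ofℕ 21) :+ k :* con (ofℕ 7))) in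
      p :* p :- con (ofℕ 3) :* (k :+ con (ofℕ 3)) :* ((k :+ con (ofℕ 2)) :* (k :+ con (ofℕ 2))) :*
        (con 1ℚ :+ k :* (con (ofℕ 7) :+ k :* con (ofℕ 4))) :=
      con (ofℕ 1729) :+ i :* (con (ofℕ 6432) :+ i :* (con (ofℕ 9399) :+ i :* (con (ofℕ 6944) :+
        i :* (con (ofℕ 2775) :+ i :* (con (ofℕ 576) :+ i :* con (ofℕ 49))))))) refl (cast j)))
    where
    P : ℚ → Set
    P k = ofℕ 3 * (k + ofℕ 3) * ((k + ofℕ 2) * (k + ofℕ 2)) * (1ℚ + k * (ofℕ 7 + k * ofℕ 4)) ≤
      (ofℕ 6 + k * (ofℕ 21 + k * (ofℕ 21 + k * ofℕ 7))) * (ofℕ 6 + k * (ofℕ 21 + k * (ofℕ 21 + k * ofℕ 7)))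
    0≤horner : ∀ a {p} → 0ℚ ≤ p → 0ℚ ≤ ofℕ a + cast j * p
    0≤horner a 0≤p = 0≤+ (0≤frac a 1) (0≤* (0≤cast j) 0≤p)

  module _ {q : ℕ} (2<q : 2 ℕ.< q) (F : FiniteField q) where

    open Lemmas 2<q F using (Carrier; 1#; _⁻¹; _≟_; n; μ)
      renaming (_*_ to infixl 7 _·_; *-assoc to ·-assoc; *-comm to ·-comm; *-identityˡ to ·-identityˡ; *-identityʳ to ·-identityʳ)
    private module L = Lemmas 2<q F

    δ : Carrier → Carrier → ℚ
    δ x y = 𝟙 (x ≟ y)

    δ̅ : Carrier → Carrier → ℚ
    δ̅ x y = 1ℚ - δ x y

    0≤δ : ∀ x y → 0ℚ ≤ δ x y
    0≤δ x y = 0≤𝟙 (x ≟ y)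

    0≤δ̅ : ∀ x y → 0ℚ ≤ δ̅ x y
    0≤δ̅ x y = 0≤1-𝟙 (x ≟ y)

    δ̅≤1 : ∀ x y → δ̅ x y ≤ 1ℚ
    δ̅≤1 x y = 1-p≤1 (0≤δ x y)

    -- For a residue a of an element, x and y those of t and w, the four factors say that the residues
    -- of a, a t, a w and w / (a t) are nontrivial.
    admissible : Carrier → Carrier → Carrier → ℚ
    admissible x y a = δ̅ a 1# * (δ̅ (a · x) 1# * (δ̅ (a · y) 1# * δ̅ y (a · x)))

    count : ℕ → Carrier → Carrier → ℚ
    count l x y = ∑ (μ l) (admissible x y)

    proportion : ℕ → Carrier → Carrier → ℚ
    proportion l x y = inv l * count l x y

    mean : ℕ → ℚ
    mean l = inv l * inv l * ∑ (μ l) (λ x → ∑ (μ l) (proportion l x))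

    deviation : ℕ → Carrier → Carrier → ℚ
    deviation l x y = proportion l x y - mean l

    variance : ℕ → ℚ
    variance l = inv l * inv l * ∑ (μ l) (λ x → ∑ (μ l) (λ y → deviation l x y * deviation l x y))

    density : ℕ → ℚ
    density l = (cast l - 1ℚ) * inv l

    -- Not a standard deviation: it is what the target error term grants to the prime l. The factor
    -- of θ⁴ W³ at l is 8 θ(l)⁴, and the part of it that is not the mean is available for the
    -- deviation.
    spread : ℕ → ℚ
    spread l = ofℕ 8 * (density l * density l * density l * density l) - mean l

    module _ {l : ℕ} (pl : Prime l) (l∣n : l ∣ n) where

      private
        1≤l : 1 ℕ.≤ l
        1≤l = prime≥1 pl
        -- In the variable k = l - 2 ≥ 0 the polynomials for the spread and for l² - 1 have
        -- nonnegative coefficients.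
        k ℓ : ℚ
        ℓ = cast l
        k = cast (l ℕ.∸ 2)
        ℓ≡k+2 : ℓ ≡ k + ofℕ 2
        ℓ≡k+2 = trans (cong cast (sym (ℕₚ.m∸n+n≡m (prime≥2 pl)))) (trans (cast-+ (l ℕ.∸ 2) 2) (cong (k +_) (cast≡ofℕ 2)))
        r : ℚ
        r = inv l
        ℓr≡1 : ℓ * r ≡ 1ℚ
        ℓr≡1 = cast*inv 1≤l
        M : List Carrier
        M = μ l
        translate : ∀ {a} → a ∈ M → (f : Carrier → ℚ) → ∑ M (λ x → f (a · x)) ≡ ∑ M f
        translate = ∑μ-translate 2<q F 1≤l

      ∑μ-const : ∀ c → ∑ M (λ _ → c) ≡ ℓ * c
      ∑μ-const c = trans (∑-const M c) (cong (λ m → cast m * c) (L.length-μ pl l∣n))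

      ∑μ-δ : ∀ {a} → a ∈ M → ∑ M (λ x → δ x a) ≡ 1ℚ
      ∑μ-δ a∈ = ∑-δ₁ _≟_ (L.μ-unique l) a∈

      ∑μ-δ* : ∀ {a} → a ∈ M → (f : Carrier → ℚ) → ∑ M (λ x → δ x a * f x) ≡ f a
      ∑μ-δ* a∈ f = ∑-δ _≟_ f (L.μ-unique l) a∈

      ∑μ-δ-scaled : ∀ {a b} → a ∈ M → b ∈ M → ∑ M (λ x → δ (a · x) b) ≡ 1ℚ
      ∑μ-δ-scaled a∈ b∈ = trans (translate a∈ (λ x → δ x _)) (∑μ-δ b∈)

      ∑μ-δ-scaledʳ : ∀ {a b} → a ∈ M → b ∈ M → ∑ M (λ x → δ (x · a) b) ≡ 1ℚ
      ∑μ-δ-scaledʳ {a} {b} a∈ b∈ = trans (∑-cong M λ {x} _ → cong (λ z → δ z b) (·-comm x a)) (∑μ-δ-scaled a∈ b∈)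

      δ-sym : ∀ x y → δ x y ≡ δ y x
      δ-sym x y = 𝟙-sym (x ≟ y) (y ≟ x) sym sym

      -- Inclusion-exclusion for two excluded points, with ℓ - 1 - 1 = k. In its uses c is the
      -- indicator that the two points coincide.
      ∑μ-1-p-q+pq : ∀ (f g : Carrier → ℚ) {c} → ∑ M f ≡ 1ℚ → ∑ M g ≡ 1ℚ → ∑ M (λ x → g x * f x) ≡ c →
                   ∑ M (λ x → (1ℚ - f x) * (1ℚ - g x)) ≡ k + c
      ∑μ-1-p-q+pq f g {c} Σf Σg Σgf = begin
        ∑ M (λ x → (1ℚ - f x) * (1ℚ - g x))
          ≡⟨ ∑-cong M (λ {x} _ → solve 2 (λ a b → (con 1ℚ :- a) :* (con 1ℚ :- b) := (con 1ℚ :- (a :+ b)) :+ b :* a) refl (f x) (g x)) ⟩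
        ∑ M (λ x → (1ℚ - (f x + g x)) + g x * f x)
          ≡⟨ ∑-+ M _ _ ⟩
        ∑ M (λ x → 1ℚ - (f x + g x)) + ∑ M (λ x → g x * f x)
          ≡⟨ cong₂ _+_ (trans (∑-- M _ _) (cong₂ _-_ (∑μ-const 1ℚ) (trans (∑-+ M f g) (cong₂ _+_ Σf Σg)))) Σgf ⟩
        (ℓ * 1ℚ - (1ℚ + 1ℚ)) + c
          ≡⟨ cong (λ z → (z * 1ℚ - (1ℚ + 1ℚ)) + c) ℓ≡k+2 ⟩
        ((k + ofℕ 2) * 1ℚ - (1ℚ + 1ℚ)) + c
          ≡⟨ solve 2 (λ k c → ((k :+ con (ofℕ 2)) :* con 1ℚ :- (con 1ℚ :+ con 1ℚ)) :+ c := k :+ c) refl k c ⟩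
        k + c ∎
        where open ≡-Reasoning

      -- The excluded values of y are the inverse of a and a x; they coincide when a² x = 1.
      ∑-count-y : ∀ {a x} → a ∈ M → x ∈ M →
        ∑ M (λ y → δ̅ (a · y) 1# * δ̅ y (a · x)) ≡ k + δ (a · (a · x)) 1#
      ∑-count-y {a} {x} a∈ x∈ = ∑μ-1-p-q+pq (λ y → δ (a · y) 1#) (λ y → δ y (a · x))
        (∑μ-δ-scaled a∈ (L.1∈μ l)) (∑μ-δ (L.*∈μ l a∈ x∈)) (∑μ-δ* (L.*∈μ l a∈ x∈) (λ y → δ (a · y) 1#))

      -- Put z = a x. The term k is summed over the ℓ - 1 = k + 1 residues z ≠ 1, and the indicator
      -- adds 1 at the inverse of a, unless that is the excluded z = 1.
      ∑-count-x : ∀ {a} → a ∈ M →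
        ∑ M (λ x → δ̅ (a · x) 1# * (k + δ (a · (a · x)) 1#)) ≡ (k + 1ℚ) * k + 1ℚ - δ a 1#
      ∑-count-x {a} a∈ = begin
        ∑ M (λ x → δ̅ (a · x) 1# * (k + δ (a · (a · x)) 1#))
          ≡⟨ translate a∈ (λ z → δ̅ z 1# * (k + δ (a · z) 1#)) ⟩
        ∑ M (λ z → δ̅ z 1# * (k + δ (a · z) 1#))
          ≡⟨ ∑-cong M (λ {z} _ → solve 3 (λ k i j → (con 1ℚ :- i) :* (k :+ j) := k :- i :* k :+ j :- i :* j) refl k (δ z 1#) (δ (a · z) 1#)) ⟩
        ∑ M (λ z → k - δ z 1# * k + δ (a · z) 1# - δ z 1# * δ (a · z) 1#)
          ≡⟨ trans (∑-- M _ _) (cong₂ _-_ (trans (∑-+ M _ _) (cong₂ _+_ (trans (∑-- M _ _) (cong₂ _-_ (∑μ-const k) (∑μ-δ* (L.1∈μ l) (λ _ → k))))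
               (∑μ-δ-scaled a∈ (L.1∈μ l)))) (∑μ-δ* (L.1∈μ l) (λ z → δ (a · z) 1#))) ⟩
        ℓ * k - k + 1ℚ - δ (a · 1#) 1#
          ≡⟨ cong₂ (λ u v → u * k - k + 1ℚ - δ v 1#) ℓ≡k+2 (·-identityʳ a) ⟩
        (k + ofℕ 2) * k - k + 1ℚ - δ a 1#
          ≡⟨ solve 2 (λ k d → (k :+ con (ofℕ 2)) :* k :- k :+ con 1ℚ :- d := (k :+ con 1ℚ) :* k :+ con 1ℚ :- d) refl k (δ a 1#) ⟩
        (k + 1ℚ) * k + 1ℚ - δ a 1# ∎
        where open ≡-Reasoning

      -- With A = a, B = a x and C = y / (a x) one has a y = A B C, so this counts the triples of
      -- nontrivial residues with nontrivial product: (l - 1)³ - (l - 1) (l - 2).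
      total : ℚ
      total = (k + 1ℚ) * ((k + 1ℚ) * k + 1ℚ)

      ∑-count : ∑ M (λ x → ∑ M (count l x)) ≡ total
      ∑-count = begin
        ∑ M (λ x → ∑ M (λ y → ∑ M (admissible x y)))
          ≡⟨ ∑-cong M (λ {x} _ → ∑-swap M M (admissible x)) ⟩
        ∑ M (λ x → ∑ M (λ a → ∑ M (λ y → admissible x y a)))
          ≡⟨ ∑-swap M M (λ x a → ∑ M (λ y → admissible x y a)) ⟩
        ∑ M (λ a → ∑ M (λ x → ∑ M (λ y → admissible x y a)))
          ≡⟨ ∑-cong M (λ {a} a∈ → trans (∑-cong M λ {x} x∈ → trans (∑-*ˡ M (δ̅ a 1#) _)
               (cong (δ̅ a 1# *_) (trans (∑-*ˡ M (δ̅ (a · x) 1#) _) (cong (δ̅ (a · x) 1# *_) (∑-count-y a∈ x∈)))))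
               (trans (∑-*ˡ M (δ̅ a 1#) _) (cong (δ̅ a 1# *_) (∑-count-x a∈)))) ⟩
        ∑ M (λ a → δ̅ a 1# * (T - δ a 1#))
          ≡⟨ ∑-cong M (λ {a} _ → solve 2 (λ d t → (con 1ℚ :- d) :* (t :- d) := t :- d :* (t :+ (con 1ℚ :- d))) refl (δ a 1#) T) ⟩
        ∑ M (λ a → T - δ a 1# * (T + δ̅ a 1#))
          ≡⟨ trans (∑-- M _ _) (cong₂ _-_ (∑μ-const T) (∑μ-δ* (L.1∈μ l) (λ a → T + δ̅ a 1#))) ⟩
        ℓ * T - (T + δ̅ 1# 1#)
          ≡⟨ cong₂ (λ u v → u * T - (T + (1ℚ - v))) ℓ≡k+2 (𝟙-refl _≟_ 1#) ⟩
        (k + ofℕ 2) * T - (T + (1ℚ - 1ℚ))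
          ≡⟨ solve 2 (λ k t → (k :+ con (ofℕ 2)) :* t :- (t :+ (con 1ℚ :- con 1ℚ)) := (k :+ con 1ℚ) :* t) refl k T ⟩
        total ∎
        where
        open ≡-Reasoning
        T : ℚ
        T = (k + 1ℚ) * k + 1ℚ

      -- Union bound: each of the four conditions excludes one of the k + 2 residues a.
      k-2≤count : ∀ {x y} → x ∈ M → y ∈ M → k - ofℕ 2 ≤ count l x y
      k-2≤count {x} {y} x∈ y∈ = subst (_≤ count l x y) lower (∑-mono M λ {a} _ →
        1-p-q≤[1-p]*r (0≤δ a 1#) (0≤δ̅ a 1#) (0≤+ (0≤δ (a · x) 1#) (0≤+ (0≤δ (a · y) 1#) (0≤δ y (a · x))))
          (1-p-q≤[1-p]*r (0≤δ (a · x) 1#) (0≤δ̅ (a · x) 1#) (0≤+ (0≤δ (a · y) 1#) (0≤δ y (a · x)))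
            (1-p-q≤[1-p]*r (0≤δ (a · y) 1#) (0≤δ̅ (a · y) 1#) (0≤δ y (a · x)) ≤-refl)))
        where
        lower : ∑ M (λ a → 1ℚ - (δ a 1# + (δ (a · x) 1# + (δ (a · y) 1# + δ y (a · x))))) ≡ k - ofℕ 2
        lower = begin
          ∑ M (λ a → 1ℚ - (δ a 1# + (δ (a · x) 1# + (δ (a · y) 1# + δ y (a · x)))))
            ≡⟨ trans (∑-- M _ _) (cong₂ _-_ (∑μ-const 1ℚ) (trans (∑-+ M _ _) (cong₂ _+_ (∑μ-δ (L.1∈μ l))
                 (trans (∑-+ M _ _) (cong₂ _+_ (∑μ-δ-scaledʳ x∈ (L.1∈μ l)) (trans (∑-+ M _ _) (cong₂ _+_ (∑μ-δ-scaledʳ y∈ (L.1∈μ l))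
                   (trans (∑-cong M λ {a} _ → δ-sym y (a · x)) (∑μ-δ-scaledʳ x∈ y∈))))))))) ⟩
          ℓ * 1ℚ - (1ℚ + (1ℚ + (1ℚ + 1ℚ)))
            ≡⟨ cong (λ z → z * 1ℚ - (1ℚ + (1ℚ + (1ℚ + 1ℚ)))) ℓ≡k+2 ⟩
          (k + ofℕ 2) * 1ℚ - (1ℚ + (1ℚ + (1ℚ + 1ℚ)))
            ≡⟨ solve 1 (λ k → (k :+ con (ofℕ 2)) :* con 1ℚ :- (con 1ℚ :+ (con 1ℚ :+ (con 1ℚ :+ con 1ℚ))) := k :- con (ofℕ 2)) refl k ⟩
          k - ofℕ 2 ∎
          where open ≡-Reasoning

      ∑-two-factors : ∀ {x} → x ∈ M → ∑ M (λ a → δ̅ (a · x) 1# * δ̅ a 1#) ≡ k + δ x 1#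
      ∑-two-factors {x} x∈ = ∑μ-1-p-q+pq (λ a → δ (a · x) 1#) (λ a → δ a 1#) (∑μ-δ-scaledʳ x∈ (L.1∈μ l)) (∑μ-δ (L.1∈μ l))
        (trans (∑μ-δ* (L.1∈μ l) (λ a → δ (a · x) 1#)) (cong (λ z → δ z 1#) (·-identityˡ x)))

      -- Keep only a ≠ 1 and a x ≠ 1. They exclude two residues, or a single one when x = 1.
      count≤x : ∀ {x} y → x ∈ M → count l x y ≤ k + δ x 1#
      count≤x {x} y x∈ = subst (count l x y ≤_) (∑-two-factors x∈) (∑-mono M λ {a} _ → ≤-trans
        (*-monoˡ (0≤δ̅ a 1#) (p*q≤p (0≤δ̅ (a · x) 1#) (≤-trans (p*q≤p (0≤δ̅ (a · y) 1#) (δ̅≤1 y (a · x))) (δ̅≤1 (a · y) 1#))))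
        (≤-reflexive (*-comm (δ̅ a 1#) (δ̅ (a · x) 1#))))

      count≤y : ∀ x {y} → y ∈ M → count l x y ≤ k + δ y 1#
      count≤y x {y} y∈ = subst (count l x y ≤_) (∑-two-factors y∈) (∑-mono M λ {a} _ → ≤-trans
        (*-monoˡ (0≤δ̅ a 1#) (≤-trans (≤-reflexive (*-comm (δ̅ (a · x) 1#) (δ̅ (a · y) 1# * δ̅ y (a · x))))
          (≤-trans (p*q≤p (0≤* (0≤δ̅ (a · y) 1#) (0≤δ̅ y (a · x))) (δ̅≤1 (a · x) 1#)) (p*q≤p (0≤δ̅ (a · y) 1#) (δ̅≤1 y (a · x))))))
        (≤-reflexive (*-comm (δ̅ a 1#) (δ̅ (a · y) 1#))))

      -- The count lies between k - 2 and k, except that at (1 , 1) it may be k + 1.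
      count²≤ : ∀ {x y} → x ∈ M → y ∈ M →
        count l x y * count l x y ≤ (k + k - ofℕ 2) * count l x y - k * (k - ofℕ 2) + ofℕ 3 * (δ x 1# * δ y 1#)
      count²≤ {x} {y} x∈ y∈ = ≤-by-difference (≤⇒0≤- (quadratic-bound (x ≟ 1#) (y ≟ 1#) {u} (≤⇒0≤- (k-2≤count x∈ y∈))
        (shifted (count≤x y x∈)) (shifted (count≤y x y∈))))
        (solve 3 (λ c k d → (k :+ k :- con (ofℕ 2)) :* c :- k :* (k :- con (ofℕ 2)) :+ d :- c :* c :=
          d :- (c :- (k :- con (ofℕ 2))) :* ((c :- (k :- con (ofℕ 2))) :- con (ofℕ 2))) refl (count l x y) k (ofℕ 3 * (δ x 1# * δ y 1#)))
        where
        u : ℚ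
        u = count l x y - (k - ofℕ 2)
        shifted : ∀ {d} → count l x y ≤ k + d → u ≤ ofℕ 2 + d
        shifted {d} h = ≤-by-difference (≤⇒0≤- h)
          (solve 3 (λ c k d → (con (ofℕ 2) :+ d) :- (c :- (k :- con (ofℕ 2))) := (k :+ d) :- c) refl (count l x y) k d)

      -- The pointwise bound on the square is linear in the count, so the second moment is reduced
      -- to the first moment `total` and no further counting is needed.
      ∑-count² : ∑ M (λ x → ∑ M (λ y → count l x y * count l x y)) ≤
                 (k + k - ofℕ 2) * total - ℓ * ℓ * (k * (k - ofℕ 2)) + ofℕ 3
      ∑-count² = subst (∑ M (λ x → ∑ M (λ y → count l x y * count l x y)) ≤_) upper (∑-mono M λ x∈ → ∑-mono M λ y∈ → count²≤ x∈ y∈)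
        where
        open ≡-Reasoning
        A B : ℚ
        A = k + k - ofℕ 2
        B = k * (k - ofℕ 2)
        inner : ∀ x → ∑ M (λ y → A * count l x y - B + ofℕ 3 * (δ x 1# * δ y 1#)) ≡
                      A * ∑ M (count l x) - ℓ * B + ofℕ 3 * δ x 1#
        inner x = trans (∑-+ M _ _) (cong₂ _+_ (trans (∑-- M _ _) (cong₂ _-_ (∑-*ˡ M A _) (∑μ-const B)))
          (trans (∑-*ˡ M (ofℕ 3) _) (cong (ofℕ 3 *_) (trans (∑-*ˡ M (δ x 1#) _) (trans (cong (δ x 1# *_) (∑μ-δ (L.1∈μ l))) (*-identityʳ (δ x 1#)))))))
        upper : ∑ M (λ x → ∑ M (λ y → A * count l x y - B + ofℕ 3 * (δ x 1# * δ y 1#))) ≡ A * total - ℓ * ℓ * B + ofℕ 3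
        upper = begin
          ∑ M (λ x → ∑ M (λ y → A * count l x y - B + ofℕ 3 * (δ x 1# * δ y 1#)))
            ≡⟨ ∑-cong M (λ {x} _ → inner x) ⟩
          ∑ M (λ x → A * ∑ M (count l x) - ℓ * B + ofℕ 3 * δ x 1#)
            ≡⟨ trans (∑-+ M _ _) (cong₂ _+_ (trans (∑-- M _ _) (cong₂ _-_ (trans (∑-*ˡ M A _) (cong (A *_) ∑-count)) (∑μ-const (ℓ * B))))
                 (trans (∑-*ˡ M (ofℕ 3) _) (cong (ofℕ 3 *_) (∑μ-δ (L.1∈μ l))))) ⟩
          A * total - ℓ * (ℓ * B) + ofℕ 3 * 1ℚ
            ≡⟨ cong₂ (λ u v → A * total - u + v) (sym (*-assoc ℓ ℓ B)) (*-identityʳ (ofℕ 3)) ⟩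
          A * total - ℓ * ℓ * B + ofℕ 3 ∎

      mean-formula : mean l ≡ r * r * r * total
      mean-formula = trans (cong (r * r *_) (trans (∑-cong M λ {x} _ → ∑-*ˡ M r (count l x)) (trans (∑-*ˡ M r _) (cong (r *_) ∑-count))))
        (solve 2 (λ r t → r :* r :* (r :* t) := r :* r :* r :* t) refl r total)

      ∑∑-const : ∀ c → r * r * ∑ M (λ _ → ∑ M (λ _ → c)) ≡ c
      ∑∑-const c = begin
        r * r * ∑ M (λ _ → ∑ M (λ _ → c))     ≡⟨ cong (r * r *_) (trans (∑-cong M λ _ → ∑μ-const c) (∑μ-const (ℓ * c))) ⟩
        r * r * (ℓ * (ℓ * c))                 ≡⟨ solve 3 (λ r l c → r :* r :* (l :* (l :* c)) := (l :* r) :* (l :* r) :* c) refl r ℓ c ⟩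
        ℓ * r * (ℓ * r) * c                   ≡⟨ cong (λ z → z * z * c) ℓr≡1 ⟩
        1ℚ * 1ℚ * c                           ≡⟨ solve 1 (λ c → con 1ℚ :* con 1ℚ :* c := c) refl c ⟩
        c ∎
        where open ≡-Reasoning

      ∑-deviation : r * r * ∑ M (λ x → ∑ M (deviation l x)) ≡ 0ℚ
      ∑-deviation = begin
        r * r * ∑ M (λ x → ∑ M (deviation l x))
          ≡⟨ cong (r * r *_) (trans (∑-cong M λ {x} _ → ∑-- M (proportion l x) (λ _ → mean l)) (∑-- M _ _)) ⟩
        r * r * (∑ M (λ x → ∑ M (proportion l x)) - ∑ M (λ _ → ∑ M (λ _ → mean l)))
          ≡⟨ solve 3 (λ r a b → r :* r :* (a :- b) := r :* r :* a :- r :* r :* b) refl r _ _ ⟩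
        mean l - r * r * ∑ M (λ _ → ∑ M (λ _ → mean l))
          ≡⟨ cong (λ z → mean l - z) (∑∑-const (mean l)) ⟩
        mean l - mean l
          ≡⟨ +-inverseʳ (mean l) ⟩
        0ℚ ∎
        where open ≡-Reasoning

      0≤count : ∀ x y → 0ℚ ≤ count l x y
      0≤count x y = 0≤∑ M λ {a} _ → 0≤* (0≤δ̅ a 1#) (0≤* (0≤δ̅ (a · x) 1#) (0≤* (0≤δ̅ (a · y) 1#) (0≤δ̅ y (a · x))))

      0≤mean : 0ℚ ≤ mean l
      0≤mean = 0≤* (0≤* (0≤inv l) (0≤inv l)) (0≤∑ M λ {x} _ → 0≤∑ M λ {y} _ → 0≤* (0≤inv l) (0≤count x y))

      -- The last factor is 7 (l - 1)³ - 1: since l ((l - 1)² - (l - 1) + 1) = (l - 1)³ + 1, the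
      -- mean is (l - 1) ((l - 1)³ + 1) / l⁴.
      spread-formula : spread l ≡ r * r * r * r * (k + 1ℚ) * (ofℕ 6 + k * (ofℕ 21 + k * (ofℕ 21 + k * ofℕ 7)))
      spread-formula = begin
        ofℕ 8 * (density l * density l * density l * density l) - mean l
          ≡⟨ cong (λ m → ofℕ 8 * (density l * density l * density l * density l) - m) mean-scaled ⟩
        ofℕ 8 * (density l * density l * density l * density l) - ℓ * r * (r * r * r * total)
          ≡⟨ cong (λ z → ofℕ 8 * ((z - 1ℚ) * r * ((z - 1ℚ) * r) * ((z - 1ℚ) * r) * ((z - 1ℚ) * r)) - z * r * (r * r * r * total)) ℓ≡k+2 ⟩
        ofℕ 8 * ((k + ofℕ 2 - 1ℚ) * r * ((k + ofℕ 2 - 1ℚ) * r) * ((k + ofℕ 2 - 1ℚ) * r) * ((k + ofℕ 2 - 1ℚ) * r)) -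
          (k + ofℕ 2) * r * (r * r * r * total)
          ≡⟨ solve 2 (λ k r → let one = con 1ℚ; two = con (ofℕ 2); s = (k :+ two :- one) :* r in
               con (ofℕ 8) :* (s :* s :* s :* s) :- (k :+ two) :* r :* (r :* r :* r :* ((k :+ one) :* ((k :+ one) :* k :+ one))) :=
               r :* r :* r :* r :* (k :+ one) :* (con (ofℕ 6) :+ k :* (con (ofℕ 21) :+ k :* (con (ofℕ 21) :+ k :* con (ofℕ 7))))) refl k r ⟩
        r * r * r * r * (k + 1ℚ) * (ofℕ 6 + k * (ofℕ 21 + k * (ofℕ 21 + k * ofℕ 7))) ∎
        where
        open ≡-Reasoning
        mean-scaled : mean l ≡ ℓ * r * (r * r * r * total)
        mean-scaled = trans mean-formula (trans (sym (*-identityˡ (r * r * r * total))) (cong (_* (r * r * r * total)) (sym ℓr≡1)))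

      0≤spread : 0ℚ ≤ spread l
      0≤spread = subst (0ℚ ≤_) (sym spread-formula) (0≤* (0≤* (0≤* (0≤* (0≤* 0≤r 0≤r) 0≤r) 0≤r) (0≤+ 0≤k 0≤1))
        (0≤+ (0≤frac 6 1) (0≤* 0≤k (0≤+ (0≤frac 21 1) (0≤* 0≤k (0≤+ (0≤frac 21 1) (0≤* 0≤k (0≤frac 7 1))))))))
        where
        0≤r = 0≤inv l
        0≤k = 0≤cast (l ℕ.∸ 2)

      variance≡ : variance l ≡ r * r * (r * r * ∑ M (λ x → ∑ M (λ y → count l x y * count l x y))) - mean l * mean l
      variance≡ = begin
        r * r * ∑ M (λ x → ∑ M (λ y → deviation l x y * deviation l x y))
          ≡⟨ cong (r * r *_) (trans (∑-cong M λ {x} _ → trans (∑-cong M λ {y} _ →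
               solve 3 (λ r c m → (r :* c :- m) :* (r :* c :- m) := r :* r :* (c :* c) :+ m :* m :- (m :+ m) :* (r :* c)) refl r (count l x y) m)
               (split (λ y → r * r * (count l x y * count l x y)) (λ _ → m * m) (λ y → (m + m) * proportion l x y)))
               (split _ _ _)) ⟩
        r * r * (∑ M (λ x → ∑ M (λ y → r * r * (count l x y * count l x y))) + ∑ M (λ _ → ∑ M (λ _ → m * m)) -
                 ∑ M (λ x → ∑ M (λ y → (m + m) * proportion l x y)))
          ≡⟨ cong₂ (λ a b → r * r * (a + ∑ M (λ _ → ∑ M (λ _ → m * m)) - b))
               (trans (∑-cong M λ {x} _ → ∑-*ˡ M (r * r) _) (∑-*ˡ M (r * r) _))
               (trans (∑-cong M λ {x} _ → ∑-*ˡ M (m + m) _) (∑-*ˡ M (m + m) _)) ⟩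
        r * r * (r * r * S + ∑ M (λ _ → ∑ M (λ _ → m * m)) - (m + m) * ∑ M (λ x → ∑ M (proportion l x)))
          ≡⟨ solve 5 (λ r S c m p → r :* r :* (r :* r :* S :+ c :- (m :+ m) :* p) :=
               r :* r :* (r :* r :* S) :+ r :* r :* c :- (m :+ m) :* (r :* r :* p)) refl r S _ m _ ⟩
        r * r * (r * r * S) + r * r * ∑ M (λ _ → ∑ M (λ _ → m * m)) - (m + m) * m
          ≡⟨ cong (λ z → r * r * (r * r * S) + z - (m + m) * m) (∑∑-const (m * m)) ⟩
        r * r * (r * r * S) + m * m - (m + m) * m
          ≡⟨ solve 2 (λ a m → a :+ m :* m :- (m :+ m) :* m := a :- m :* m) refl (r * r * (r * r * S)) m ⟩
        r * r * (r * r * S) - m * m ∎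
        where
        open ≡-Reasoning
        m S : ℚ
        m = mean l
        S = ∑ M (λ x → ∑ M (λ y → count l x y * count l x y))
        split : ∀ (f g h : Carrier → ℚ) → ∑ M (λ x → f x + g x - h x) ≡ ∑ M f + ∑ M g - ∑ M h
        split f g h = trans (∑-- M _ h) (cong (_- ∑ M h) (∑-+ M f g))

      1≤ℓ² : 0ℚ ≤ ℓ * ℓ - 1ℚ
      1≤ℓ² = subst (0ℚ ≤_) (trans (solve 1 (λ k → (k :+ con 1ℚ) :* (k :+ con (ofℕ 3)) :=
          (k :+ con (ofℕ 2)) :* (k :+ con (ofℕ 2)) :- con 1ℚ) refl k) (cong (λ z → z * z - 1ℚ) (sym ℓ≡k+2)))
        (0≤* (0≤+ (0≤cast (l ℕ.∸ 2)) 0≤1) (0≤+ (0≤cast (l ℕ.∸ 2)) (0≤frac 3 1)))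

      variance-bound : (ℓ * ℓ - 1ℚ) * variance l ≤ spread l * spread l
      variance-bound = ≤-trans (*-monoˡ 1≤ℓ² (≤-trans (≤-reflexive variance≡) (+-monoˡ-≤ (- (mean l * mean l))
          (*-monoˡ (0≤* 0≤r 0≤r) (*-monoˡ (0≤* 0≤r 0≤r) ∑-count²)))))
        (≤-trans (≤-reflexive polynomial) (≤-trans (*-monoˡ (0≤p² X) (moment-polynomial (l ℕ.∸ 2))) (≤-reflexive square)))
        where
        open ≡-Reasoning
        0≤r = 0≤inv l
        X U A B : ℚ
        X = r * r * r * r * (k + 1ℚ)
        U = (k + k - ofℕ 2) * total - ℓ * ℓ * (k * (k - ofℕ 2)) + ofℕ 3
        A = ofℕ 3 * (k + ofℕ 3) * ((k + ofℕ 2) * (k + ofℕ 2)) * (1ℚ + k * (ofℕ 7 + k * ofℕ 4))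
        B = ofℕ 6 + k * (ofℕ 21 + k * (ofℕ 21 + k * ofℕ 7))
        square : X * X * (B * B) ≡ spread l * spread l
        square = trans (solve 2 (λ x b → x :* x :* (b :* b) := (x :* b) :* (x :* b)) refl X B) (cong (λ z → z * z) (sym spread-formula))
        polynomial : (ℓ * ℓ - 1ℚ) * (r * r * (r * r * U) - mean l * mean l) ≡ X * X * A
        polynomial = begin
          (ℓ * ℓ - 1ℚ) * (r * r * (r * r * U) - mean l * mean l)
            ≡⟨ cong (λ z → (ℓ * ℓ - 1ℚ) * (r * r * (r * r * U) - z * z)) mean-formula ⟩
          (ℓ * ℓ - 1ℚ) * (r * r * (r * r * U) - r * r * r * total * (r * r * r * total))
            -- The solver does not know that ℓ r = 1. Factors 1 are inserted and then replaced by ℓ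
            -- r, four in the first term and two in the second, so that both terms become multiples
            -- of r⁸.
            ≡⟨ solve 4 (λ l r u t → let o = con 1ℚ in (l :* l :- o) :* (r :* r :* (r :* r :* u) :- r :* r :* r :* t :* (r :* r :* r :* t)) :=
                 (l :* l :- o) :* (r :* r :* (r :* r :* u) :* (o :* o :* o :* o) :- r :* r :* r :* t :* (r :* r :* r :* t) :* (o :* o))) refl ℓ r U total ⟩
          (ℓ * ℓ - 1ℚ) * (r * r * (r * r * U) * (1ℚ * 1ℚ * 1ℚ * 1ℚ) - r * r * r * total * (r * r * r * total) * (1ℚ * 1ℚ))
            ≡⟨ cong (λ e → (ℓ * ℓ - 1ℚ) * (r * r * (r * r * U) * (e * e * e * e) - r * r * r * total * (r * r * r * total) * (e * e))) (sym ℓr≡1) ⟩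
          (ℓ * ℓ - 1ℚ) * (r * r * (r * r * U) * (ℓ * r * (ℓ * r) * (ℓ * r) * (ℓ * r)) - r * r * r * total * (r * r * r * total) * (ℓ * r * (ℓ * r)))
            ≡⟨ solve 4 (λ l r u t → (l :* l :- con 1ℚ) :* (r :* r :* (r :* r :* u) :* (l :* r :* (l :* r) :* (l :* r) :* (l :* r)) :-
                 r :* r :* r :* t :* (r :* r :* r :* t) :* (l :* r :* (l :* r))) :=
                 (r :* r :* r :* r) :* (r :* r :* r :* r) :* ((l :* l :- con 1ℚ) :* (l :* l) :* (l :* l :* u :- t :* t))) refl ℓ r U total ⟩
          r * r * r * r * (r * r * r * r) * ((ℓ * ℓ - 1ℚ) * (ℓ * ℓ) * (ℓ * ℓ * U - total * total))
            ≡⟨ cong (λ z → r * r * r * r * (r * r * r * r) * ((z * z - 1ℚ) * (z * z) *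
                 (z * z * ((k + k - ofℕ 2) * total - z * z * (k * (k - ofℕ 2)) + ofℕ 3) - total * total))) ℓ≡k+2 ⟩
          r * r * r * r * (r * r * r * r) * (((k + ofℕ 2) * (k + ofℕ 2) - 1ℚ) * ((k + ofℕ 2) * (k + ofℕ 2)) *
                 ((k + ofℕ 2) * (k + ofℕ 2) * ((k + k - ofℕ 2) * total - (k + ofℕ 2) * (k + ofℕ 2) * (k * (k - ofℕ 2)) + ofℕ 3) - total * total))
            ≡⟨ cong (r * r * r * r * (r * r * r * r) *_) (solve 1 (λ k → let o = con 1ℚ; tw = con (ofℕ 2); th = con (ofℕ 3); l = k :+ tw; t = (k :+ o) :* ((k :+ o) :* k :+ o) in
                 (l :* l :- o) :* (l :* l) :* (l :* l :* ((k :+ k :- tw) :* t :- l :* l :* (k :* (k :- tw)) :+ th) :- t :* t) :=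
                 (k :+ o) :* (k :+ o) :* (th :* (k :+ th) :* (l :* l) :* (o :+ k :* (con (ofℕ 7) :+ k :* con (ofℕ 4))))) refl k) ⟩
          r * r * r * r * (r * r * r * r) * ((k + 1ℚ) * (k + 1ℚ) * A)
            ≡⟨ solve 3 (λ s j a → s :* s :* (j :* j :* a) := s :* j :* (s :* j) :* a) refl (r * r * r * r) (k + 1ℚ) A ⟩
          X * X * A ∎

    -- The reproducing kernel of the mean-zero functions on μ l × μ l.
    kernel : ℕ → Carrier → Carrier → Carrier → Carrier → ℚ
    kernel l x y x′ y′ = cast l * cast l * (δ x x′ * δ y y′) - 1ℚ

    -- The dimension of the space of mean-zero functions on `μ l` × `μ l`, which is the trace of its
    -- reproducing kernel.
    kernelSize : ℕ → ℚ
    kernelSize l = cast l * cast l - 1ℚ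

    kernel-diagonal : ∀ l x y → kernel l x y x y ≡ kernelSize l
    kernel-diagonal l x y = cong (_- 1ℚ) (trans (cong₂ (λ a b → cast l * cast l * (a * b)) (𝟙-refl _≟_ x) (𝟙-refl _≟_ y))
      (trans (cong (cast l * cast l *_) (*-identityˡ 1ℚ)) (*-identityʳ (cast l * cast l))))

    module _ {l : ℕ} (pl : Prime l) (l∣n : l ∣ n) where

      private
        M : List Carrier
        M = μ l
        ℓ r : ℚ
        ℓ = cast l
        r = inv l
        ℓr≡1 : ℓ * r ≡ 1ℚ
        ℓr≡1 = cast*inv (prime≥1 pl)
        cancel : ∀ c → r * r * (ℓ * ℓ * c) ≡ c
        cancel c = trans (solve 3 (λ r l c → r :* r :* (l :* l :* c) := (l :* r) :* (l :* r) :* c) refl r ℓ c)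
          (trans (cong (λ e → e * e * c) ℓr≡1) (trans (cong (_* c) (*-identityˡ 1ℚ)) (*-identityˡ c)))
        ∑∑-δδ : ∀ {x y} → x ∈ M → y ∈ M → (f : Carrier → Carrier → ℚ) →
                ∑ M (λ z → ∑ M (λ z′ → δ z x * δ z′ y * f z z′)) ≡ f x y
        ∑∑-δδ {x} {y} x∈ y∈ f = trans (∑-cong M λ {z} _ → trans (∑-cong M λ {z′} _ → *-assoc (δ z x) (δ z′ y) (f z z′))
            (trans (∑-*ˡ M (δ z x) _) (cong (δ z x *_) (∑μ-δ* pl l∣n y∈ (f z)))))
          (∑μ-δ* pl l∣n x∈ (λ z → f z y))

      -- Under the average, the delta part of the kernel picks out the value at (x , y), and the -1
      -- subtracts the mean of f.
      kernel-reproducing : ∀ {x y} → x ∈ M → y ∈ M → (f : Carrier → Carrier → ℚ) →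
        r * r * ∑ M (λ z → ∑ M (λ z′ → f z z′ * kernel l z z′ x y)) ≡ f x y - r * r * ∑ M (λ z → ∑ M (f z))
      kernel-reproducing {x} {y} x∈ y∈ f = begin
        r * r * ∑ M (λ z → ∑ M (λ z′ → f z z′ * kernel l z z′ x y))
          ≡⟨ cong (r * r *_) (∑-cong M λ {z} _ → trans (∑-cong M λ {z′} _ →
               solve 3 (λ f e l → f :* (l :* l :* e :- con 1ℚ) := l :* l :* (e :* f) :- f) refl (f z z′) (δ z x * δ z′ y) ℓ)
               (trans (∑-- M _ _) (cong (_- ∑ M (f z)) (∑-*ˡ M (ℓ * ℓ) _)))) ⟩
        r * r * ∑ M (λ z → ℓ * ℓ * ∑ M (λ z′ → δ z x * δ z′ y * f z z′) - ∑ M (f z))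
          ≡⟨ cong (r * r *_) (trans (∑-- M _ _) (cong (_- ∑ M (λ z → ∑ M (f z))) (trans (∑-*ˡ M (ℓ * ℓ) _) (cong (ℓ * ℓ *_) (∑∑-δδ x∈ y∈ f))))) ⟩
        r * r * (ℓ * ℓ * f x y - ∑ M (λ z → ∑ M (f z)))
          ≡⟨ trans (solve 3 (λ r a b → r :* r :* (a :- b) := r :* r :* a :- r :* r :* b) refl r (ℓ * ℓ * f x y) (∑ M (λ z → ∑ M (f z))))
               (cong (_- r * r * ∑ M (λ z → ∑ M (f z))) (cancel (f x y))) ⟩
        f x y - r * r * ∑ M (λ z → ∑ M (f z)) ∎
        where open ≡-Reasoning

      ∑-kernel : ∀ {x y} → x ∈ M → y ∈ M → r * r * ∑ M (λ z → ∑ M (λ z′ → kernel l z z′ x y)) ≡ 0ℚ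
      ∑-kernel {x} {y} x∈ y∈ = trans (cong (r * r *_) (∑-cong M λ _ → ∑-cong M λ _ → sym (*-identityˡ _)))
        (trans (kernel-reproducing x∈ y∈ (λ _ _ → 1ℚ)) (trans (cong (λ z → 1ℚ - z) (∑∑-const pl l∣n 1ℚ)) (+-inverseʳ 1ℚ)))

      kernel-reproduces-deviation : ∀ {x y} → x ∈ M → y ∈ M →
        r * r * ∑ M (λ z → ∑ M (λ z′ → deviation l z z′ * kernel l z z′ x y)) ≡ deviation l x y
      kernel-reproduces-deviation {x} {y} x∈ y∈ = trans (kernel-reproducing x∈ y∈ (deviation l))
        (trans (cong (λ z → deviation l x y - z) (∑-deviation pl l∣n)) (+-identityʳ (deviation l x y)))

      kernel-reproduces-kernel : ∀ {x y x′ y′} → x ∈ M → y ∈ M → x′ ∈ M → y′ ∈ M →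
        r * r * ∑ M (λ z → ∑ M (λ z′ → kernel l z z′ x y * kernel l z z′ x′ y′)) ≡ kernel l x′ y′ x y
      kernel-reproduces-kernel {x} {y} {x′} {y′} x∈ y∈ x′∈ y′∈ = trans (kernel-reproducing x′∈ y′∈ (λ z z′ → kernel l z z′ x y))
        (trans (cong (λ z → kernel l x′ y′ x y - z) (∑-kernel x∈ y∈)) (+-identityʳ (kernel l x′ y′ x y)))

      private
        -- Each of the lines x = 1, y = 1 and x = y meets (1 , 1) once, so the average of the kernel
        -- along it is (ℓ² - ℓ) / ℓ. These are the three lines that `ratios` leaves out.
        line : ∀ {f : Carrier → ℚ} → ∑ M f ≡ 1ℚ → r * ∑ M (λ z → ℓ * ℓ * f z - 1ℚ) ≡ ℓ - 1ℚ
        line {f} Σf = begin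
          r * ∑ M (λ z → ℓ * ℓ * f z - 1ℚ)
            ≡⟨ cong (r *_) (trans (∑-- M _ _) (cong₂ _-_ (trans (∑-*ˡ M (ℓ * ℓ) f) (cong (ℓ * ℓ *_) Σf)) (∑μ-const pl l∣n 1ℚ))) ⟩
          r * (ℓ * ℓ * 1ℚ - ℓ * 1ℚ)
            ≡⟨ solve 2 (λ r l → r :* (l :* l :* con 1ℚ :- l :* con 1ℚ) := l :* r :* (l :- con 1ℚ)) refl r ℓ ⟩
          ℓ * r * (ℓ - 1ℚ)
            ≡⟨ trans (cong (_* (ℓ - 1ℚ)) ℓr≡1) (*-identityˡ (ℓ - 1ℚ)) ⟩
          ℓ - 1ℚ ∎
          where open ≡-Reasoning

      ∑-kernel-y : r * ∑ M (λ y → kernel l 1# y 1# 1#) ≡ ℓ - 1ℚ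
      ∑-kernel-y = line (trans (∑-cong M λ {y} _ → trans (cong (_* δ y 1#) (𝟙-refl _≟_ 1#)) (*-identityˡ (δ y 1#))) (∑μ-δ pl l∣n (L.1∈μ l)))

      ∑-kernel-x : r * ∑ M (λ x → kernel l x 1# 1# 1#) ≡ ℓ - 1ℚ
      ∑-kernel-x = line (trans (∑-cong M λ {x} _ → trans (cong (δ x 1# *_) (𝟙-refl _≟_ 1#)) (*-identityʳ (δ x 1#))) (∑μ-δ pl l∣n (L.1∈μ l)))

      ∑-kernel-xx : r * ∑ M (λ x → kernel l x x 1# 1#) ≡ ℓ - 1ℚ
      ∑-kernel-xx = line (trans (∑μ-δ* pl l∣n (L.1∈μ l) (λ x → δ x 1#)) (𝟙-refl _≟_ 1#))

      0≤ℓ-1 : 0ℚ ≤ ℓ - 1ℚ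
      0≤ℓ-1 = ≤⇒0≤- (subst (_≤ ℓ) cast-1 (cast-mono (prime≥1 pl)))

    module _ {l : ℕ} (pl : Prime l) (l∣n : l ∣ n) where

      private
        ℓ r k : ℚ
        ℓ = cast l
        r = inv l
        k = cast (l ℕ.∸ 2)
        ℓ≡k+2 : ℓ ≡ k + ofℕ 2
        ℓ≡k+2 = trans (cong cast (sym (ℕₚ.m∸n+n≡m (prime≥2 pl)))) (trans (cast-+ (l ℕ.∸ 2) 2) (cong (k +_) (cast≡ofℕ 2)))
        rℓ≡1 : r * ℓ ≡ 1ℚ
        rℓ≡1 = trans (*-comm r ℓ) (cast*inv (prime≥1 pl))

      0≤proportion : ∀ x y → 0ℚ ≤ proportion l x y
      0≤proportion x y = 0≤* (0≤inv l) (0≤count pl l∣n x y)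

      proportion≤1 : ∀ {x} y → x ∈ μ l → proportion l x y ≤ 1ℚ
      proportion≤1 {x} y x∈ = subst (proportion l x y ≤_) rℓ≡1 (*-monoˡ (0≤inv l) (≤-trans (count≤x pl l∣n y x∈)
        (≤-by-difference (0≤+ 0≤1 (0≤δ̅ x 1#)) (trans (cong (_- (k + δ x 1#)) ℓ≡k+2)
          (solve 2 (λ k d → (k :+ con (ofℕ 2)) :- (k :+ d) := con 1ℚ :+ (con 1ℚ :- d)) refl k (δ x 1#))))))

      1-4r≤proportion : ∀ {x y} → x ∈ μ l → y ∈ μ l → 1ℚ - ofℕ 4 * r ≤ proportion l x y
      1-4r≤proportion {x} {y} x∈ y∈ = subst (_≤ proportion l x y) r*[k-2] (*-monoˡ (0≤inv l) (k-2≤count pl l∣n x∈ y∈))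
        where
        r*[k-2] : r * (k - ofℕ 2) ≡ 1ℚ - ofℕ 4 * r
        r*[k-2] = trans (solve 2 (λ r k → r :* (k :- con (ofℕ 2)) := r :* (k :+ con (ofℕ 2)) :- con (ofℕ 4) :* r) refl r k)
          (cong (_- ofℕ 4 * r) (trans (cong (r *_) (sym ℓ≡k+2)) rℓ≡1))

-- The points t with t and u + v t nonzero, and the bijection between pairs and ratios.

module LinePoints where

  open import Defs using (FiniteField)
  open import Data.Nat as ℕ using (ℕ; suc; _<_)
  open import Data.Integer using (0ℤ)
  open import Data.List using (List; _∷_; filter; length; cartesianProduct)
  open import Data.List.Membership.Propositional using (_∈_)
  open import Data.List.Membership.Propositional.Properties using (∈-filter⁺; ∈-filter⁻; ∈-cartesianProduct⁺; ∈-cartesianProduct⁻)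
  open import Data.List.Relation.Binary.Permutation.Propositional.Properties using (↭-length)
  open import Data.List.Relation.Unary.All as All using (All; _∷_)
  open import Data.List.Relation.Unary.Any using (here; there)
  open import Data.List.Relation.Unary.AllPairs using (_∷_)
  open import Data.List.Relation.Unary.Unique.Propositional using (Unique)
  open import Data.List.Relation.Unary.Unique.Propositional.Properties using (filter⁺; cartesianProduct⁺)
  open import Data.Product using (_×_; _,_; proj₁; proj₂)
  open import Function using (_∘_)
  open import Relation.Nullary using (yes; no; ¬?; Dec)
  open import Relation.Nullary.Decidable using (_×-dec_)
  open import Relation.Binary.PropositionalEquality
  open FiniteSums using (unique-↭)
  open FieldArithmetic

  module Lines {q : ℕ} (2<q : 2 < q) (F : FiniteField q) (u v : FiniteField.Carrier F)
               (u≢0 : u ≢ FiniteField.0# F) (v≢0 : v ≢ FiniteField.0# F) where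

    open Lemmas 2<q F
    open ≡-Reasoning

    w : Carrier → Carrier
    w t = u + v * t

    OnLine : Carrier → Set
    OnLine t = t ≢ 0# × w t ≢ 0#

    onLine? : ∀ t → Dec (OnLine t)
    onLine? t = ¬? (t ≟ 0#) ×-dec ¬? (w t ≟ 0#)

    T : List Carrier
    T = filter onLine? elements

    T-unique : Unique T
    T-unique = filter⁺ onLine? elements-unique

    ∈T : ∀ {t} → OnLine t → t ∈ T
    ∈T {t} = ∈-filter⁺ onLine? (∈-elements t)

    ∈T⇒OnLine : ∀ {t} → t ∈ T → OnLine t
    ∈T⇒OnLine t∈ = proj₂ (∈-filter⁻ onLine? {xs = elements} t∈)

    root : Carrier
    root = v ⁻¹ * (- u)

    w-root : w root ≡ 0#
    w-root = trans (cong (u +_) (x*[x⁻¹*y]≡y (- u) v≢0)) (x−x≡0 u)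

    root-unique : ∀ {t} → w t ≡ 0# → t ≡ root
    root-unique {t} wt≡0 = *-cancelˡ v≢0 (trans (solve 2 (λ a b → b := (a :+ b) :+ :- a) refl u (v * t))
      (trans (cong (_− u) wt≡0) (trans (solve 1 (λ a → con 0ℤ :+ :- a := :- a) refl u) (sym (x*[x⁻¹*y]≡y (- u) v≢0)))))

    root≢0 : root ≢ 0#
    root≢0 = *-≢0 (⁻¹-≢0 v≢0) λ -u≡0 → u≢0 (trans (solve 1 (λ a → a := :- (:- a)) refl u)
      (trans (cong -_ -u≡0) (solve 0 (:- con 0ℤ := con 0ℤ) refl)))

    -- The two points removed from the field, 0 and `root`, are distinct because u ≠ 0.
    length-T : suc (suc (length T)) ≡ q
    length-T = trans (sym (↭-length {xs = elements} {ys = 0# ∷ root ∷ T} (unique-↭ elements-unique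
        (((root≢0 ∘ sym) ∷ All.tabulate (λ t∈ 0≡t → proj₁ (∈T⇒OnLine t∈) (sym 0≡t))) ∷
         All.tabulate (λ {t} t∈ root≡t → proj₂ (∈T⇒OnLine t∈) (trans (cong w (sym root≡t)) w-root)) ∷ T-unique)
        (λ {t} _ → to t) (λ {t} _ → ∈-elements t)))) length-elements
      where
      to : ∀ t → t ∈ 0# ∷ root ∷ T
      to t with t ≟ 0# | w t ≟ 0#
      ... | yes t≡0 | _        = here t≡0
      ... | no  _   | yes wt≡0 = there (here (root-unique wt≡0))
      ... | no  t≢0 | no  wt≢0 = there (there (∈T (t≢0 , wt≢0)))

    Distinct : Carrier × Carrier → Set
    Distinct (t , t′) = t ≢ t′

    distinct? : ∀ p → Dec (Distinct p)
    distinct? (t , t′) = ¬? (t ≟ t′)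

    pairs : List (Carrier × Carrier)
    pairs = filter distinct? (cartesianProduct T T)

    pairs-unique : Unique pairs
    pairs-unique = filter⁺ distinct? (cartesianProduct⁺ T-unique T-unique)

    Ratios : Carrier × Carrier → Set
    Ratios (x , y) = x ≢ 1# × y ≢ 1# × x ≢ y

    ratios? : ∀ p → Dec (Ratios p)
    ratios? (x , y) = ¬? (x ≟ 1#) ×-dec ¬? (y ≟ 1#) ×-dec ¬? (x ≟ y)

    ratios : List (Carrier × Carrier)
    ratios = filter ratios? (cartesianProduct G G)

    ratios-unique : Unique ratios
    ratios-unique = filter⁺ ratios? (cartesianProduct⁺ G-unique G-unique)

    -- The point of the line at which t and w t are multiplied by x and y respectively when t is replaced by x t.
    point : Carrier → Carrier → Carrier
    point x y = (v * (x − y)) ⁻¹ * (u * (y − 1#))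

    toPair : Carrier × Carrier → Carrier × Carrier
    toPair (x , y) = point x y , x * point x y

    toRatio : Carrier × Carrier → Carrier × Carrier
    toRatio (t , t′) = t ⁻¹ * t′ , w t ⁻¹ * w t′

    −-≢0 : ∀ {x y} → x ≢ y → x − y ≢ 0#
    −-≢0 x≢y = x≢y ∘ x−y≡0⇒x≡y

    point-equation : ∀ {x y} → x ≢ y → (v * (x − y)) * point x y ≡ u * (y − 1#)
    point-equation x≢y = x*[x⁻¹*y]≡y _ (*-≢0 v≢0 (−-≢0 x≢y))

    -- The condition u + v x t = y (u + v t) is linear in t and rearranges to the given equation;
    -- this is the origin of `point`.
    equation⇒scaled : ∀ {x y t} → (v * (x − y)) * t ≡ u * (y − 1#) → w (x * t) ≡ y * w t
    equation⇒scaled {x} {y} {t} e = x−y≡0⇒x≡y (begin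
      w (x * t) − y * w t                      ≡⟨ expand ⟩
      (v * (x − y)) * t − u * (y − 1#)         ≡⟨ cong (_− u * (y − 1#)) e ⟩
      u * (y − 1#) − u * (y − 1#)              ≡⟨ x−x≡0 _ ⟩
      0#                                       ∎)
      where
      expand : w (x * t) − y * w t ≡ (v * (x − y)) * t − u * (y − 1#)
      -- The unit enters the solver as the variable o, hence u is first written as u times `1#`; the
      -- solver's own constant 1 denotes `1#` + `0#`.
      expand = trans (cong (λ z → z + v * (x * t) − y * w t) (sym (*-identityʳ u)))
        (solve 6 (λ u v x y t o → (u :* o :+ v :* (x :* t)) :+ :- (y :* (u :+ v :* t)) :=
          (v :* (x :+ :- y)) :* t :+ :- (u :* (y :+ :- o))) refl u v x y t 1#)

    scaled⇒equation : ∀ {x y t} → w (x * t) ≡ y * w t → (v * (x − y)) * t ≡ u * (y − 1#)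
    scaled⇒equation {x} {y} {t} e = x−y≡0⇒x≡y (begin
      (v * (x − y)) * t − u * (y − 1#)         ≡⟨ expand ⟩
      w (x * t) − y * w t                      ≡⟨ cong (_− y * w t) e ⟩
      y * w t − y * w t                        ≡⟨ x−x≡0 _ ⟩
      0#                                       ∎)
      where
      expand : (v * (x − y)) * t − u * (y − 1#) ≡ w (x * t) − y * w t
      expand = trans (solve 6 (λ u v x y t o → (v :* (x :+ :- y)) :* t :+ :- (u :* (y :+ :- o)) :=
          (u :* o :+ v :* (x :* t)) :+ :- (y :* (u :+ v :* t))) refl u v x y t 1#)
        (cong (λ z → z + v * (x * t) − y * w t) (*-identityʳ u))

    w-injective : ∀ {t t′} → w t ≡ w t′ → t ≡ t′
    w-injective {t} {t′} e = *-cancelˡ v≢0 (x−y≡0⇒x≡y (trans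
      (solve 4 (λ u v t t′ → v :* t :+ :- (v :* t′) := (u :+ v :* t) :+ :- (u :+ v :* t′)) refl u v t t′)
      (trans (cong (_− w t′) e) (x−x≡0 _))))

    module _ {x y} (x≢0 : x ≢ 0#) (y≢0 : y ≢ 0#) (x≢1 : x ≢ 1#) (y≢1 : y ≢ 1#) (x≢y : x ≢ y) where

      private
        t : Carrier
        t = point x y

      point-scaled : w (x * t) ≡ y * w t
      point-scaled = equation⇒scaled (point-equation x≢y)

      point≢0 : t ≢ 0#
      point≢0 = *-≢0 (⁻¹-≢0 (*-≢0 v≢0 (−-≢0 x≢y))) (*-≢0 u≢0 (−-≢0 y≢1))

      -- The equation of the point gives u (x - 1) = w t (x - y), and the left side is nonzero.
      w-point≢0 : w t ≢ 0#
      w-point≢0 wt≡0 = *-≢0 u≢0 (−-≢0 x≢1) (begin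
        u * (x − 1#)                           ≡⟨ solve 4 (λ u x y o → u :* (x :+ :- o) := u :* (x :+ :- y) :+ u :* (y :+ :- o)) refl u x y 1# ⟩
        u * (x − y) + u * (y − 1#)             ≡⟨ cong (u * (x − y) +_) (sym (point-equation x≢y)) ⟩
        u * (x − y) + (v * (x − y)) * t        ≡⟨ solve 4 (λ u v d t → u :* d :+ (v :* d) :* t := (u :+ v :* t) :* d) refl u v (x − y) t ⟩
        w t * (x − y)                          ≡⟨ cong (_* (x − y)) wt≡0 ⟩
        0# * (x − y)                           ≡⟨ zeroˡ _ ⟩
        0#                                     ∎)

    toPair∈ : ∀ {p} → p ∈ ratios → toPair p ∈ pairs
    toPair∈ {x , y} p∈ with ∈-filter⁻ ratios? {xs = cartesianProduct G G} p∈
    ... | p∈GG , x≢1 , y≢1 , x≢y with ∈-cartesianProduct⁻ G G p∈GG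
    ... | x∈ , y∈ = ∈-filter⁺ distinct? (∈-cartesianProduct⁺ (∈T (t≢0 , wt≢0))
        (∈T (*-≢0 x≢0 t≢0 , λ e → *-≢0 y≢0 wt≢0 (trans (sym (point-scaled x≢0 y≢0 x≢1 y≢1 x≢y)) e))))
        λ t≡xt → x≢1 (*-cancelˡ t≢0 (trans (*-comm _ x) (trans (sym t≡xt) (sym (*-identityʳ _)))))
      where
      x≢0 = ∈G⇒≢0 x∈
      y≢0 = ∈G⇒≢0 y∈
      t≢0 = point≢0 x≢0 y≢0 x≢1 y≢1 x≢y
      wt≢0 = w-point≢0 x≢0 y≢0 x≢1 y≢1 x≢y

    toRatio∘toPair : ∀ {p} → p ∈ ratios → toRatio (toPair p) ≡ p
    toRatio∘toPair {x , y} p∈ with ∈-filter⁻ ratios? {xs = cartesianProduct G G} p∈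
    ... | p∈GG , x≢1 , y≢1 , x≢y with ∈-cartesianProduct⁻ G G p∈GG
    ... | x∈ , y∈ = cong₂ _,_
        (trans (cong (t ⁻¹ *_) (*-comm x t)) (x⁻¹*[x*y]≡y x (point≢0 x≢0 y≢0 x≢1 y≢1 x≢y)))
        (trans (cong (w t ⁻¹ *_) (trans (point-scaled x≢0 y≢0 x≢1 y≢1 x≢y) (*-comm y (w t)))) (x⁻¹*[x*y]≡y y (w-point≢0 x≢0 y≢0 x≢1 y≢1 x≢y)))
      where
      t = point x y
      x≢0 = ∈G⇒≢0 x∈
      y≢0 = ∈G⇒≢0 y∈

    module _ {t t′} (t∈ : t ∈ T) (t′∈ : t′ ∈ T) (t≢t′ : t ≢ t′) where

      private
        t≢0 = proj₁ (∈T⇒OnLine t∈)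
        wt≢0 = proj₂ (∈T⇒OnLine t∈)
        x y : Carrier
        x = t ⁻¹ * t′
        y = w t ⁻¹ * w t′
        x*t : x * t ≡ t′
        x*t = trans (*-comm x t) (x*[x⁻¹*y]≡y t′ t≢0)
        y*wt : y * w t ≡ w t′
        y*wt = trans (*-comm y (w t)) (x*[x⁻¹*y]≡y (w t′) wt≢0)
        equation : (v * (x − y)) * t ≡ u * (y − 1#)
        equation = scaled⇒equation (trans (cong w x*t) (sym y*wt))

      ratio≢0 : x ≢ 0# × y ≢ 0#
      ratio≢0 = *-≢0 (⁻¹-≢0 t≢0) (proj₁ (∈T⇒OnLine t′∈)) , *-≢0 (⁻¹-≢0 wt≢0) (proj₂ (∈T⇒OnLine t′∈))

      ratio-y≢1 : y ≢ 1#
      ratio-y≢1 y≡1 = t≢t′ (w-injective (trans (sym (*-identityˡ (w t))) (trans (cong (_* w t) (sym y≡1)) y*wt)))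

      ratio-x≢1 : x ≢ 1#
      ratio-x≢1 x≡1 = t≢t′ (trans (sym (*-identityˡ t)) (trans (cong (_* t) (sym x≡1)) x*t))

      -- For x = y the left side of `equation` vanishes, while u (y - 1) does not.
      ratio-x≢y : x ≢ y
      ratio-x≢y x≡y = *-≢0 u≢0 (−-≢0 ratio-y≢1) (trans (sym equation)
        (trans (cong (λ z → (v * (z − y)) * t) x≡y) (solve 3 (λ v y t → (v :* (y :+ :- y)) :* t := con 0ℤ) refl v y t)))

      point-ratio : point x y ≡ t
      point-ratio = trans (cong ((v * (x − y)) ⁻¹ *_) (sym equation)) (x⁻¹*[x*y]≡y t (*-≢0 v≢0 (−-≢0 ratio-x≢y)))

      toPair-ratio : toPair (x , y) ≡ (t , t′)
      toPair-ratio = cong₂ _,_ point-ratio (trans (cong (x *_) point-ratio) x*t)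

    toRatio∈ : ∀ {p} → p ∈ pairs → toRatio p ∈ ratios
    toRatio∈ {t , t′} p∈ with ∈-filter⁻ distinct? {xs = cartesianProduct T T} p∈
    ... | p∈TT , t≢t′ with ∈-cartesianProduct⁻ T T p∈TT
    ... | t∈ , t′∈ = ∈-filter⁺ ratios? (∈-cartesianProduct⁺ (∈G (proj₁ (ratio≢0 t∈ t′∈ t≢t′))) (∈G (proj₂ (ratio≢0 t∈ t′∈ t≢t′))))
      (ratio-x≢1 t∈ t′∈ t≢t′ , ratio-y≢1 t∈ t′∈ t≢t′ , ratio-x≢y t∈ t′∈ t≢t′)

    toPair∘toRatio : ∀ {p} → p ∈ pairs → toPair (toRatio p) ≡ p
    toPair∘toRatio {t , t′} p∈ with ∈-filter⁻ distinct? {xs = cartesianProduct T T} p∈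
    ... | p∈TT , t≢t′ with ∈-cartesianProduct⁻ T T p∈TT
    ... | t∈ , t′∈ = toPair-ratio t∈ t′∈ t≢t′

-- The large sieve inequality for sums of products of deviations over the line.

module KernelBound where

  open import Defs using (FiniteField; ofℕ)
  open import Data.Nat as ℕ using (ℕ)
  import Data.Nat.Properties as ℕₚ
  open import Data.Nat.Divisibility using (_∣_)
  open import Data.Nat.Primality using (Prime)
  open import Data.Rational hiding (_≟_)
  open import Data.Rational.Properties hiding (_≟_)
  open import Data.Rational.Solver
  open import Data.List using (List; _∷_; length; cartesianProduct)
  open import Data.List.Membership.Propositional using (_∈_)
  open import Data.List.Membership.Propositional.Properties using (∈-cartesianProduct⁻; ∈-filter⁻)
  open import Data.List.Relation.Unary.All as All using (All)
  open import Data.List.Relation.Unary.Any using (here)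
  open import Data.Product using (_×_; _,_; proj₁; proj₂)
  open import Data.Empty using (⊥-elim)
  open import Relation.Nullary using (Dec; yes; no; ¬?)
  open import Relation.Nullary.Decidable using (_×-dec_)
  open import Relation.Binary.PropositionalEquality
  open Rationals
  open FiniteSums
  open FieldArithmetic
  open ResidueAverages
  open LocalMoments
  open LinePoints

  open +-*-Solver

  -- Any two of the three equalities force the third. In inclusion-exclusion the three double terms
  -- and the triple term are therefore equal, and their coefficients add up to 3 - 1 = 2.
  𝟙-distinct : ∀ {P Q R : Set} (p : Dec P) (q : Dec Q) (r : Dec R) → (P → Q → R) → (P → R → Q) → (Q → R → P) →
    𝟙 (¬? p ×-dec ¬? q ×-dec ¬? r) ≡ 1ℚ - 𝟙 p - 𝟙 q - 𝟙 r + ofℕ 2 * (𝟙 p * 𝟙 q)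
  𝟙-distinct (yes p) (yes q) (yes r) _ _ _ = refl
  𝟙-distinct (yes p) (yes q) (no ¬r) f _ _ = ⊥-elim (¬r (f p q))
  𝟙-distinct (yes p) (no ¬q) (yes r) _ g _ = ⊥-elim (¬q (g p r))
  𝟙-distinct (yes p) (no ¬q) (no ¬r) _ _ _ = refl
  𝟙-distinct (no ¬p) (yes q) (yes r) _ _ h = ⊥-elim (¬p (h q r))
  𝟙-distinct (no ¬p) (yes q) (no ¬r) _ _ _ = refl
  𝟙-distinct (no ¬p) (no ¬q) (yes r) _ _ _ = refl
  𝟙-distinct (no ¬p) (no ¬q) (no ¬r) _ _ _ = refl

  module LargeSieve {q : ℕ} (2<q : 2 ℕ.< q) (F : FiniteField q) (u v : FiniteField.Carrier F)
                    (u≢0 : u ≢ FiniteField.0# F) (v≢0 : v ≢ FiniteField.0# F) where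

    open Lemmas 2<q F using (Carrier; 1#; _⁻¹; _≟_; n; G; μ; π)
      renaming (_*_ to infixl 7 _·_; *-assoc to ·-assoc; *-comm to ·-comm; *-identityˡ to ·-identityˡ; *-identityʳ to ·-identityʳ)
    open Lines 2<q F u v u≢0 v≢0
    private module L = Lemmas 2<q F

    δ′ : Carrier → Carrier → ℚ
    δ′ = δ 2<q F

    module _ {l : ℕ} {ls : List ℕ} (P : PrimesOfOrder 2<q F (l ∷ ls)) where

      private
        D : List ℕ
        D = l ∷ ls
        N : ℚ
        N = cast n
        prime∈ : ∀ {l′} → l′ ∈ D → Prime l′
        prime∈ = All.lookup (primes P)
        divides∈ : ∀ {l′} → l′ ∈ D → l′ ∣ n
        divides∈ = All.lookup (divide P)
        π∈ : ∀ {l′ x} → l′ ∈ D → x ∈ G → π l′ x ∈ μ l′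
        π∈ l∈ = L.π∈μ (prime∈ l∈) (divides∈ l∈)
        t∈G : ∀ {t} → t ∈ T → t ∈ G
        t∈G t∈ = L.∈G (proj₁ (∈T⇒OnLine t∈))
        w∈G : ∀ {t} → t ∈ T → w t ∈ G
        w∈G t∈ = L.∈G (proj₂ (∈T⇒OnLine t∈))

      devₗ : Carrier → Carrier → ℕ → ℚ
      devₗ x y l = deviation 2<q F l (π l x) (π l y)

      dev : Carrier → Carrier → ℚ
      dev x y = ∏ D (devₗ x y)

      kerₗ : Carrier → Carrier → Carrier → Carrier → ℕ → ℚ
      kerₗ x y x′ y′ l = kernel 2<q F l (π l x) (π l y) (π l x′) (π l y′)

      ker : Carrier → Carrier → Carrier → Carrier → ℚ
      ker x y x′ y′ = ∏ D (kerₗ x y x′ y′)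

      size : ℚ
      size = ∏ D (kernelSize 2<q F)

      reproduce : ∀ {x y} → x ∈ G → y ∈ G → ∑ G (λ z → ∑ G (λ z′ → dev z z′ * ker z z′ x y)) ≡ N * N * dev x y
      reproduce {x} {y} x∈ y∈ = trans (∑-cong G λ {z} _ → ∑-cong G λ {z′} _ → sym (∏-* D (devₗ z z′) (kerₗ z z′ x y)))
        (trans (average₂ 2<q F P (λ l a b → deviation 2<q F l a b * kernel 2<q F l a b (π l x) (π l y)))
          (cong (N * N *_) (∏-cong D λ {l} l∈ → kernel-reproduces-deviation 2<q F (prime∈ l∈) (divides∈ l∈) (π∈ l∈ x∈) (π∈ l∈ y∈))))

      compose : ∀ {x y x′ y′} → x ∈ G → y ∈ G → x′ ∈ G → y′ ∈ G →
        ∑ G (λ z → ∑ G (λ z′ → ker z z′ x y * ker z z′ x′ y′)) ≡ N * N * ker x′ y′ x y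
      compose {x} {y} {x′} {y′} x∈ y∈ x′∈ y′∈ = trans (∑-cong G λ {z} _ → ∑-cong G λ {z′} _ → sym (∏-* D (kerₗ z z′ x y) (kerₗ z z′ x′ y′)))
        (trans (average₂ 2<q F P (λ l a b → kernel 2<q F l a b (π l x) (π l y) * kernel 2<q F l a b (π l x′) (π l y′)))
          (cong (N * N *_) (∏-cong D λ {l} l∈ → kernel-reproduces-kernel 2<q F (prime∈ l∈) (divides∈ l∈) (π∈ l∈ x∈) (π∈ l∈ y∈) (π∈ l∈ x′∈) (π∈ l∈ y′∈))))

      ∑dev² : ∑ G (λ z → ∑ G (λ z′ → dev z z′ * dev z z′)) ≡ N * N * ∏ D (variance 2<q F)
      ∑dev² = trans (∑-cong G λ {z} _ → ∑-cong G λ {z′} _ → sym (∏-* D (devₗ z z′) (devₗ z z′)))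
        (average₂ 2<q F P (λ l a b → deviation 2<q F l a b * deviation 2<q F l a b))

      E : ℚ
      E = ∑ T (λ t → dev t (w t))

      -- The representer of E: by the reproducing property its inner product with `dev` over G × G
      -- is N² E.
      R : Carrier → Carrier → ℚ
      R z z′ = ∑ T (λ t → ker z z′ t (w t))

      Q : ℚ
      Q = ∑ T (λ t → ∑ T (λ t′ → ker t (w t) t′ (w t′)))

      ∑dev*R : ∑ G (λ z → ∑ G (λ z′ → dev z z′ * R z z′)) ≡ N * N * E
      ∑dev*R = begin
        ∑ G (λ z → ∑ G (λ z′ → dev z z′ * R z z′))
          ≡⟨ ∑-cong G (λ {z} _ → trans (∑-cong G λ {z′} _ → sym (∑-*ˡ T (dev z z′) _)) (∑-swap G T _)) ⟩
        ∑ G (λ z → ∑ T (λ t → ∑ G (λ z′ → dev z z′ * ker z z′ t (w t))))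
          ≡⟨ ∑-swap G T _ ⟩
        ∑ T (λ t → ∑ G (λ z → ∑ G (λ z′ → dev z z′ * ker z z′ t (w t))))
          ≡⟨ ∑-cong T (λ {t} t∈ → reproduce (t∈G t∈) (w∈G t∈)) ⟩
        ∑ T (λ t → N * N * dev t (w t))
          ≡⟨ ∑-*ˡ T (N * N) _ ⟩
        N * N * E ∎
        where open ≡-Reasoning

      ∑R² : ∑ G (λ z → ∑ G (λ z′ → R z z′ * R z z′)) ≡ N * N * Q
      ∑R² = begin
        ∑ G (λ z → ∑ G (λ z′ → R z z′ * R z z′))
          ≡⟨ ∑-cong G (λ {z} _ → trans (∑-cong G λ {z′} _ → trans (sym (∑-*ʳ T (R z z′) _))
               (∑-cong T λ {t} _ → sym (∑-*ˡ T (ker z z′ t (w t)) _))) (∑-swap G T _)) ⟩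
        ∑ G (λ z → ∑ T (λ t → ∑ G (λ z′ → ∑ T (λ t′ → ker z z′ t (w t) * ker z z′ t′ (w t′)))))
          ≡⟨ ∑-swap G T _ ⟩
        ∑ T (λ t → ∑ G (λ z → ∑ G (λ z′ → ∑ T (λ t′ → ker z z′ t (w t) * ker z z′ t′ (w t′)))))
          ≡⟨ ∑-cong T (λ {t} t∈ → trans (∑-cong G λ {z} _ → ∑-swap G T _) (trans (∑-swap G T _)
               (∑-cong T λ {t′} t′∈ → compose (t∈G t∈) (w∈G t∈) (t∈G t′∈) (w∈G t′∈)))) ⟩
        ∑ T (λ t → ∑ T (λ t′ → N * N * ker t′ (w t′) t (w t)))
          ≡⟨ trans (∑-cong T λ {t} _ → ∑-*ˡ T (N * N) _) (∑-*ˡ T (N * N) _) ⟩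
        N * N * ∑ T (λ t → ∑ T (λ t′ → ker t′ (w t′) t (w t)))
          ≡⟨ cong (N * N *_) (∑-swap T T _) ⟩
        N * N * Q ∎
        where open ≡-Reasoning

      -- Cauchy-Schwarz is applied on G × G to `dev` and `R`, and not on the line itself. There both
      -- norms are averages: that of `dev` factors over the primes, and that of `R` collapses to Q.
      -- The common factor N⁴ cancels.
      E²≤variance*Q : E * E ≤ ∏ D (variance 2<q F) * Q
      E²≤variance*Q = subst₂ _≤_ (scale E E) (scale (∏ D (variance 2<q F)) Q) (*-monoˡ (0≤* (0≤p² (inv n)) (0≤p² (inv n)))
        (subst₂ _≤_ (cong (λ z → z * z) (trans (∑-cartesianProduct G G (λ p → dev (proj₁ p) (proj₂ p) * R (proj₁ p) (proj₂ p))) ∑dev*R))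
          (cong₂ _*_ (trans (∑-cartesianProduct G G (λ p → dev (proj₁ p) (proj₂ p) * dev (proj₁ p) (proj₂ p))) ∑dev²)
            (trans (∑-cartesianProduct G G (λ p → R (proj₁ p) (proj₂ p) * R (proj₁ p) (proj₂ p))) ∑R²))
          (cauchy-schwarz (cartesianProduct G G) (λ p → dev (proj₁ p) (proj₂ p)) (λ p → R (proj₁ p) (proj₂ p)))))
        where
        N*inv≡1 : N * inv n ≡ 1ℚ
        N*inv≡1 = cast*inv (ℕₚ.<⇒≤ L.1<n)
        scale : ∀ a b → inv n * inv n * (inv n * inv n) * (N * N * a * (N * N * b)) ≡ a * b
        scale a b = trans (solve 4 (λ N i a b → i :* i :* (i :* i) :* (N :* N :* a :* (N :* N :* b)) :=
            (N :* i) :* (N :* i) :* ((N :* i) :* (N :* i)) :* (a :* b)) refl N (inv n) a b)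
          (trans (cong (λ e → e * e * (e * e) * (a * b)) N*inv≡1)
            (solve 1 (λ c → con 1ℚ :* con 1ℚ :* (con 1ℚ :* con 1ℚ) :* c := c) refl (a * b)))

      ker₁ : Carrier → Carrier → ℚ
      ker₁ x y = ker x y 1# 1#

      ker-diagonal : ∀ x y → ker x y x y ≡ size
      ker-diagonal x y = ∏-cong D λ {l} _ → kernel-diagonal 2<q F l (π l x) (π l y)

      δ-ratio : ∀ l {x t} → t ∈ G → δ′ (π l t) (π l (x · t)) ≡ δ′ (π l x) (π l 1#)
      δ-ratio l {x} {t} t∈ = 𝟙-sym (π l t ≟ π l (x · t)) (π l x ≟ π l 1#)
        (λ e → trans (L.*-cancelˡ πt≢0 (trans (·-comm (π l t) (π l x)) (trans (sym (L.π-* l x t)) (trans (sym e) (sym (·-identityʳ (π l t))))))) (sym π1≡1))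
        (λ e → sym (trans (L.π-* l x t) (trans (cong (_· π l t) (trans e π1≡1)) (·-identityˡ (π l t)))))
        where
        πt≢0 = L.π-≢0 l (L.∈G⇒≢0 t∈)
        π1≡1 : π l 1# ≡ 1#
        π1≡1 = L.1^ (L.cofactor l)

      -- Each projection is multiplicative, so the kernel sees only the ratios of its two points.
      ker-ratio : ∀ {x y t t′} → t ∈ G → t′ ∈ G → ker t t′ (x · t) (y · t′) ≡ ker₁ x y
      ker-ratio {x} {y} {t} {t′} t∈ t′∈ = ∏-cong D λ {l} _ →
        cong₂ (λ a b → cast l * cast l * (a * b) - 1ℚ) (δ-ratio l t∈) (δ-ratio l t′∈)

      off-diagonal : ∑ pairs (λ p → ker (proj₁ p) (w (proj₁ p)) (proj₂ p) (w (proj₂ p))) ≡ ∑ ratios (λ p → ker₁ (proj₁ p) (proj₂ p))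
      off-diagonal = sym (trans (∑-cong ratios λ p∈ → sym (ker-toPair p∈))
        (∑-reindex toPair toRatio ratios-unique pairs-unique toPair∈ toRatio∈ toRatio∘toPair toPair∘toRatio
          (λ p → ker (proj₁ p) (w (proj₁ p)) (proj₂ p) (w (proj₂ p)))))
        where
        ker-toPair : ∀ {p} → p ∈ ratios → let t , t′ = toPair p in ker t (w t) t′ (w t′) ≡ ker₁ (proj₁ p) (proj₂ p)
        ker-toPair {x , y} p∈ =
          let t∈ = proj₁ (∈-cartesianProduct⁻ T T (proj₁ (∈-filter⁻′ p∈)))
          in trans (cong (ker (point x y) (w (point x y)) (x · point x y)) (ratio-scaled p∈)) (ker-ratio (t∈G t∈) (w∈G t∈))
          where
          ∈-filter⁻′ : ∀ {p} → p ∈ ratios → toPair p ∈ cartesianProduct T T × Distinct (toPair p)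
          ∈-filter⁻′ p∈ = ∈-filter⁻ distinct? {xs = cartesianProduct T T} (toPair∈ p∈)
          ratio-scaled : ∀ {x y} → (x , y) ∈ ratios → w (x · point x y) ≡ y · w (point x y)
          ratio-scaled p∈ = equation⇒scaled (point-equation (proj₂ (proj₂ (proj₂ (∈-filter⁻ ratios? {xs = cartesianProduct G G} p∈)))))

      private
        weight : Carrier → Carrier → ℚ
        weight x y = 1ℚ - δ′ x 1# - δ′ y 1# - δ′ x y + ofℕ 2 * (δ′ x 1# * δ′ y 1#)

      ∑-ratios : ∑ ratios (λ p → ker₁ (proj₁ p) (proj₂ p)) ≡
        ∑ G (λ x → ∑ G (ker₁ x)) - ∑ G (ker₁ 1#) - ∑ G (λ x → ker₁ x 1#) - ∑ G (λ x → ker₁ x x) + ofℕ 2 * ker₁ 1# 1#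
      ∑-ratios = begin
        ∑ ratios (λ p → ker₁ (proj₁ p) (proj₂ p))
          ≡⟨ trans (∑-filter ratios? (cartesianProduct G G) _) (∑-cartesianProduct G G _) ⟩
        ∑ G (λ x → ∑ G (λ y → 𝟙 (ratios? (x , y)) * ker₁ x y))
          ≡⟨ ∑-cong G (λ {x} _ → ∑-cong G λ {y} _ → cong (_* ker₁ x y)
               (𝟙-distinct (x ≟ 1#) (y ≟ 1#) (x ≟ y) (λ a b → trans a (sym b)) (λ a b → trans (sym b) a) (λ a b → trans b a))) ⟩
        ∑ G (λ x → ∑ G (λ y → weight x y * ker₁ x y))
          ≡⟨ ∑-cong G (λ {x} x∈ → trans (∑-cong G λ {y} _ →
               solve 5 (λ a b c k two → (con 1ℚ :- a :- b :- c :+ two :* (a :* b)) :* k :=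
                 k :- a :* k :- b :* k :- c :* k :+ two :* (b :* (a :* k))) refl (δ′ x 1#) (δ′ y 1#) (δ′ x y) (ker₁ x y) (ofℕ 2))
               (trans (∑-+ G _ _) (cong₂ _+_ (trans (∑-- G _ _) (cong₂ _-_ (trans (∑-- G _ _) (cong₂ _-_ (trans (∑-- G _ _)
                 (cong (λ z → ∑ G (ker₁ x) - z) (∑-*ˡ G (δ′ x 1#) (ker₁ x)))) (∑-δG 1∈G (ker₁ x))))
                 (trans (∑-cong G λ {y} _ → cong (_* ker₁ x y) (𝟙-sym (x ≟ y) (y ≟ x) sym sym)) (∑-δG x∈ (ker₁ x)))))
                 (trans (∑-*ˡ G (ofℕ 2) _) (cong (ofℕ 2 *_) (∑-δG 1∈G (λ y → δ′ x 1# * ker₁ x y))))))) ⟩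
        ∑ G (λ x → ∑ G (ker₁ x) - δ′ x 1# * ∑ G (ker₁ x) - ker₁ x 1# - ker₁ x x + ofℕ 2 * (δ′ x 1# * ker₁ x 1#))
          ≡⟨ trans (∑-+ G _ _) (cong₂ _+_ (trans (∑-- G _ _) (cong (_- ∑ G (λ x → ker₁ x x)) (trans (∑-- G _ _) (cong (_- ∑ G (λ x → ker₁ x 1#))
               (trans (∑-- G _ _) (cong (λ z → ∑ G (λ x → ∑ G (ker₁ x)) - z) (∑-δG 1∈G (λ x → ∑ G (ker₁ x)))))))))
               (trans (∑-*ˡ G (ofℕ 2) _) (cong (ofℕ 2 *_) (∑-δG 1∈G (λ x → ker₁ x 1#))))) ⟩
        ∑ G (λ x → ∑ G (ker₁ x)) - ∑ G (ker₁ 1#) - ∑ G (λ x → ker₁ x 1#) - ∑ G (λ x → ker₁ x x) + ofℕ 2 * ker₁ 1# 1# ∎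
        where
        open ≡-Reasoning
        1∈G : 1# ∈ G
        1∈G = L.∈G L.1≢0
        ∑-δG : ∀ {a} → a ∈ G → (f : Carrier → ℚ) → ∑ G (λ x → δ′ x a * f x) ≡ f a
        ∑-δG a∈ f = ∑-δ _≟_ f L.G-unique a∈

      private
        π1≡1 : ∀ l → π l 1# ≡ 1#
        π1≡1 l = L.1^ (L.cofactor l)

      0≤line : ∀ (f : ℕ → Carrier → ℚ) → (∀ {l} → l ∈ D → inv l * ∑ (μ l) (f l) ≡ cast l - 1ℚ) →
               0ℚ ≤ ∑ G (λ x → ∏ D (λ l → f l (π l x)))
      0≤line f e = subst (0ℚ ≤_) (sym (average 2<q F P f)) (0≤* (0≤cast n) (0≤∏ D λ l∈ →
        subst (0ℚ ≤_) (sym (e l∈)) (0≤ℓ-1 2<q F (prime∈ l∈) (divides∈ l∈))))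

      0≤∑ker-y : 0ℚ ≤ ∑ G (ker₁ 1#)
      0≤∑ker-y = subst (0ℚ ≤_) (∑-cong G λ {y} _ → ∏-cong D λ {l} _ → cong (λ z → kernel 2<q F l z (π l y) z z) (sym (π1≡1 l)))
        (0≤line (λ l y → kernel 2<q F l 1# y 1# 1#) (λ l∈ → ∑-kernel-y 2<q F (prime∈ l∈) (divides∈ l∈)))

      0≤∑ker-x : 0ℚ ≤ ∑ G (λ x → ker₁ x 1#)
      0≤∑ker-x = subst (0ℚ ≤_) (∑-cong G λ {x} _ → ∏-cong D λ {l} _ → cong (λ z → kernel 2<q F l (π l x) z z z) (sym (π1≡1 l)))
        (0≤line (λ l x → kernel 2<q F l x 1# 1# 1#) (λ l∈ → ∑-kernel-x 2<q F (prime∈ l∈) (divides∈ l∈)))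

      0≤∑ker-xx : 0ℚ ≤ ∑ G (λ x → ker₁ x x)
      0≤∑ker-xx = subst (0ℚ ≤_) (∑-cong G λ {x} _ → ∏-cong D λ {l} _ → cong (λ z → kernel 2<q F l (π l x) (π l x) z z) (sym (π1≡1 l)))
        (0≤line (λ l x → kernel 2<q F l x x 1# 1#) (λ l∈ → ∑-kernel-xx 2<q F (prime∈ l∈) (divides∈ l∈)))

      -- Here D must be nonempty: the factor at its head prime averages to 0.
      ∑∑ker≡0 : ∑ G (λ x → ∑ G (ker₁ x)) ≡ 0ℚ
      ∑∑ker≡0 = begin
        ∑ G (λ x → ∑ G (ker₁ x))
          ≡⟨ ∑-cong G (λ {x} _ → ∑-cong G λ {y} _ → ∏-cong D λ {l} _ → cong (λ z → kernel 2<q F l (π l x) (π l y) z z) (π1≡1 l)) ⟩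
        ∑ G (λ x → ∑ G (λ y → ∏ D (λ l → kernel 2<q F l (π l x) (π l y) 1# 1#)))
          ≡⟨ average₂ 2<q F P (λ l a b → kernel 2<q F l a b 1# 1#) ⟩
        N * N * (inv l * inv l * ∑ (μ l) (λ x → ∑ (μ l) (λ y → kernel 2<q F l x y 1# 1#)) * rest)
          ≡⟨ cong (λ z → N * N * (z * rest)) (∑-kernel 2<q F (prime∈ (here refl)) (divides∈ (here refl)) (L.1∈μ l) (L.1∈μ l)) ⟩
        N * N * (0ℚ * rest)
          ≡⟨ solve 2 (λ a b → a :* a :* (con 0ℚ :* b) := con 0ℚ) refl N rest ⟩
        0ℚ ∎
        where
        open ≡-Reasoning
        rest : ℚ
        rest = ∏ ls (λ l → inv l * inv l * ∑ (μ l) (λ x → ∑ (μ l) (λ y → kernel 2<q F l x y 1# 1#)))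

      -- In the inclusion-exclusion the full sum vanishes, the three line sums are nonnegative and
      -- enter with a minus sign, and the point (1 , 1) enters with weight 2.
      ∑-ratios≤ : ∑ ratios (λ p → ker₁ (proj₁ p) (proj₂ p)) ≤ ofℕ 2 * size
      ∑-ratios≤ = ≤-by-difference (0≤+ 0≤∑ker-y (0≤+ 0≤∑ker-x 0≤∑ker-xx)) (begin
        ofℕ 2 * size - ∑ ratios (λ p → ker₁ (proj₁ p) (proj₂ p))
          ≡⟨ cong (λ z → ofℕ 2 * size - z) (trans ∑-ratios (cong₂ (λ a b → a - Y - X - Z + ofℕ 2 * b) ∑∑ker≡0 (ker-diagonal 1# 1#))) ⟩
        ofℕ 2 * size - (0ℚ - Y - X - Z + ofℕ 2 * size)
          ≡⟨ solve 4 (λ s x y z → s :- (con 0ℚ :- y :- x :- z :+ s) := y :+ (x :+ z)) refl (ofℕ 2 * size) X Y Z ⟩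
        Y + (X + Z) ∎)
        where
        open ≡-Reasoning
        X Y Z : ℚ
        X = ∑ G (λ x → ker₁ x 1#)
        Y = ∑ G (ker₁ 1#)
        Z = ∑ G (λ x → ker₁ x x)

      Q-split : Q ≡ cast (length T) * size + ∑ pairs (λ p → ker (proj₁ p) (w (proj₁ p)) (proj₂ p) (w (proj₂ p)))
      Q-split = begin
        ∑ T (λ t → ∑ T (k t))
          ≡⟨ ∑-cong T (λ {t} t∈ → trans (∑-cong T λ {t′} _ → by-cases t t′ (t ≟ t′) (t′ ≟ t)) (trans (∑-+ T _ _)
               (cong₂ _+_ (trans (∑-δ _≟_ (k t) T-unique t∈) (ker-diagonal t (w t))) refl))) ⟩
        ∑ T (λ t → size + ∑ T (λ t′ → 𝟙 (distinct? (t , t′)) * k t t′))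
          ≡⟨ trans (∑-+ T _ _) (cong₂ _+_ (∑-const T size) (sym (trans (∑-filter distinct? (cartesianProduct T T) k′) (∑-cartesianProduct T T (λ p → 𝟙 (distinct? p) * k′ p))))) ⟩
        cast (length T) * size + ∑ pairs k′ ∎
        where
        open ≡-Reasoning
        k : Carrier → Carrier → ℚ
        k t t′ = ker t (w t) t′ (w t′)
        k′ : Carrier × Carrier → ℚ
        k′ (t , t′) = k t t′
        -- `∑-δ` decides t′ = t and `distinct?` decides t = t′, so two decisions have to be
        -- compared.
        by-cases : ∀ t t′ (d : Dec (t ≡ t′)) (d′ : Dec (t′ ≡ t)) → k t t′ ≡ 𝟙 d′ * k t t′ + 𝟙 (¬? d) * k t t′
        by-cases t t′ (yes e) (yes _)  = solve 1 (λ a → a := con 1ℚ :* a :+ con 0ℚ :* a) refl (k t t′)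
        by-cases t t′ (yes e) (no ¬e′) = ⊥-elim (¬e′ (sym e))
        by-cases t t′ (no ¬e) (yes e′) = ⊥-elim (¬e (sym e′))
        by-cases t t′ (no ¬e) (no _)   = solve 1 (λ a → a := con 0ℚ :* a :+ con 1ℚ :* a) refl (k t t′)

      -- The q - 2 diagonal terms and the 2 from the off-diagonal part add up to exactly q.
      Q≤ : Q ≤ cast q * size
      Q≤ = ≤-trans (≤-reflexive (trans Q-split (cong (cast (length T) * size +_) off-diagonal)))
        (≤-trans (+-monoʳ-≤ (cast (length T) * size) ∑-ratios≤) (≤-reflexive (begin
          cast (length T) * size + ofℕ 2 * size          ≡⟨ sym (*-distribʳ-+ size (cast (length T)) (ofℕ 2)) ⟩
          (cast (length T) + ofℕ 2) * size               ≡⟨ cong (λ z → (cast (length T) + z) * size) (sym (cast≡ofℕ 2)) ⟩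
          (cast (length T) + cast 2) * size              ≡⟨ cong (_* size) (trans (sym (cast-+ (length T) 2)) (cong cast (trans (ℕₚ.+-comm (length T) 2) length-T))) ⟩
          cast q * size                                  ∎)))
        where open ≡-Reasoning

      0≤variance : ∀ l → 0ℚ ≤ variance 2<q F l
      0≤variance l = 0≤* (0≤* (0≤inv l) (0≤inv l)) (0≤∑ (μ l) λ {x} _ → 0≤∑ (μ l) λ {y} _ → 0≤p² (deviation 2<q F l x y))

      -- The factors l² - 1 of `size` are paired with the variances at the same primes, where
      -- `variance-bound` applies to each product.
      E²≤ : E * E ≤ cast q * (∏ D (spread 2<q F) * ∏ D (spread 2<q F))
      E²≤ = ≤-trans E²≤variance*Q (≤-trans (*-monoˡ (0≤∏ D λ {l} _ → 0≤variance l) Q≤)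
        (≤-trans (≤-reflexive (trans (solve 3 (λ a b c → a :* (b :* c) := b :* (c :* a)) refl (∏ D (variance 2<q F)) (cast q) size)
            (cong (cast q *_) (sym (∏-* D (kernelSize 2<q F) (variance 2<q F))))))
          (*-monoˡ (0≤cast q) (≤-trans (∏-mono D (λ {l} l∈ → 0≤* (1≤ℓ² 2<q F (prime∈ l∈) (divides∈ l∈)) (0≤variance l))
              (λ l∈ → variance-bound 2<q F (prime∈ l∈) (divides∈ l∈)))
            (≤-reflexive (∏-* D (spread 2<q F) (spread 2<q F)))))))

      E-bound : ∀ {s} → 0ℚ ≤ s → cast q ≤ s * s → - (s * ∏ D (spread 2<q F)) ≤ E
      E-bound {s} 0≤s q≤s² = sq-cancel-≥ (0≤* 0≤s (0≤∏ D λ l∈ → 0≤spread 2<q F (prime∈ l∈) (divides∈ l∈)))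
        (≤-trans E²≤ (≤-trans (*-monoʳ (0≤p² (∏ D (spread 2<q F))) q≤s²)
          (≤-reflexive (solve 2 (λ s c → s :* s :* (c :* c) := (s :* c) :* (s :* c)) refl s (∏ D (spread 2<q F))))))

-- Expansion of the product over the primes of k into means and deviations.

module MainExpansion where

  open import Defs using (FiniteField)
  open import Data.Nat as ℕ using (ℕ)
  open import Data.Rational hiding (_≟_)
  open import Data.Rational.Properties hiding (_≟_)
  open import Data.Rational.Solver
  open import Data.List using (List; []; _∷_; _++_; length)
  open import Data.List.Properties using (++-identityʳ)
  open import Data.List.Relation.Binary.Permutation.Propositional using (_↭_; ↭-sym; ↭⇒↭ₛ)
  open import Data.List.Relation.Binary.Permutation.Propositional.Properties using (All-resp-↭; shift)
  import Data.List.Relation.Binary.Permutation.Setoid.Properties as Permutationₛ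
  open import Relation.Binary.PropositionalEquality
  open Rationals
  open FiniteSums
  open FieldArithmetic
  open ResidueAverages
  open LocalMoments
  open LinePoints
  open KernelBound

  open +-*-Solver

  module Expand {q : ℕ} (2<q : 2 ℕ.< q) (F : FiniteField q) (u v : FiniteField.Carrier F)
                (u≢0 : u ≢ FiniteField.0# F) (v≢0 : v ≢ FiniteField.0# F) where

    open Lemmas 2<q F using (Carrier; π)
    open Lines 2<q F u v u≢0 v≢0 using (T; w)

    PrimesOfOrder-resp-↭ : ∀ {ls ls′} → ls ↭ ls′ → PrimesOfOrder 2<q F ls → PrimesOfOrder 2<q F ls′
    PrimesOfOrder-resp-↭ p (primesOfOrder d P n) =
      primesOfOrder (Permutationₛ.Unique-resp-↭ (setoid ℕ) (↭⇒↭ₛ p) d) (All-resp-↭ p P) (All-resp-↭ p n)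

    prop dev : Carrier → ℕ → ℚ
    prop t l = proportion 2<q F l (π l t) (π l (w t))
    dev  t l = deviation 2<q F l (π l t) (π l (w t))

    mean′ spread′ bound : ℕ → ℚ
    mean′    = mean 2<q F
    spread′  = spread 2<q F
    bound l = mean′ l + spread′ l

    -- The state of a partial expansion: the primes in ls are still to be expanded, those in ds have
    -- already contributed their deviation.
    correlation : List ℕ → List ℕ → ℚ
    correlation ls ds = ∑ T (λ t → ∏ ls (prop t) * ∏ ds (dev t))

    correlation-step : ∀ l ls ds → correlation (l ∷ ls) ds ≡ mean′ l * correlation ls ds + correlation ls (l ∷ ds)
    correlation-step l ls ds = begin
      ∑ T (λ t → prop t l * ∏ ls (prop t) * ∏ ds (dev t))
        ≡⟨ ∑-cong T (λ {t} _ → solve 4 (λ p m a b → p :* a :* b := m :* (a :* b) :+ a :* ((p :- m) :* b)) refl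
             (prop t l) (mean′ l) (∏ ls (prop t)) (∏ ds (dev t))) ⟩
      ∑ T (λ t → mean′ l * (∏ ls (prop t) * ∏ ds (dev t)) + ∏ ls (prop t) * (dev t l * ∏ ds (dev t)))
        ≡⟨ trans (∑-+ T _ _) (cong (_+ correlation ls (l ∷ ds)) (∑-*ˡ T (mean′ l) (λ t → ∏ ls (prop t) * ∏ ds (dev t)))) ⟩
      mean′ l * correlation ls ds + correlation ls (l ∷ ds) ∎
      where open ≡-Reasoning

    module _ {s : ℚ} (0≤s : 0ℚ ≤ s) (q≤s² : cast q ≤ s * s) where

      -- The next prime either gives its mean, which is nonnegative and so preserves the inequality,
      -- or joins the deviations. The two bounds add up to mean + spread, and once ls is exhausted
      -- the large sieve applies, as d keeps the list of deviations nonempty.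
      nontrivial-part : ∀ ls d ds → PrimesOfOrder 2<q F (ls ++ d ∷ ds) →
        - (s * (∏ (d ∷ ds) spread′ * ∏ ls bound)) ≤ correlation ls (d ∷ ds)
      nontrivial-part []       d ds P = subst₂ _≤_
        (cong (λ z → - (s * z)) (sym (*-identityʳ (∏ (d ∷ ds) spread′))))
        (∑-cong T λ {t} _ → sym (*-identityˡ (∏ (d ∷ ds) (dev t))))
        (LargeSieve.E-bound 2<q F u v u≢0 v≢0 P 0≤s q≤s²)
      nontrivial-part (l ∷ ls) d ds P = ≤-trans
        (≤-reflexive (solve 5 (λ s c x m b → :- (s :* (c :* ((m :+ b) :* x))) := m :* (:- (s :* (c :* x))) :+ :- (s :* (b :* c :* x))) refl
          s (∏ (d ∷ ds) spread′) (∏ ls bound) (mean′ l) (spread′ l)))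
        (≤-trans (+-mono-≤ (*-monoˡ (0≤mean 2<q F (headPrime 2<q F P) (headDivides 2<q F P)) (nontrivial-part ls d ds (tailPrimes 2<q F P)))
            (nontrivial-part ls l (d ∷ ds) (PrimesOfOrder-resp-↭ (↭-sym (shift l ls (d ∷ ds))) P)))
          (≤-reflexive (sym (correlation-step l ls (d ∷ ds)))))

      -- The same recursion with no deviation chosen yet. The branch that takes the mean at every
      -- prime is exact, so its product of means is taken out of the error term.
      lower-bound : ∀ ls → PrimesOfOrder 2<q F ls →
        cast (length T) * ∏ ls mean′ - s * (∏ ls bound - ∏ ls mean′) ≤ correlation ls []
      lower-bound []       P = ≤-reflexive (trans (solve 2 (λ n s → n :* con 1ℚ :- s :* (con 1ℚ :- con 1ℚ) := n :* (con 1ℚ :* con 1ℚ)) refl (cast (length T)) s)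
        (sym (∑-const T (1ℚ * 1ℚ))))
      lower-bound (l ∷ ls) P = ≤-trans
        (≤-reflexive (solve 6 (λ n s m b X M → n :* (m :* M) :- s :* ((m :+ b) :* X :- m :* M) :=
            m :* (n :* M :- s :* (X :- M)) :+ :- (s :* (b :* con 1ℚ :* X))) refl
          (cast (length T)) s (mean′ l) (spread′ l) (∏ ls bound) (∏ ls mean′)))
        (≤-trans (+-mono-≤ (*-monoˡ (0≤mean 2<q F (headPrime 2<q F P) (headDivides 2<q F P)) (lower-bound ls (tailPrimes 2<q F P)))
            (nontrivial-part ls l [] (PrimesOfOrder-resp-↭ (↭-sym (shift l ls [])) (subst (λ z → PrimesOfOrder 2<q F (l ∷ z)) (sym (++-identityʳ ls)) P))))
          (≤-reflexive (sym (correlation-step l ls []))))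

-- From the count of pairs to the sum over the line, and the sieving primes.

module SieveCount where

  open import Defs using (FiniteField; ofℕ)
  open import Data.Nat as ℕ using (ℕ)
  open import Data.Nat.Divisibility using (_∣_)
  open import Data.Nat.Primality using (Prime)
  open import Data.Rational hiding (_≟_)
  open import Data.Rational.Properties hiding (_≟_)
  open import Data.Rational.Solver
  open import Data.List using (List; []; _∷_; _++_; filter; cartesianProduct)
  open import Data.List.Membership.Propositional using (_∈_)
  open import Data.List.Membership.Propositional.Properties using (∈-++⁺ˡ; ∈-++⁺ʳ)
  open import Data.List.Relation.Unary.All as All using (All; []; _∷_)
  open import Data.List.Relation.Unary.Any using (here; there)
  open import Data.Product using (_×_; _,_; proj₁; proj₂)
  open import Data.Sum as Sum using (_⊎_; inj₁; inj₂)
  open import Data.Empty using (⊥-elim)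
  open import Relation.Nullary using (Dec; yes; no; ¬_)
  open import Relation.Binary.PropositionalEquality
  open Rationals
  open FiniteSums
  open FieldArithmetic
  open ResidueAverages
  open LocalMoments
  open LinePoints

  open +-*-Solver

  private variable
    A : Set

  -- Each factor of a product is recorded either as zero or as evidence for its condition. Such
  -- alternatives multiply, which avoids matching on all decisions at once.
  1-𝟙≡0⊎ : ∀ {P : Set} (d : Dec P) → (1ℚ - 𝟙 d ≡ 0ℚ) ⊎ (¬ P)
  1-𝟙≡0⊎ (yes _) = inj₁ refl
  1-𝟙≡0⊎ (no ¬p) = inj₂ ¬p

  *≡0⊎ : ∀ {P Q : Set} {p q : ℚ} → p ≡ 0ℚ ⊎ P → q ≡ 0ℚ ⊎ Q → p * q ≡ 0ℚ ⊎ P × Q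
  *≡0⊎ {q = q} (inj₁ p≡0) _          = inj₁ (trans (cong (_* q) p≡0) (*-zeroˡ q))
  *≡0⊎ {p = p} (inj₂ _)   (inj₁ q≡0) = inj₁ (trans (cong (p *_) q≡0) (*-zeroʳ p))
  *≡0⊎         (inj₂ x)   (inj₂ y)   = inj₂ (x , y)

  ∏≡0⊎ : ∀ (xs : List A) {f : A → ℚ} {P : A → Set} → (∀ x → f x ≡ 0ℚ ⊎ P x) → ∏ xs f ≡ 0ℚ ⊎ All P xs
  ∏≡0⊎ []       h = inj₂ []
  ∏≡0⊎ (x ∷ xs) h = Sum.map₂ (λ (p , ps) → p ∷ ps) (*≡0⊎ (h x) (∏≡0⊎ xs h))

  ≤𝟙 : ∀ {P Q : Set} {p} (d : Dec Q) → p ≤ 1ℚ → p ≡ 0ℚ ⊎ P → (P → Q) → p ≤ 𝟙 d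
  ≤𝟙 (yes _)  p≤1 _          _   = p≤1
  ≤𝟙 (no _)   _   (inj₁ p≡0) _   = ≤-reflexive p≡0
  ≤𝟙 (no ¬q)  _   (inj₂ x)   P⇒Q = ⊥-elim (¬q (P⇒Q x))

  ∏≤1 : ∀ (xs : List A) {f : A → ℚ} → (∀ {x} → x ∈ xs → 0ℚ ≤ f x) → (∀ {x} → x ∈ xs → f x ≤ 1ℚ) → ∏ xs f ≤ 1ℚ
  ∏≤1 []       0≤f f≤1 = ≤-refl
  ∏≤1 (x ∷ xs) 0≤f f≤1 = ≤-trans (p*q≤p (0≤f (here refl)) (∏≤1 xs (λ i → 0≤f (there i)) (λ i → f≤1 (there i)))) (f≤1 (here refl))

  -- Weierstrass' product inequality. The step rests on (1 - f) (1 - P) ≥ 0 for the head value f and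
  -- the product P of the rest, which holds whatever the sign of 1 - g; for instance 1 - 4/3 is
  -- negative.
  1-∑≤∏ : ∀ (xs : List A) {f g : A → ℚ} → (∀ {x} → x ∈ xs → 0ℚ ≤ f x) → (∀ {x} → x ∈ xs → f x ≤ 1ℚ) →
          (∀ {x} → x ∈ xs → 1ℚ - g x ≤ f x) → 1ℚ - ∑ xs g ≤ ∏ xs f
  1-∑≤∏ []       0≤f f≤1 1-g≤f = ≤-reflexive (+-identityʳ 1ℚ)
  1-∑≤∏ (x ∷ xs) {f} {g} 0≤f f≤1 1-g≤f = ≤-by-difference
    (0≤+ (≤⇒0≤- (1-∑≤∏ xs (λ i → 0≤f (there i)) (λ i → f≤1 (there i)) (λ i → 1-g≤f (there i))))
      (0≤+ (≤⇒0≤- (1-g≤f (here refl))) (0≤* (≤⇒0≤- (f≤1 (here refl))) (≤⇒0≤- (∏≤1 xs (λ i → 0≤f (there i)) (λ i → f≤1 (there i)))))))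
    (solve 4 (λ f g P S → f :* P :- (con 1ℚ :- (g :+ S)) := (P :- (con 1ℚ :- S)) :+ ((f :- (con 1ℚ :- g)) :+ (con 1ℚ :- f) :* (con 1ℚ :- P)))
      refl (f x) (g x) (∏ xs f) (∑ xs g))

  ∑-filter≤ : ∀ {P : A → Set} (P? : ∀ x → Dec (P x)) (xs : List A) {f : A → ℚ} → (∀ x → 0ℚ ≤ f x) → ∑ (filter P? xs) f ≤ ∑ xs f
  ∑-filter≤ P? xs {f} 0≤f = ≤-trans (≤-reflexive (∑-filter P? xs f)) (∑-mono xs λ {x} _ → indicator (P? x) (0≤f x))
    where
    indicator : ∀ {Q : Set} (d : Dec Q) {p} → 0ℚ ≤ p → 𝟙 d * p ≤ p
    indicator (yes _) {p} _   = ≤-reflexive (*-identityˡ p)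
    indicator (no _)  {p} 0≤p = ≤-trans (≤-reflexive (*-zeroˡ p)) 0≤p

  module Counting {q : ℕ} (2<q : 2 ℕ.< q) (F : FiniteField q) (u v : FiniteField.Carrier F)
                  (u≢0 : u ≢ FiniteField.0# F) (v≢0 : v ≢ FiniteField.0# F) where

    open Lemmas 2<q F using (Carrier; 0#; 1#; _⁻¹; _≟_; n; G; μ; π; elements; Primitive; UVPrimitive; uvPrimitive?)
      renaming (_*_ to infixl 7 _·_; _+_ to infixl 6 _⊕_; *-assoc to ·-assoc; *-comm to ·-comm; *-identityˡ to ·-identityˡ; *-identityʳ to ·-identityʳ)
    open Lines 2<q F u v u≢0 v≢0
    private module L = Lemmas 2<q F

    Nontrivial : Carrier → Carrier → Carrier → Set
    Nontrivial x y a = a ≢ 1# × a · x ≢ 1# × a · y ≢ 1# × y ≢ a · x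

    admissible≡0⊎ : ∀ x y a → admissible 2<q F x y a ≡ 0ℚ ⊎ Nontrivial x y a
    admissible≡0⊎ x y a = *≡0⊎ (1-𝟙≡0⊎ (a ≟ 1#)) (*≡0⊎ (1-𝟙≡0⊎ ((a · x) ≟ 1#)) (*≡0⊎ (1-𝟙≡0⊎ ((a · y) ≟ 1#)) (1-𝟙≡0⊎ (y ≟ (a · x)))))

    0≤admissible : ∀ x y a → 0ℚ ≤ admissible 2<q F x y a
    0≤admissible x y a = 0≤* (0≤δ̅ 2<q F a 1#) (0≤* (0≤δ̅ 2<q F (a · x) 1#) (0≤* (0≤δ̅ 2<q F (a · y) 1#) (0≤δ̅ 2<q F y (a · x))))

    admissible≤1 : ∀ x y a → admissible 2<q F x y a ≤ 1ℚ
    admissible≤1 x y a = ≤-trans (p*q≤p (0≤δ̅ 2<q F a 1#) (≤-trans (p*q≤p (0≤δ̅ 2<q F (a · x) 1#)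
      (≤-trans (p*q≤p (0≤δ̅ 2<q F (a · y) 1#) (δ̅≤1 2<q F y (a · x))) (δ̅≤1 2<q F (a · y) 1#))) (δ̅≤1 2<q F (a · x) 1#))) (δ̅≤1 2<q F a 1#)

    third : ∀ a t → (u · a) ⊕ (v · (a · t)) ≡ a · w t
    third a t = L.solve 4 (λ u v a t → (u L.:* a) L.:+ (v L.:* (a L.:* t)) L.:= a L.:* (u L.:+ v L.:* t)) refl u v a t

    -- Multiplication by a t clears both inverses, so no formula for the inverse of a product is
    -- required.
    fourth : ∀ {a t} → a ≢ 0# → t ≢ 0# → (v · (a ⁻¹) ⊕ u · ((a · t) ⁻¹)) · (a · t) ≡ w t
    fourth {a} {t} a≢0 t≢0 = begin
      (v · (a ⁻¹) ⊕ u · ((a · t) ⁻¹)) · (a · t)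
        ≡⟨ L.solve 6 (λ u v a t i j → (v L.:* i L.:+ u L.:* j) L.:* (a L.:* t) L.:= u L.:* ((a L.:* t) L.:* j) L.:+ v L.:* t L.:* (a L.:* i)) refl
             u v a t (a ⁻¹) ((a · t) ⁻¹) ⟩
      u · ((a · t) · ((a · t) ⁻¹)) ⊕ v · t · (a · (a ⁻¹))
        ≡⟨ cong₂ (λ x y → u · x ⊕ v · t · y) (L.inverseʳ (a · t) (L.*-≢0 a≢0 t≢0)) (L.inverseʳ a a≢0) ⟩
      u · 1# ⊕ v · t · 1#
        ≡⟨ cong₂ _⊕_ (·-identityʳ u) (·-identityʳ (v · t)) ⟩
      w t ∎
      where open ≡-Reasoning

    module _ {ls : List ℕ} (complete : ∀ {l} → Prime l → l ∣ n → l ∈ ls) where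

      uvPrimitive-criterion : ∀ {a t} → a ∈ G → t ∈ T → All (λ l → Nontrivial (π l t) (π l (w t)) (π l a)) ls →
                              UVPrimitive u v (a , a · t)
      uvPrimitive-criterion {a} {t} a∈ t∈ good =
          L.primitive-criterion a≢0 (λ pl l∣n → proj₁ (at pl l∣n))
        , L.primitive-criterion at≢0 (λ {l} pl l∣n e → proj₁ (proj₂ (at pl l∣n)) (trans (sym (L.π-* l a t)) e))
        , subst Primitive (sym (third a t)) (L.primitive-criterion (L.*-≢0 a≢0 wt≢0)
            (λ {l} pl l∣n e → proj₁ (proj₂ (proj₂ (at pl l∣n))) (trans (sym (L.π-* l a (w t))) e)))
        -- If `π l d` were 1, then `d*b` would give the excluded equality of the residues of w t and
        -- a t.
        , L.primitive-criterion d≢0 (λ {l} pl l∣n e → proj₂ (proj₂ (proj₂ (at pl l∣n)))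
            (trans (cong (π l) (sym d*b)) (trans (L.π-* l d (a · t)) (trans (cong (_· π l (a · t)) e)
              (trans (·-identityˡ (π l (a · t))) (L.π-* l a t))))))
        where
        a≢0 = L.∈G⇒≢0 a∈
        t≢0 = proj₁ (∈T⇒OnLine t∈)
        wt≢0 = proj₂ (∈T⇒OnLine t∈)
        at≢0 = L.*-≢0 a≢0 t≢0
        at : ∀ {l} → Prime l → l ∣ n → Nontrivial (π l t) (π l (w t)) (π l a)
        at pl l∣n = All.lookup good (complete pl l∣n)
        d : Carrier
        d = v · (a ⁻¹) ⊕ u · ((a · t) ⁻¹)
        d*b : d · (a · t) ≡ w t
        d*b = fourth a≢0 t≢0
        d≢0 : d ≢ 0#
        d≢0 d≡0 = wt≢0 (trans (sym d*b) (trans (cong (_· (a · t)) d≡0) (L.zeroˡ (a · t))))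

      indicator-bound : ∀ {a t} → a ∈ G → t ∈ T →
        ∏ ls (λ l → admissible 2<q F (π l t) (π l (w t)) (π l a)) ≤ 𝟙 (uvPrimitive? u v (a , a · t))
      indicator-bound {a} {t} a∈ t∈ = ≤𝟙 (uvPrimitive? u v (a , a · t))
        (∏≤1 ls (λ {l} _ → 0≤admissible (π l t) (π l (w t)) (π l a)) (λ {l} _ → admissible≤1 (π l t) (π l (w t)) (π l a)))
        (∏≡0⊎ ls (λ l → admissible≡0⊎ (π l t) (π l (w t)) (π l a)))
        (uvPrimitive-criterion a∈ t∈)

      N-as-sum : cast (L.N u v) ≡ ∑ elements (λ a → ∑ elements (λ b → 𝟙 (uvPrimitive? u v (a , b))))
      N-as-sum = begin
        cast (L.N u v)
          ≡⟨ length-∑ (filter (uvPrimitive? u v) (cartesianProduct elements elements)) ⟩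
        ∑ (filter (uvPrimitive? u v) (cartesianProduct elements elements)) (λ _ → 1ℚ)
          ≡⟨ ∑-filter (uvPrimitive? u v) (cartesianProduct elements elements) (λ _ → 1ℚ) ⟩
        ∑ (cartesianProduct elements elements) (λ p → 𝟙 (uvPrimitive? u v p) * 1ℚ)
          ≡⟨ ∑-cong (cartesianProduct elements elements) (λ {p} _ → *-identityʳ (𝟙 (uvPrimitive? u v p))) ⟩
        ∑ (cartesianProduct elements elements) (λ p → 𝟙 (uvPrimitive? u v p))
          ≡⟨ ∑-cartesianProduct elements elements (λ p → 𝟙 (uvPrimitive? u v p)) ⟩
        ∑ elements (λ a → ∑ elements (λ b → 𝟙 (uvPrimitive? u v (a , b)))) ∎
        where open ≡-Reasoning

      ∑-elements-scale : ∀ {a} → a ≢ 0# → (f : Carrier → ℚ) → ∑ elements (λ t → f (a · t)) ≡ ∑ elements f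
      ∑-elements-scale {a} a≢0 = ∑-reindex (a ·_) (a ⁻¹ ·_) L.elements-unique L.elements-unique (λ _ → L.∈-elements _) (λ _ → L.∈-elements _)
        (λ {x} _ → L.x⁻¹*[x*y]≡y x a≢0) (λ {y} _ → L.x*[x⁻¹*y]≡y y a≢0)

      -- Of the formula for N only this direction is needed: a = 0 and the points off the line are
      -- discarded, primitivity is used only through the sufficient criterion, and b = a t merely
      -- permutes the field for fixed a ≠ 0.
      sieve : PrimesOfOrder 2<q F ls →
        cast n * ∑ T (λ t → ∏ ls (λ l → proportion 2<q F l (π l t) (π l (w t)))) ≤ cast (L.N u v)
      sieve P = ≤-trans (≤-reflexive (trans (sym (∑-*ˡ T (cast n) _)) (trans (∑-cong T λ {t} _ →
          sym (average 2<q F P (λ l → admissible 2<q F (π l t) (π l (w t))))) (∑-swap T G _))))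
        (≤-trans (∑-mono G λ {a} a∈ → ≤-trans (∑-mono T λ t∈ → indicator-bound a∈ t∈)
            (≤-trans (∑-filter≤ onLine? elements (λ t → 0≤𝟙 (uvPrimitive? u v (a , a · t))))
              (≤-reflexive (∑-elements-scale (L.∈G⇒≢0 a∈) (λ b → 𝟙 (uvPrimitive? u v (a , b)))))))
          (≤-trans (∑-filter≤ _ elements (λ a → 0≤∑ elements λ {b} _ → 0≤𝟙 (uvPrimitive? u v (a , b))))
            (≤-reflexive (sym N-as-sum))))

    prime-sieve : ∀ {ps ks} → (∀ {l} → Prime l → l ∣ n → l ∈ ps ++ ks) → PrimesOfOrder 2<q F (ps ++ ks) →
      0ℚ ≤ 1ℚ - ofℕ 4 * ∑ ps inv →
      cast n * ((1ℚ - ofℕ 4 * ∑ ps inv) * ∑ T (λ t → ∏ ks (λ l → proportion 2<q F l (π l t) (π l (w t))))) ≤ cast (L.N u v)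
    prime-sieve {ps} {ks} complete P 0≤δ₄ = ≤-trans (*-monoˡ (0≤cast n) (≤-trans (≤-reflexive (sym (∑-*ˡ T δ₄ _)))
        (∑-mono T λ {t} t∈ → ≤-trans (*-monoʳ (0≤∏ ks λ l∈ → 0≤prop t (∈-++⁺ʳ ps l∈)) (δ₄≤∏ t∈))
          (≤-reflexive (sym (∏-++ ps ks (prop t)))))))
      (sieve complete P)
      where
      prop : Carrier → ℕ → ℚ
      prop t l = proportion 2<q F l (π l t) (π l (w t))
      δ₄ : ℚ
      δ₄ = 1ℚ - ofℕ 4 * ∑ ps inv
      prime∈ : ∀ {l} → l ∈ ps ++ ks → Prime l
      prime∈ = All.lookup (primes P)
      divides∈ : ∀ {l} → l ∈ ps ++ ks → l ∣ n
      divides∈ = All.lookup (divide P)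
      0≤prop : ∀ t {l} → l ∈ ps ++ ks → 0ℚ ≤ prop t l
      0≤prop t {l} l∈ = 0≤proportion 2<q F (prime∈ l∈) (divides∈ l∈) (π l t) (π l (w t))
      δ₄≤∏ : ∀ {t} → t ∈ T → δ₄ ≤ ∏ ps (prop t)
      δ₄≤∏ {t} t∈ = subst (_≤ ∏ ps (prop t)) (cong (λ z → 1ℚ - z) (∑-*ˡ ps (ofℕ 4) inv))
        (1-∑≤∏ ps (λ l∈ → 0≤prop t (∈-++⁺ˡ l∈))
          (λ {l} l∈ → proportion≤1 2<q F (prime∈ (∈-++⁺ˡ l∈)) (divides∈ (∈-++⁺ˡ l∈)) (π l (w t)) (π∈ (∈-++⁺ˡ l∈) t∈G))
          (λ {l} l∈ → 1-4r≤proportion 2<q F (prime∈ (∈-++⁺ˡ l∈)) (divides∈ (∈-++⁺ˡ l∈)) (π∈ (∈-++⁺ˡ l∈) t∈G) (π∈ (∈-++⁺ˡ l∈) wt∈G)))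
        where
        t∈G : t ∈ G
        t∈G = L.∈G (proj₁ (∈T⇒OnLine t∈))
        wt∈G : w t ∈ G
        wt∈G = L.∈G (proj₂ (∈T⇒OnLine t∈))
        π∈ : ∀ {l x} → l ∈ ps ++ ks → x ∈ G → π l x ∈ μ l
        π∈ l∈ x∈ = L.π∈μ (prime∈ l∈) (divides∈ l∈) x∈

-- Splitting a radical, and Euler's function of a product of distinct primes.

module SquarefreeFactors where

  open import Defs using (primeDivisors; φ)
  open import Data.Nat as ℕ using (ℕ; zero; suc; _∸_; _<_; _≤_; s≤s)
  import Data.Nat.Properties as ℕₚ
  open import Data.Nat.Coprimality using (coprime⇒gcd≡1; gcd≡1⇒coprime; coprime-divisor)
  open import Data.Nat.Divisibility
  open import Data.Nat.GCD using (gcd)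
  open import Data.Nat.Primality using (Prime; prime?; ¬prime[1]; prime⇒nonZero)
  open import Data.Nat.Primality.Factorisation using (factorisationHasAllPrimeFactors)
  open import Data.Nat.ListAction using (product)
  open import Data.Nat.ListAction.Properties using (product-↭; ∈⇒∣product)
  open import Data.Rational as Q using (ℚ; 1ℚ; _+_; _*_; _-_)
  import Data.Rational.Properties as Qₚ
  open import Data.Rational.Solver
  open import Data.List using ([]; _∷_; _++_; upTo; applyUpTo; filter)
  open import Data.List.Properties using (map-applyUpTo; length-upTo)
  open import Data.List.Membership.Propositional using (_∈_)
  open import Data.List.Membership.Propositional.Properties using (∈-∃++; ∈-filter⁺; ∈-filter⁻; ∈-upTo⁺; ∈-upTo⁻)
  open import Data.List.Relation.Binary.Permutation.Propositional using (_↭_; prep; ↭-trans; ↭-refl)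
  open import Data.List.Relation.Binary.Permutation.Propositional.Properties using (shift; All-resp-↭)
  open import Data.List.Relation.Unary.All as All using (All; []; _∷_)
  open import Data.List.Relation.Unary.AllPairs using ([]; _∷_)
  open import Data.List.Relation.Unary.Unique.Propositional using (Unique)
  open import Data.List.Relation.Unary.Unique.Propositional.Properties using (filter⁺; upTo⁺)
  open import Data.Product using (_×_; _,_; ∃; proj₁; proj₂)
  open import Data.Empty using (⊥-elim)
  open import Function using (_∘_)
  open import Relation.Nullary using (Dec; yes; no; ¬_)
  open import Relation.Nullary.Decidable using (_×-dec_)
  open import Relation.Binary.PropositionalEquality
  open Rationals
  open FiniteSums
  open FieldArithmetic using (prime≥1; prime-∤⇒coprime)

  open +-*-Solver

  primeDivisors-unique : ∀ m → Unique (primeDivisors m)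
  primeDivisors-unique m = filter⁺ (λ p → prime? p ×-dec (p ∣? m)) (upTo⁺ (suc m))

  ∈primeDivisors⁻ : ∀ {l} m → l ∈ primeDivisors m → Prime l × l ∣ m
  ∈primeDivisors⁻ m l∈ = proj₂ (∈-filter⁻ (λ p → prime? p ×-dec (p ∣? m)) {xs = upTo (suc m)} l∈)

  ∈primeDivisors⁺ : ∀ {l m} → 1 ≤ m → Prime l → l ∣ m → l ∈ primeDivisors m
  ∈primeDivisors⁺ {l} {m@(suc _)} _ pl l∣m = ∈-filter⁺ (λ p → prime? p ×-dec (p ∣? m)) (∈-upTo⁺ (s≤s (∣⇒≤ l∣m))) (pl , l∣m)

  -- Unique factorisation: each p in ps divides the product of ls, so it occurs in ls and can be
  -- moved to the front and cancelled. What remains of ls is the list of the primes of k.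
  split-factors : ∀ k ps {ls} → All Prime ps → All Prime ls → k ℕ.* product ps ≡ product ls →
                  ∃ λ ks → ls ↭ ps ++ ks × k ≡ product ks
  split-factors k [] {ls} _ _ e = ls , ↭-refl , trans (sym (ℕₚ.*-identityʳ k)) e
  split-factors k (p ∷ ps) {ls} (pp ∷ pps) pls e =
    let ys , zs , ls≡  = ∈-∃++ (factorisationHasAllPrimeFactors pp p∣ pls)
        ls↭            = subst (_↭ p ∷ ys ++ zs) (sym ls≡) (shift p ys zs)
        ks , rest↭ , k≡ = split-factors k ps pps (All.tail (All-resp-↭ ls↭ pls)) (cancel (product-↭ ls↭))
    in ks , ↭-trans ls↭ (prep p rest↭) , k≡
    where
    pull : k ℕ.* (p ℕ.* product ps) ≡ p ℕ.* (k ℕ.* product ps)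
    pull = trans (sym (ℕₚ.*-assoc k p (product ps))) (trans (cong (ℕ._* product ps) (ℕₚ.*-comm k p)) (ℕₚ.*-assoc p k (product ps)))
    p∣ : p ∣ product ls
    p∣ = subst (p ∣_) (trans (sym pull) e) (m∣m*n (k ℕ.* product ps))
    cancel : ∀ {m} → product ls ≡ p ℕ.* m → k ℕ.* product ps ≡ m
    cancel {m} e′ = ℕₚ.*-cancelˡ-≡ (k ℕ.* product ps) m p {{prime⇒nonZero pp}} (trans (sym pull) (trans e e′))

  primeDivisors-product : ∀ {ks} → Unique ks → All Prime ks → 1 ≤ product ks → primeDivisors (product ks) ↭ ks
  primeDivisors-product {ks} uks pks 1≤ = unique-↭ (primeDivisors-unique (product ks)) uks
    (λ l∈ → let pl , l∣ = ∈primeDivisors⁻ (product ks) l∈ in factorisationHasAllPrimeFactors pl l∣ pks)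
    (λ l∈ → ∈primeDivisors⁺ 1≤ (All.lookup pks l∈) (∈⇒∣product l∈))

  ∑-upTo-+ : ∀ a b (f : ℕ → ℚ) → ∑ (upTo (a ℕ.+ b)) f ≡ ∑ (upTo a) f + ∑ (upTo b) (λ i → f (a ℕ.+ i))
  ∑-upTo-+ zero    b f = sym (Qₚ.+-identityˡ _)
  ∑-upTo-+ (suc a) b f = begin
    f 0 + ∑ (applyUpTo suc (a ℕ.+ b)) f
      ≡⟨ cong (f 0 +_) (∑-suc (a ℕ.+ b) f) ⟩
    f 0 + ∑ (upTo (a ℕ.+ b)) (f ∘ suc)
      ≡⟨ cong (f 0 +_) (∑-upTo-+ a b (f ∘ suc)) ⟩
    f 0 + (∑ (upTo a) (f ∘ suc) + ∑ (upTo b) (λ i → f (suc a ℕ.+ i)))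
      ≡⟨ sym (Qₚ.+-assoc (f 0) _ _) ⟩
    f 0 + ∑ (upTo a) (f ∘ suc) + ∑ (upTo b) (λ i → f (suc a ℕ.+ i))
      ≡⟨ cong (λ z → f 0 + z + ∑ (upTo b) (λ i → f (suc a ℕ.+ i))) (sym (∑-suc a f)) ⟩
    f 0 + ∑ (applyUpTo suc a) f + ∑ (upTo b) (λ i → f (suc a ℕ.+ i)) ∎
    where
    open ≡-Reasoning
    ∑-suc : ∀ c (f : ℕ → ℚ) → ∑ (applyUpTo suc c) f ≡ ∑ (upTo c) (f ∘ suc)
    ∑-suc c f = trans (cong (λ xs → ∑ xs f) (sym (map-applyUpTo (λ i → i) suc c))) (∑-map suc (upTo c) f)

  ∑-upTo-* : ∀ a b (f : ℕ → ℚ) → ∑ (upTo (a ℕ.* b)) f ≡ ∑ (upTo a) (λ j → ∑ (upTo b) (λ i → f (j ℕ.* b ℕ.+ i)))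
  ∑-upTo-* zero    b f = refl
  ∑-upTo-* (suc a) b f = begin
    ∑ (upTo (b ℕ.+ a ℕ.* b)) f
      ≡⟨ ∑-upTo-+ b (a ℕ.* b) f ⟩
    ∑ (upTo b) f + ∑ (upTo (a ℕ.* b)) (λ i → f (b ℕ.+ i))
      ≡⟨ cong (∑ (upTo b) f +_) (trans (∑-upTo-* a b (λ i → f (b ℕ.+ i)))
           (∑-cong (upTo a) λ {j} _ → ∑-cong (upTo b) λ {i} _ → cong f (sym (ℕₚ.+-assoc b (j ℕ.* b) i)))) ⟩
    ∑ (upTo b) f + ∑ (upTo a) (λ j → ∑ (upTo b) (λ i → f (suc j ℕ.* b ℕ.+ i)))
      ≡⟨ cong (∑ (upTo b) f +_) (trans (sym (∑-map suc (upTo a) (λ j → ∑ (upTo b) (λ i → f (j ℕ.* b ℕ.+ i)))))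
           (cong (λ xs → ∑ xs (λ j → ∑ (upTo b) (λ i → f (j ℕ.* b ℕ.+ i)))) (map-applyUpTo (λ i → i) suc a))) ⟩
    ∑ (upTo (suc a)) (λ j → ∑ (upTo b) (λ i → f (j ℕ.* b ℕ.+ i))) ∎
    where open ≡-Reasoning

  -- Shifted as in `φ`: the index i stands for the integer i + 1.
  coprimality : ℕ → ℕ → ℚ
  coprimality m i = 𝟙 (gcd (suc i) m ℕ.≟ 1)

  φ-as-sum : ∀ m → cast (φ m) ≡ ∑ (upTo m) (coprimality m)
  φ-as-sum m = trans (length-∑ (filter (λ i → gcd (suc i) m ℕ.≟ 1) (upTo m)))
    (trans (∑-filter (λ i → gcd (suc i) m ℕ.≟ 1) (upTo m) (λ _ → 1ℚ)) (∑-cong (upTo m) λ {i} _ → Qₚ.*-identityʳ (coprimality m i)))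

  coprimality-periodic : ∀ m j i → coprimality m (j ℕ.* m ℕ.+ i) ≡ coprimality m i
  coprimality-periodic m j i = 𝟙-sym (gcd (suc (j ℕ.* m ℕ.+ i)) m ℕ.≟ 1) (gcd (suc i) m ℕ.≟ 1)
    (λ e → coprime⇒gcd≡1 λ {d} (d∣i , d∣m) → gcd≡1⇒coprime {suc (j ℕ.* m ℕ.+ i)} e
      (subst (d ∣_) (ℕₚ.+-suc (j ℕ.* m) i) (∣m∣n⇒∣m+n (∣n⇒∣m*n j d∣m) d∣i) , d∣m))
    (λ e → coprime⇒gcd≡1 λ {d} (d∣ , d∣m) → gcd≡1⇒coprime {suc i} e
      (∣m+n∣m⇒∣n (subst (d ∣_) (sym (ℕₚ.+-suc (j ℕ.* m) i)) d∣) (∣n⇒∣m*n j d∣m) , d∣m))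

  module _ {l m : ℕ} (pl : Prime l) (l∤m : ¬ l ∣ m) where

    coprime-lm⁺ : ∀ {x} → gcd x m ≡ 1 → ¬ l ∣ x → gcd x (l ℕ.* m) ≡ 1
    coprime-lm⁺ {x} e l∤x = coprime⇒gcd≡1 λ {d} (d∣x , d∣lm) → gcd≡1⇒coprime {x} e (d∣x ,
      coprime-divisor {d} {l} (λ (e∣d , e∣l) → prime-∤⇒coprime pl l∤x (∣-trans e∣d d∣x , e∣l)) d∣lm)

    coprime-lm⁻ : ∀ {x} → gcd x (l ℕ.* m) ≡ 1 → gcd x m ≡ 1 × ¬ l ∣ x
    coprime-lm⁻ {x} e = coprime⇒gcd≡1 (λ (d∣x , d∣m) → gcd≡1⇒coprime {x} e (d∣x , ∣n⇒∣m*n l d∣m)) ,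
      λ l∣x → ¬prime[1] (subst Prime (gcd≡1⇒coprime {x} e (l∣x , m∣m*n m)) pl)

    coprime-scaled : ∀ x → gcd (x ℕ.* l) m ≡ 1 → gcd x m ≡ 1
    coprime-scaled x e = coprime⇒gcd≡1 λ (d∣x , d∣m) → gcd≡1⇒coprime {x ℕ.* l} e (∣m⇒∣m*n {m = x} l d∣x , d∣m)

    coprime-unscaled : ∀ x → gcd x m ≡ 1 → gcd (x ℕ.* l) m ≡ 1
    coprime-unscaled x e = coprime⇒gcd≡1 λ {d} (d∣xl , d∣m) → gcd≡1⇒coprime {x} e
      (coprime-divisor {d} {l} (λ (e∣d , e∣l) → prime-∤⇒coprime pl l∤m (∣-trans e∣d d∣m , e∣l)) (subst (d ∣_) (ℕₚ.*-comm x l) d∣xl) , d∣m)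

    coprimality-lm : ∀ i → coprimality (l ℕ.* m) i ≡ coprimality m i - 𝟙 (l ∣? suc i) * coprimality m i
    coprimality-lm i = by-cases (gcd (suc i) (l ℕ.* m) ℕ.≟ 1) (gcd (suc i) m ℕ.≟ 1) (l ∣? suc i)
      where
      by-cases : (a : Dec (gcd (suc i) (l ℕ.* m) ≡ 1)) (b : Dec (gcd (suc i) m ≡ 1)) (c : Dec (l ∣ suc i)) →
                 𝟙 a ≡ 𝟙 b - 𝟙 c * 𝟙 b
      by-cases (yes a) (yes b) (yes c) = ⊥-elim (proj₂ (coprime-lm⁻ {suc i} a) c)
      by-cases (yes a) (yes b) (no ¬c) = refl
      by-cases (yes a) (no ¬b) _       = ⊥-elim (¬b (proj₁ (coprime-lm⁻ {suc i} a)))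
      by-cases (no ¬a) (yes b) (yes c) = refl
      by-cases (no ¬a) (yes b) (no ¬c) = ⊥-elim (¬a (coprime-lm⁺ {suc i} b ¬c))
      by-cases (no ¬a) (no ¬b) (yes c) = refl
      by-cases (no ¬a) (no ¬b) (no ¬c) = refl

    private
      l≡ : suc (l ∸ 1) ≡ l
      l≡ = ℕₚ.m+[n∸m]≡n (prime≥1 pl)

    -- Among the integers j l + 1, ..., j l + l only the last, (j + 1) l, is a multiple of l. It is
    -- prime to m exactly when j + 1 is, because l does not divide m.
    multiples-in-block : ∀ j → ∑ (upTo l) (λ i → 𝟙 (l ∣? suc (j ℕ.* l ℕ.+ i)) * coprimality m (j ℕ.* l ℕ.+ i)) ≡ coprimality m j
    multiples-in-block j = begin
      ∑ (upTo l) (λ i → 𝟙 (l ∣? suc (j ℕ.* l ℕ.+ i)) * coprimality m (j ℕ.* l ℕ.+ i))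
        ≡⟨ ∑-cong (upTo l) (λ {i} i∈ → cong (_* coprimality m (j ℕ.* l ℕ.+ i))
             (𝟙-sym (l ∣? suc (j ℕ.* l ℕ.+ i)) (i ℕ.≟ l ∸ 1) (last (∈-upTo⁻ i∈)) last⁻)) ⟩
      ∑ (upTo l) (λ i → 𝟙 (i ℕ.≟ l ∸ 1) * coprimality m (j ℕ.* l ℕ.+ i))
        ≡⟨ ∑-δ ℕ._≟_ (λ i → coprimality m (j ℕ.* l ℕ.+ i)) (upTo⁺ l) (∈-upTo⁺ (ℕₚ.≤-reflexive l≡)) ⟩
      coprimality m (j ℕ.* l ℕ.+ (l ∸ 1))
        ≡⟨ 𝟙-sym (gcd (suc (j ℕ.* l ℕ.+ (l ∸ 1))) m ℕ.≟ 1) (gcd (suc j) m ℕ.≟ 1)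
             (λ e → coprime-scaled (suc j) (subst (λ z → gcd z m ≡ 1) end e))
             (λ e → subst (λ z → gcd z m ≡ 1) (sym end) (coprime-unscaled (suc j) e)) ⟩
      coprimality m j ∎
      where
      open ≡-Reasoning
      end : suc (j ℕ.* l ℕ.+ (l ∸ 1)) ≡ suc j ℕ.* l
      end = trans (sym (ℕₚ.+-suc (j ℕ.* l) (l ∸ 1))) (trans (cong (j ℕ.* l ℕ.+_) l≡) (ℕₚ.+-comm (j ℕ.* l) l))
      last : ∀ {i} → i < l → l ∣ suc (j ℕ.* l ℕ.+ i) → i ≡ l ∸ 1
      last {i} i<l l∣ = ℕₚ.suc-injective (trans (ℕₚ.≤-antisym i<l
        (∣⇒≤ (∣m+n∣m⇒∣n (subst (l ∣_) (sym (ℕₚ.+-suc (j ℕ.* l) i)) l∣) (n∣m*n j)))) (sym l≡))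
      last⁻ : ∀ {i} → i ≡ l ∸ 1 → l ∣ suc (j ℕ.* l ℕ.+ i)
      last⁻ refl = subst (l ∣_) (sym end) (n∣m*n (suc j))

    -- By periodicity l φ(m) of the integers up to l m are prime to m. Exactly φ(m) of these are
    -- multiples of l and have to be removed.
    φ-prime-* : cast (φ (l ℕ.* m)) ≡ (cast l - 1ℚ) * cast (φ m)
    φ-prime-* = begin
      cast (φ (l ℕ.* m))
        ≡⟨ trans (φ-as-sum (l ℕ.* m)) (∑-cong (upTo (l ℕ.* m)) λ {i} _ → coprimality-lm i) ⟩
      ∑ (upTo (l ℕ.* m)) (λ i → coprimality m i - 𝟙 (l ∣? suc i) * coprimality m i)
        ≡⟨ ∑-- (upTo (l ℕ.* m)) _ _ ⟩
      ∑ (upTo (l ℕ.* m)) (coprimality m) - ∑ (upTo (l ℕ.* m)) (λ i → 𝟙 (l ∣? suc i) * coprimality m i)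
        ≡⟨ cong₂ _-_ all multiples ⟩
      cast l * cast (φ m) - cast (φ m)
        ≡⟨ solve 2 (λ l p → l :* p :- p := (l :- con 1ℚ) :* p) refl (cast l) (cast (φ m)) ⟩
      (cast l - 1ℚ) * cast (φ m) ∎
      where
      open ≡-Reasoning
      all : ∑ (upTo (l ℕ.* m)) (coprimality m) ≡ cast l * cast (φ m)
      all = trans (∑-upTo-* l m (coprimality m)) (trans (∑-cong (upTo l) λ {j} _ →
          trans (∑-cong (upTo m) λ {i} _ → coprimality-periodic m j i) (sym (φ-as-sum m)))
        (trans (∑-const (upTo l) (cast (φ m))) (cong (λ z → cast z * cast (φ m)) (length-upTo l))))
      multiples : ∑ (upTo (l ℕ.* m)) (λ i → 𝟙 (l ∣? suc i) * coprimality m i) ≡ cast (φ m)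
      -- All integers were counted in l blocks of length m; for the multiples of l the same range is
      -- cut into m blocks of length l.
      multiples = trans (cong (λ z → ∑ (upTo z) (λ i → 𝟙 (l ∣? suc i) * coprimality m i)) (ℕₚ.*-comm l m))
        (trans (∑-upTo-* m l (λ i → 𝟙 (l ∣? suc i) * coprimality m i))
          (trans (∑-cong (upTo m) λ {j} _ → multiples-in-block j) (sym (φ-as-sum m))))

  φ-product : ∀ {ks} → Unique ks → All Prime ks → cast (φ (product ks)) ≡ ∏ ks (λ l → cast l - 1ℚ)
  φ-product [] [] = cast-1
  φ-product {l ∷ ks} (l∉ ∷ u) (pl ∷ pks) = trans
    (φ-prime-* pl (λ l∣ → All.lookup l∉ (factorisationHasAllPrimeFactors pl l∣ pks) refl))
    (cong ((cast l - 1ℚ) *_) (φ-product u pks))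

  cast-product : ∀ ks → cast (product ks) ≡ ∏ ks cast
  cast-product []       = cast-1
  cast-product (l ∷ ks) = trans (cast-* l (product ks)) (cong (cast l *_) (cast-product ks))

-- Translation into θ, τ and W, and the bound for q ≥ 4.

module Assembly where

  open import Defs using (FiniteField; ofℕ; frac; primeDivisors; θ; τ; W; φ; Rad; sumℚ)
  open import Data.Nat as ℕ using (ℕ; suc; _∸_)
  import Data.Nat.Properties as ℕₚ
  open import Data.Nat.Divisibility using (_∣_)
  open import Data.Nat.ListAction using (product)
  open import Data.Nat.Primality using (Prime)
  open import Data.Rational
  open import Data.Rational.Properties
  open import Data.Rational.Solver
  open import Data.List using (List; []; _∷_; _++_; map; length)
  open import Data.List.Membership.Propositional using (_∈_)
  open import Data.List.Relation.Binary.Permutation.Propositional using (_↭_)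
  open import Data.List.Relation.Binary.Permutation.Propositional.Properties using (∈-resp-↭; ↭-length)
  open import Data.List.Relation.Unary.All as All using (All; []; _∷_)
  open import Data.Product using (_×_; ∃; proj₁; proj₂)
  open import Relation.Binary.PropositionalEquality
  open Rationals
  open FiniteSums
  open FieldArithmetic
  open ResidueAverages
  open LocalMoments
  open LinePoints
  open MainExpansion
  open SieveCount
  open SquarefreeFactors

  open +-*-Solver

  inv-unique : ∀ {a} → 1 ℕ.≤ a → ∀ {x} → cast a * x ≡ 1ℚ → x ≡ inv a
  inv-unique {a} 1≤a {x} e = begin
    x                        ≡⟨ sym (*-identityˡ x) ⟩
    1ℚ * x                   ≡⟨ cong (_* x) (sym (cast*inv 1≤a)) ⟩
    cast a * inv a * x       ≡⟨ solve 3 (λ a i x → a :* i :* x := i :* (a :* x)) refl (cast a) (inv a) x ⟩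
    inv a * (cast a * x)     ≡⟨ trans (cong (inv a *_) e) (*-identityʳ (inv a)) ⟩
    inv a                    ∎
    where open ≡-Reasoning

  inv-* : ∀ {a b} → 1 ℕ.≤ a → 1 ℕ.≤ b → inv (a ℕ.* b) ≡ inv a * inv b
  inv-* {a} {b} 1≤a 1≤b = sym (inv-unique (ℕₚ.*-mono-≤ 1≤a 1≤b) (begin
    cast (a ℕ.* b) * (inv a * inv b)          ≡⟨ cong (_* (inv a * inv b)) (cast-* a b) ⟩
    cast a * cast b * (inv a * inv b)         ≡⟨ solve 4 (λ a b i j → a :* b :* (i :* j) := (a :* i) :* (b :* j)) refl (cast a) (cast b) (inv a) (inv b) ⟩
    cast a * inv a * (cast b * inv b)         ≡⟨ cong₂ _*_ (cast*inv 1≤a) (cast*inv 1≤b) ⟩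
    1ℚ * 1ℚ                                   ≡⟨⟩
    1ℚ                                        ∎))
    where open ≡-Reasoning

  τ-factor : ℕ → ℚ
  τ-factor l = (1ℚ - frac 1 (l ∸ 1)) + frac 1 ((l ∸ 1) ℕ.* (l ∸ 1))

  cubedWeight : ∀ {A : Set} (xs : List A) → let w = 2 ℕ.^ length xs in cast (w ℕ.* w ℕ.* w) ≡ ∏ xs (λ _ → ofℕ 8)
  cubedWeight xs = trans (trans (cast-* (w ℕ.* w) w) (cong (_* cast w) (cast-* w w))) (trans (cong (λ z → z * z * z) (cast-2^ xs))
      (trans (cong (_* twos) (sym (∏-* xs (λ _ → ofℕ 2) (λ _ → ofℕ 2)))) (sym (∏-* xs (λ _ → ofℕ 2 * ofℕ 2) (λ _ → ofℕ 2)))))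
    where
    w : ℕ
    w = 2 ℕ.^ length xs
    twos : ℚ
    twos = ∏ xs (λ _ → ofℕ 2)
    cast-2^ : ∀ {A : Set} (xs : List A) → cast (2 ℕ.^ length xs) ≡ ∏ xs (λ _ → ofℕ 2)
    cast-2^ []       = cast-1
    cast-2^ (x ∷ xs) = trans (cast-* 2 (2 ℕ.^ length xs)) (cong₂ _*_ (cast≡ofℕ 2) (cast-2^ xs))

  2≤sqrt : ∀ {q s} → 4 ℕ.≤ q → 0ℚ ≤ s → ofℕ q ≤ s * s → ofℕ 2 ≤ s
  2≤sqrt {q} {s} 4≤q 0≤s q≤s² = sq-cancel-≤ 0≤s (≤-trans (subst₂ _≤_ (cast≡ofℕ 4) (cast≡ofℕ q) (cast-mono 4≤q)) q≤s²)

  module _ {q : ℕ} (2<q : 2 ℕ.< q) (F : FiniteField q) where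

    open Lemmas 2<q F using (n)
    private module L = Lemmas 2<q F

    dropPrimes : ∀ ps {ks} → PrimesOfOrder 2<q F (ps ++ ks) → PrimesOfOrder 2<q F ks
    dropPrimes []       P = P
    dropPrimes (p ∷ ps) P = dropPrimes ps (tailPrimes 2<q F P)

    primeDivisors-n : PrimesOfOrder 2<q F (primeDivisors n)
    primeDivisors-n = primesOfOrder (primeDivisors-unique n) (All.tabulate (λ l∈ → proj₁ (∈primeDivisors⁻ n l∈)))
      (All.tabulate (λ l∈ → proj₂ (∈primeDivisors⁻ n l∈)))

    mean≡ : ∀ {l} → Prime l → l ∣ n → mean 2<q F l ≡ density 2<q F l * density 2<q F l * density 2<q F l * τ-factor l
    mean≡ {l} pl l∣n = begin
      mean 2<q F l
        ≡⟨ mean-formula 2<q F pl l∣n ⟩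
      r * r * r * ((k + 1ℚ) * ((k + 1ℚ) * k + 1ℚ))
        -- The quadratic m² - m + 1 in m = l - 1 is made homogeneous by explicit ones. Replacing
        -- them by m i, with i the inverse of m, turns it into m² (1 - i + i²), whose last factor is
        -- that of τ.
        ≡⟨ cong (λ z → r * r * r * ((k + 1ℚ) * z)) (solve 2 (λ k o → (k :+ con 1ℚ) :* k :+ con 1ℚ :=
             (k :+ con 1ℚ) :* (k :+ con 1ℚ) :- (k :+ con 1ℚ) :* con 1ℚ :+ con 1ℚ :* con 1ℚ) refl k 1ℚ) ⟩
      r * r * r * ((k + 1ℚ) * ((k + 1ℚ) * (k + 1ℚ) - (k + 1ℚ) * 1ℚ + 1ℚ * 1ℚ))
        ≡⟨ cong₂ (λ m e → r * r * r * (m * (m * m - m * e + e * e))) k+1≡m (sym m*i≡1) ⟩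
      r * r * r * (m * (m * m - m * (m * i) + m * i * (m * i)))
        ≡⟨ solve 3 (λ r m i → r :* r :* r :* (m :* (m :* m :- m :* (m :* i) :+ m :* i :* (m :* i))) :=
             m :* r :* (m :* r) :* (m :* r) :* ((con 1ℚ :- i) :+ i :* i)) refl r m i ⟩
      m * r * (m * r) * (m * r) * ((1ℚ - i) + i * i)
        ≡⟨ cong₂ (λ d t → d * r * (d * r) * (d * r) * t) m≡ℓ-1 factor ⟩
      density 2<q F l * density 2<q F l * density 2<q F l * τ-factor l ∎
      where
      open ≡-Reasoning
      r k m i : ℚ
      r = inv l
      k = cast (l ∸ 2)
      m = cast (l ∸ 1)
      i = inv (l ∸ 1)
      1≤l-1 : 1 ℕ.≤ l ∸ 1
      1≤l-1 = ℕₚ.∸-monoˡ-≤ 1 (prime≥2 pl)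
      m*i≡1 : m * i ≡ 1ℚ
      m*i≡1 = cast*inv 1≤l-1
      k+1≡m : k + 1ℚ ≡ m
      k+1≡m = trans (+-comm k 1ℚ) (trans (sym (cast-suc (l ∸ 2))) (cong cast (trans (cong suc (sym (ℕₚ.∸-+-assoc l 1 1))) (ℕₚ.m+[n∸m]≡n 1≤l-1))))
      m≡ℓ-1 : m ≡ cast l - 1ℚ
      m≡ℓ-1 = trans (solve 1 (λ m → m := (con 1ℚ :+ m) :- con 1ℚ) refl m)
        (cong (_- 1ℚ) (trans (sym (cast-suc (l ∸ 1))) (cong cast (ℕₚ.m+[n∸m]≡n (prime≥1 pl)))))
      factor : (1ℚ - i) + i * i ≡ τ-factor l
      factor = cong₂ (λ a b → (1ℚ - a) + b) (inv≡frac (l ∸ 1)) (trans (sym (inv-* 1≤l-1 1≤l-1)) (inv≡frac ((l ∸ 1) ℕ.* (l ∸ 1))))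

    module _ {k ks} (1≤k : 1 ℕ.≤ k) (P : PrimesOfOrder 2<q F ks) (k≡ : k ≡ product ks) where

      private
        prime∈ : ∀ {l} → l ∈ ks → Prime l
        prime∈ = All.lookup (primes P)
        primeDivisors-k : primeDivisors k ↭ ks
        primeDivisors-k = subst (λ z → primeDivisors z ↭ ks) (sym k≡)
          (primeDivisors-product (distinct P) (primes P) (subst (1 ℕ.≤_) k≡ 1≤k))

      θ≡ : θ k ≡ ∏ ks (density 2<q F)
      θ≡ = begin
        θ k                                              ≡⟨ frac-cast 1≤k ⟩
        cast (φ k) * inv k                               ≡⟨ cong₂ _*_ (trans (cong (λ z → cast (φ z)) k≡) (φ-product (distinct P) (primes P))) inverse ⟩
        ∏ ks (λ l → cast l - 1ℚ) * ∏ ks inv              ≡⟨ sym (∏-* ks (λ l → cast l - 1ℚ) inv) ⟩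
        ∏ ks (density 2<q F)                             ∎
        where
        open ≡-Reasoning
        frac-cast : ∀ {a b} → 1 ℕ.≤ b → frac a b ≡ cast a * inv b
        frac-cast {a} {suc b} _ = frac≡cast*inv a b
        one : ∀ xs → ∏ xs (λ (_ : ℕ) → 1ℚ) ≡ 1ℚ
        one []       = refl
        one (x ∷ xs) = trans (*-identityˡ _) (one xs)
        inverse : inv k ≡ ∏ ks inv
        inverse = sym (inv-unique 1≤k (trans (cong (λ z → cast z * ∏ ks inv) k≡) (trans (cong (_* ∏ ks inv) (cast-product ks))
          (trans (sym (∏-* ks cast inv)) (trans (∏-cong ks λ l∈ → cast*inv (prime≥1 (prime∈ l∈))) (one ks))))))

      τ≡ : τ k ≡ ∏ ks τ-factor
      τ≡ = ∏-↭ τ-factor primeDivisors-k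

      W³≡ : ofℕ (W k ℕ.* W k ℕ.* W k) ≡ ∏ ks (λ _ → ofℕ 8)
      W³≡ = trans (sym (cast≡ofℕ (W k ℕ.* W k ℕ.* W k)))
        (trans (cong (λ m → cast (2 ℕ.^ m ℕ.* 2 ℕ.^ m ℕ.* 2 ℕ.^ m)) (↭-length primeDivisors-k)) (cubedWeight ks))

      private
        d : ℕ → ℚ
        d = density 2<q F

      θ³τ≡ : θ k * θ k * θ k * τ k ≡ ∏ ks (mean 2<q F)
      θ³τ≡ = begin
        θ k * θ k * θ k * τ k                                  ≡⟨ cong₂ (λ a b → a * a * a * b) θ≡ τ≡ ⟩
        ∏ ks d * ∏ ks d * ∏ ks d * ∏ ks τ-factor               ≡⟨ cong (λ z → z * ∏ ks d * ∏ ks τ-factor) (sym (∏-* ks d d)) ⟩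
        ∏ ks (λ l → d l * d l) * ∏ ks d * ∏ ks τ-factor        ≡⟨ cong (_* ∏ ks τ-factor) (sym (∏-* ks (λ l → d l * d l) d)) ⟩
        ∏ ks (λ l → d l * d l * d l) * ∏ ks τ-factor           ≡⟨ sym (∏-* ks (λ l → d l * d l * d l) τ-factor) ⟩
        ∏ ks (λ l → d l * d l * d l * τ-factor l)              ≡⟨ sym (∏-cong ks λ l∈ → mean≡ (prime∈ l∈) (All.lookup (divide P) l∈)) ⟩
        ∏ ks (mean 2<q F)                                      ∎
        where open ≡-Reasoning

      θ⁴W³≡ : θ k * θ k * θ k * (θ k * ofℕ (W k ℕ.* W k ℕ.* W k)) ≡ ∏ ks (λ l → mean 2<q F l + spread 2<q F l)
      θ⁴W³≡ = begin
        θ k * θ k * θ k * (θ k * ofℕ (W k ℕ.* W k ℕ.* W k))                 ≡⟨ cong₂ (λ a b → a * a * a * (a * b)) θ≡ W³≡ ⟩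
        ∏ ks d * ∏ ks d * ∏ ks d * (∏ ks d * ∏ ks (λ _ → ofℕ 8))            ≡⟨ solve 2 (λ a b → a :* a :* a :* (a :* b) := b :* (a :* a :* a :* a)) refl (∏ ks d) (∏ ks (λ _ → ofℕ 8)) ⟩
        ∏ ks (λ _ → ofℕ 8) * (∏ ks d * ∏ ks d * ∏ ks d * ∏ ks d)            ≡⟨ cong (∏ ks (λ _ → ofℕ 8) *_) (trans (cong (λ z → z * ∏ ks d * ∏ ks d) (sym (∏-* ks d d)))
                                                                                 (trans (cong (_* ∏ ks d) (sym (∏-* ks (λ l → d l * d l) d))) (sym (∏-* ks (λ l → d l * d l * d l) d)))) ⟩
        ∏ ks (λ _ → ofℕ 8) * ∏ ks (λ l → d l * d l * d l * d l)             ≡⟨ sym (∏-* ks (λ _ → ofℕ 8) (λ l → d l * d l * d l * d l)) ⟩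
        ∏ ks (λ l → ofℕ 8 * (d l * d l * d l * d l))                        ≡⟨ ∏-cong ks (λ {l} _ → solve 2 (λ e m → e := m :+ (e :- m)) refl
                                                                                 (ofℕ 8 * (d l * d l * d l * d l)) (mean 2<q F l)) ⟩
        ∏ ks (λ l → mean 2<q F l + spread 2<q F l)                          ∎
        where open ≡-Reasoning

    large-field : 4 ℕ.≤ q → (u v : FiniteField.Carrier F) → u ≢ FiniteField.0# F → v ≢ FiniteField.0# F →
      (k : ℕ) → 1 ℕ.≤ k → (ps : List ℕ) → All Prime ps → k ℕ.* product ps ≡ Rad (q ∸ 1) →
      0ℚ < 1ℚ - ofℕ 4 * sumℚ (map (frac 1) ps) →
      (s : ℚ) → 0ℚ ≤ s → ofℕ q ≤ s * s →
      (1ℚ - ofℕ 4 * sumℚ (map (frac 1) ps)) * (θ k * θ k * θ k) * ofℕ (q ∸ 1) *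
        (τ k * ofℕ q - θ k * ofℕ (W k ℕ.* W k ℕ.* W k) * s) ≤ ofℕ (FiniteField.N F u v)
    large-field 4≤q u v u≢0 v≢0 k 1≤k ps pps k*ps≡Rad 0<δ₄ s 0≤s q≤s²
      = subst₂ _≤_ refl (cast≡ofℕ (L.N u v)) (≤-trans (≤-reflexive target≡) (≤-trans main (subst (λ z → cast n * (z * C) ≤ cast (L.N u v)) δ₄≡
          (prime-sieve {ps} {ks} complete P (subst (0ℚ ≤_) (sym δ₄≡) 0≤δ₄)))))
      where
      open Lines 2<q F u v u≢0 v≢0 using (T; length-T)
      open Expand 2<q F u v u≢0 v≢0 using (PrimesOfOrder-resp-↭; correlation; lower-bound)
      open Counting 2<q F u v u≢0 v≢0 using (prime-sieve)
      splitting : ∃ λ ks → primeDivisors n ↭ ps ++ ks × k ≡ product ks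
      splitting = split-factors k ps pps (primes primeDivisors-n) k*ps≡Rad
      ks : List ℕ
      ks = proj₁ splitting
      P : PrimesOfOrder 2<q F (ps ++ ks)
      P = PrimesOfOrder-resp-↭ (proj₁ (proj₂ splitting)) primeDivisors-n
      Pks : PrimesOfOrder 2<q F ks
      Pks = dropPrimes ps P
      k≡ : k ≡ product ks
      k≡ = proj₂ (proj₂ splitting)
      complete : ∀ {l} → Prime l → l ∣ n → l ∈ ps ++ ks
      complete pl l∣n = ∈-resp-↭ (proj₁ (proj₂ splitting)) (∈primeDivisors⁺ (ℕₚ.<⇒≤ L.1<n) pl l∣n)
      δ₄ X Y C Θ : ℚ
      δ₄ = 1ℚ - ofℕ 4 * sumℚ (map (frac 1) ps)
      Θ = θ k * θ k * θ k
      X = ∏ ks (mean 2<q F)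
      Y = ∏ ks (λ l → mean 2<q F l + spread 2<q F l)
      C = ∑ T (λ t → ∏ ks (λ l → proportion 2<q F l (L.π l t) (L.π l (Lines.w 2<q F u v u≢0 v≢0 t))))
      0≤δ₄ : 0ℚ ≤ δ₄
      0≤δ₄ = <⇒≤ 0<δ₄
      δ₄≡ : 1ℚ - ofℕ 4 * ∑ ps inv ≡ δ₄
      δ₄≡ = cong (λ z → 1ℚ - ofℕ 4 * z) (∑-cong ps λ {p} _ → inv≡frac p)
      target≡ : δ₄ * Θ * ofℕ (q ∸ 1) * (τ k * ofℕ q - θ k * ofℕ (W k ℕ.* W k ℕ.* W k) * s) ≡ cast n * (δ₄ * (cast q * X - s * Y))
      target≡ = begin
        δ₄ * Θ * ofℕ (q ∸ 1) * (τ k * ofℕ q - θ k * V * s)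
          ≡⟨ cong₂ (λ a b → δ₄ * Θ * a * (τ k * b - θ k * V * s)) (sym (cast≡ofℕ n)) (sym (cast≡ofℕ q)) ⟩
        δ₄ * Θ * cast n * (τ k * cast q - θ k * V * s)
          ≡⟨ solve 7 (λ d T n q t V s → d :* T :* n :* (t :* q :- V :* s) := n :* (d :* (q :* (T :* t) :- s :* (T :* V))))
               refl δ₄ Θ (cast n) (cast q) (τ k) (θ k * V) s ⟩
        cast n * (δ₄ * (cast q * (Θ * τ k) - s * (Θ * (θ k * V))))
          ≡⟨ cong₂ (λ a b → cast n * (δ₄ * (cast q * a - s * b))) (θ³τ≡ 1≤k Pks k≡) (θ⁴W³≡ 1≤k Pks k≡) ⟩
        cast n * (δ₄ * (cast q * X - s * Y)) ∎
        where
        open ≡-Reasoning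
        V : ℚ
        V = ofℕ (W k ℕ.* W k ℕ.* W k)
      0≤X : 0ℚ ≤ X
      0≤X = 0≤∏ ks λ l∈ → 0≤mean 2<q F (All.lookup (primes Pks) l∈) (All.lookup (divide Pks) l∈)
      q≡T+2 : cast q ≡ cast (length T) + ofℕ 2
      q≡T+2 = trans (cong cast (trans (sym length-T) (ℕₚ.+-comm 2 (length T)))) (trans (cast-+ (length T) 2) (cong (cast (length T) +_) (cast≡ofℕ 2)))
      -- With q = `length T` + 2 the two sides differ by (s - 2) X: the two missing points cost 2 X,
      -- and the exact branch of the expansion saves s X. This is where q ≥ 4 enters.
      absorb : cast q * X - s * Y ≤ cast (length T) * X - s * (Y - X)
      absorb = ≤-by-difference (0≤* (≤⇒0≤- (2≤sqrt {q} 4≤q 0≤s q≤s²)) 0≤X)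
        (trans (cong (λ z → cast (length T) * X - s * (Y - X) - (z * X - s * Y)) q≡T+2)
          (solve 4 (λ t s X Y → t :* X :- s :* (Y :- X) :- ((t :+ con (ofℕ 2)) :* X :- s :* Y) := (s :- con (ofℕ 2)) :* X) refl (cast (length T)) s X Y))
      main : cast n * (δ₄ * (cast q * X - s * Y)) ≤ cast n * (δ₄ * C)
      main = *-monoˡ (0≤cast n) (*-monoˡ 0≤δ₄ (≤-trans absorb (≤-trans
        (lower-bound 0≤s (subst (_≤ s * s) (sym (cast≡ofℕ q)) q≤s²) ks Pks)
        (≤-reflexive (∑-cong T λ {t} _ → *-identityʳ _)))))

-- The field with three elements, where √q < 2.

module SmallField where

  open import Defs using (FiniteField; ofℕ; frac; primeDivisors; θ; τ; W; Rad; sumℚ)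
  open import Data.Nat as ℕ using (ℕ)
  import Data.Nat.Properties as ℕₚ
  open import Data.Nat.ListAction using (product)
  open import Data.Nat.Primality using (Prime)
  open import Data.Rational
  open import Data.Rational.Properties
  open import Data.Rational.Solver
  open import Data.List using (List; []; _∷_; map)
  open import Data.List.Properties using (∷-injective; ++-conicalˡ)
  open import Data.List.Relation.Binary.Permutation.Propositional using (↭-sym)
  open import Data.List.Relation.Binary.Permutation.Propositional.Properties using (↭-singleton-inv)
  open import Data.List.Relation.Unary.All as All using (All; []; _∷_)
  open import Data.Product using (_×_; _,_; proj₁)
  open import Data.Sum using (_⊎_; inj₁; inj₂)
  open import Data.Empty using (⊥-elim)
  open import Relation.Nullary.Decidable using (from-yes; from-no)
  open import Relation.Binary.PropositionalEquality
  open Rationals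
  open SquarefreeFactors

  open +-*-Solver

  -- If q = 3 then either (k , ps) = (2 , []), where the bound is negative, or (k , ps) = (1 , 2 ∷ []), where δ₄ < 0.
  factors-of-2 : ∀ k ps → All Prime ps → k ℕ.* product ps ≡ Rad 2 → ps ≡ [] × k ≡ 2 ⊎ ps ≡ 2 ∷ []
  factors-of-2 k []       _   e = inj₁ (refl , trans (sym (ℕₚ.*-identityʳ k)) e)
  factors-of-2 k (p ∷ ps) pps e =
    let ks , p↭ , _ = split-factors k (p ∷ ps) {primeDivisors 2} pps (All.tabulate λ l∈ → proj₁ (∈primeDivisors⁻ 2 l∈)) e
        p≡2 , ps++ks≡[] = ∷-injective (↭-singleton-inv (↭-sym p↭))
    in inj₂ (cong₂ _∷_ p≡2 (++-conicalˡ ps ks ps++ks≡[]))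

  small-field : (F : FiniteField 3) (u v : FiniteField.Carrier F) →
    (k : ℕ) (ps : List ℕ) → All Prime ps → k ℕ.* product ps ≡ Rad 2 →
    0ℚ < 1ℚ - ofℕ 4 * sumℚ (map (frac 1) ps) →
    (s : ℚ) → 0ℚ ≤ s → ofℕ 3 ≤ s * s →
    (1ℚ - ofℕ 4 * sumℚ (map (frac 1) ps)) * (θ k * θ k * θ k) * ofℕ 2 *
      (τ k * ofℕ 3 - θ k * ofℕ (W k ℕ.* W k ℕ.* W k) * s) ≤ ofℕ (FiniteField.N F u v)
  small-field F u v k ps pps e 0<δ₄ s 0≤s 3≤s² = by-cases (factors-of-2 k ps pps e) 0<δ₄
    where
    1≤s : 1ℚ ≤ s
    1≤s = sq-cancel-≤ 0≤s (≤-trans (from-yes (1ℚ * 1ℚ ≤? ofℕ 3)) 3≤s²)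
    -- As θ(2) = 1/2, τ(2) = 1 and W(2)³ = 8, the left side is (3 - 4 s) / 8. Since 4 s - 3 = 3 (s -
    -- 1) + s, the crude bound s ≥ 1 suffices.
    bound≤0 : θ 2 * θ 2 * θ 2 * (τ 2 * ofℕ 3 - θ 2 * ofℕ (W 2 ℕ.* W 2 ℕ.* W 2) * s) ≤ 0ℚ
    bound≤0 = ≤-by-difference {d = ofℕ 3 * frac 1 8 * (s - 1ℚ) + frac 1 8 * s} (0≤+ (0≤* (0≤frac 3 8) (≤⇒0≤- 1≤s)) (0≤* (0≤frac 1 8) 0≤s))
      (solve 1 (λ s → con 0ℚ :- con (frac 1 8) :* (con (ofℕ 3) :- con (ofℕ 4) :* s) :=
        con (ofℕ 3 * frac 1 8) :* (s :- con 1ℚ) :+ con (frac 1 8) :* s) refl s)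
    by-cases : ∀ {k ps} → ps ≡ [] × k ≡ 2 ⊎ ps ≡ 2 ∷ [] → 0ℚ < 1ℚ - ofℕ 4 * sumℚ (map (frac 1) ps) →
      (1ℚ - ofℕ 4 * sumℚ (map (frac 1) ps)) * (θ k * θ k * θ k) * ofℕ 2 *
        (τ k * ofℕ 3 - θ k * ofℕ (W k ℕ.* W k ℕ.* W k) * s) ≤ ofℕ (FiniteField.N F u v)
    by-cases (inj₂ refl) 0<-1 = ⊥-elim (from-no (0ℚ <? 1ℚ - ofℕ 4 * sumℚ (map (frac 1) (2 ∷ []))) 0<-1)
    by-cases (inj₁ (refl , refl)) _ = ≤-trans (≤-reflexive
        (solve 1 (λ b → con (1ℚ * (θ 2 * θ 2 * θ 2)) :* con (ofℕ 2) :* b := con (ofℕ 2) :* (con (θ 2 * θ 2 * θ 2) :* b)) refl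
          (τ 2 * ofℕ 3 - θ 2 * ofℕ (W 2 ℕ.* W 2 ℕ.* W 2) * s)))
      (≤-trans (*-monoˡ (0≤frac 2 1) bound≤0) (0≤frac (FiniteField.N F u v) 1))

-- The cases q ≥ 4 and q = 3 combined.

open import Defs
open import Data.Nat using (ℕ; _<_; _≤_; _*_; _∸_)
import Data.Nat.Properties as ℕₚ
open import Data.Nat.Primality using (Prime)
open import Data.List using (List; map; foldr)
open import Data.List.Relation.Unary.All using (All)
open import Data.List.Relation.Unary.Unique.Propositional using (Unique)
open import Data.Rational using (ℚ; 0ℚ; 1ℚ; _+_; _-_)
import Data.Rational as Q
open import Data.Sum using (inj₁; inj₂)
open import Relation.Binary.PropositionalEquality using (_≡_; _≢_; refl)

theorem1p4 : (q : ℕ) → 2 < q → IsPrimePower q → (F : FiniteField q) →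
    (u v : FiniteField.Carrier F) → u ≢ FiniteField.0# F → v ≢ FiniteField.0# F →
    (k : ℕ) → 1 ≤ k → (ps : List ℕ) → All Prime ps → Unique ps →
    k * foldr _*_ 1 ps ≡ Rad (q ∸ 1) →
    0ℚ Q.< 1ℚ - ofℕ 4 Q.* sumℚ (map (frac 1) ps) →
    (s : ℚ) → 0ℚ Q.≤ s → ofℕ q Q.≤ s Q.* s →
    ((1ℚ - ofℕ 4 Q.* sumℚ (map (frac 1) ps)) Q.* (θ k Q.* θ k Q.* θ k)
    Q.* ofℕ (q ∸ 1)
    Q.* (τ k Q.* ofℕ q - θ k Q.* ofℕ (W k * W k * W k) Q.* s))
    Q.≤ ofℕ (FiniteField.N F u v)
theorem1p4 q 2<q _ F u v u≢0 v≢0 k 1≤k ps pps _ k*ps≡Rad 0<δ₄ s 0≤s q≤s² with ℕₚ.m≤n⇒m<n∨m≡n 2<q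
... | inj₁ 3<q  = Assembly.large-field 2<q F 3<q u v u≢0 v≢0 k 1≤k ps pps k*ps≡Rad 0<δ₄ s 0≤s q≤s²
... | inj₂ refl = SmallField.small-field F u v k ps pps k*ps≡Rad 0<δ₄ s 0≤s q≤s²
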